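{- Let $K,L,A$ be as in the context and suppose there is an $A$-scaffold on $L$ of tolerance $\mathfrak{T}$ with shift parameters $b_1,\dots,b_n$. Let $h\in\mathbb{Z}$, and let $\mathfrak{A}$, $b$, $d$, $w$, $\mathcal{D}$, $\mathcal{E}$ be as in the context, and assume $\mathfrak{T}\ge p^n+b-h$. Then the minimal number of generators of the $\mathfrak{A}$-module $\mathfrak{P}_L^h$ is $|\mathcal{D}|$. Also, $\mathfrak{A}$ is a (not necessarily commutative) local ring with residue field $\kappa=\mathfrak{O}_K/\mathfrak{P}_K$, and, writing $\mathfrak{M}$ for its unique maximal ideal, the embedding dimension $\dim_\kappa(\mathfrak{M}/\mathfrak{M}^2)$ of $\mathfrak{A}$ is $|\mathcal{E}|$.
   Context: Let $K$ be a field complete with respect to a discrete valuation, with residue field $\kappa$ of characteristic $p>0$ ($\kappa$ need not be perfect; $K$ may have characteristic $0$ or $p$). Let $L/K$ be a totally ramified field extension of degree $p^n$; $v_K,v_L$ normalized valuations, $\mathfrak{O}_K,\mathfrak{O}_L$ valuation rings, $\mathfrak{P}_K,\mathfrak{P}_L$ maximal ideals. Let $A$ be a $K$-algebra with $\dim_K A=p^n$ acting $K$-linearly on $L$, written $\alpha\cdot x$. Let $\mathbb{S}_{p^n}=\{0,\dots,p^n-1\}$; write $s=\sum_{i=1}^n s_{(n-i)}p^{n-i}$ with digits in $\{0,\dots,p-1\}$; $s\preceq t$ means $s_{(n-i)}\le t_{(n-i)}$ for all $i$, and $s\prec t$ means $s\preceq t$ and $s\neq t$. Given integers $b_1,\dots,b_n$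 prime to $p$, put $\mathfrak{b}(s)=\sum_i s_{(n-i)}p^{n-i}b_i$; for $t\in\mathbb{Z}$ let $\mathfrak{a}(t)\in\mathbb{S}_{p^n}$ be the unique element with $\mathfrak{b}(\mathfrak{a}(t))\equiv-t\pmod{p^n}$ (digits $\mathfrak{a}(t)_{(n-i)}$). An $A$-scaffold on $L$ of tolerance $\mathfrak{T}\ge1$ (possibly $\infty$) with shift parameters $b_1,\dots,b_n$ consists of: (i) $\lambda_t\in L$ ($t\in\mathbb{Z}$) with $v_L(\lambda_t)=t$ and $\lambda_{t_1}\lambda_{t_2}^{ -1}\in K$ whenever $t_1\equiv t_2\pmod{p^n}$; (ii) $\Psi_1,\dots,\Psi_n\in A$ with $\Psi_i\cdot1=0$ such that for each $i,t$ there is $u_{i,t}\in\mathfrak{O}_K^\times$ with $\Psi_i\cdot\lambda_t\equiv u_{i,t}\lambda_{t+p^{n-i}b_i}$ if $\mathfrak{a}(t)_{(n-i)}\ge1$ and $\equiv0$ if $\mathfrak{a}(t)_{(n-i)}=0$, modulo $\lambda_{t+p^{n-i}b_i}\mathfrak{P}_L^{\mathfrak{T}}$ (equalities if $\mathfrak{T}=\infty$). Fix $h\in\mathbb{Z}$; $\mathfrak{A}=\{\alpha\in A:\alpha\cdot\mathfrak{P}_L^h\subseteq\mathfrak{P}_L^h\}$. Let $b$ be the unique integer with $h\le b<h+p^n$ and $\mathfrak{a}(b)=p^n-1$. For $s\in\mathbb{S}_{p^n}$ let $d(s)=\lfloor(\mathfrak{b}(s)+b-h)/p^n\rfloor$ and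 $w(s)=\min\{d(u)-d(u-s):u\in\mathbb{S}_{p^n},\,u\succeq s\}$. Let $\mathcal{D}=\{u\in\mathbb{S}_{p^n}: d(u)>d(u-s)+w(s)\text{ for all }s\in\mathbb{S}_{p^n}\text{ with }0\prec s\preceq u\}$ and $\mathcal{E}=\{u\in\mathbb{S}_{p^n}: w(u)>w(u-s)+w(s)\text{ for all }s\in\mathbb{S}_{p^n}\text{ with }0\prec s\prec u\}$. -}

module Defs where

open import Level using (Level; _⊔_) renaming (suc to lsuc)
open import Algebra.Bundles using (CommutativeMonoid; Ring; CommutativeRing)
open import Algebra.Definitions.RawMonoid using (sum; _×_)
open import Algebra.Module.Bundles using (LeftModule)
open import Algebra.Module.Construct.TensorUnit using () renaming (leftModule to regularModule)
open import Algebra.Module.Structures using (IsLeftModule)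
open import Algebra.Morphism.Structures using (IsRingHomomorphism; IsRingIsomorphism)
import Algebra.Properties.AbelianGroup as AbelianGroupProperties
import Algebra.Properties.CommutativeSemigroup as CommutativeSemigroupProperties
import Algebra.Properties.Ring as RingProperties
open import Data.Empty using (⊥-elim)
open import Data.Fin.Base using (Fin; toℕ; fromℕ<)
import Data.Fin.Properties as Fin
open import Data.Integer.Base as ℤ using (ℤ; +_; -[1+_]; +≤+)
import Data.Integer.Divisibility.Signed as ℤ using (_∣_; _∣?_)
import Data.Integer.Properties as ℤ
open import Data.List.Base using (allFin; filter; length; map)
import Data.List.Extrema as Extrema
open import Data.Nat.Base as ℕ using (ℕ; NonZero; _^_; _∸_; z≤n)
open import Data.Nat.DivMod using (_/_; _%_)
import Data.Nat.Divisibility as ℕ using (_∣_)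
open import Data.Nat.Primality using (Prime; prime⇒nonZero)
import Data.Nat.Properties as ℕ
open import Data.Product.Base using (Σ; Σ-syntax; ∃; ∃-syntax; _,_; proj₁; proj₂) renaming (_×_ to _∧_)
open import Function.Bundles using (_⇔_; module Equivalence)
open import Relation.Binary.Construct.Add.Supremum.NonStrict ℤ._≤_ public using (_≤⁺_; [_]; _≤⊤⁺)
open import Relation.Binary.PropositionalEquality using (_≡_; _≢_; refl; sym; trans; cong; subst)
open import Relation.Nullary using (¬_; Dec; yes; no)
open import Relation.Nullary.Construct.Add.Supremum public using (_⁺; ⊤⁺; [_])
open import Relation.Nullary.Decidable using (_→-dec_; _×-dec_; ¬?)
open import Relation.Unary using (Pred; _∈_; _∉_; _⊆_; _≐_)

private
  variable
    c ℓ c′ ℓ′ k ℓk l ℓl a ℓa m ℓm ℓᴵ : Level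

------------------------------------------------------------------------
-- ℤ ∪ {∞}, the element ∞ being ⊤⁺

infixl 6 _+⁺_
_+⁺_ : ℤ ⁺ → ℤ ⁺ → ℤ ⁺
[ i ] +⁺ [ j ] = [ i ℤ.+ j ]
[ i ] +⁺ ⊤⁺    = ⊤⁺
⊤⁺    +⁺ _     = ⊤⁺

infixr 8 _·⁺_
_·⁺_ : ℕ → ℤ ⁺ → ℤ ⁺
e ·⁺ [ i ] = [ + e ℤ.* i ]
e ·⁺ ⊤⁺    = ⊤⁺

private
  ≤⁺-refl : ∀ x → x ≤⁺ x
  ≤⁺-refl [ i ] = [ ℤ.≤-refl ]
  ≤⁺-refl ⊤⁺    = ⊤⁺ ≤⊤⁺

  +⁺-mono-≤⁺ : ∀ {i j x y} → [ i ] ≤⁺ x → [ j ] ≤⁺ y → [ i ℤ.+ j ] ≤⁺ x +⁺ y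
  +⁺-mono-≤⁺ [ p ]      [ q ]      = [ ℤ.+-mono-≤ p q ]
  +⁺-mono-≤⁺ [ p ]      (_ ≤⊤⁺)    = _ ≤⊤⁺
  +⁺-mono-≤⁺ (_ ≤⊤⁺)    _          = _ ≤⊤⁺

  ·⁺-nonneg : ∀ e {x} → [ + 0 ] ≤⁺ x → [ + 0 ] ≤⁺ e ·⁺ x
  ·⁺-nonneg e (_ ≤⊤⁺) = _ ≤⊤⁺
  ·⁺-nonneg e ([_] {l = i} p) =
    [ subst (ℤ._≤ + e ℤ.* i) (ℤ.*-zeroʳ (+ e)) (ℤ.*-monoˡ-≤-nonNeg (+ e) p) ]

  +⁺-identityˡ : ∀ x → [ + 0 ] +⁺ x ≡ x
  +⁺-identityˡ [ i ] = cong [_] (ℤ.+-identityˡ i)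
  +⁺-identityˡ ⊤⁺    = refl

  []-injective : ∀ {i j : ℤ} → _≡_ {A = ℤ ⁺} [ i ] [ j ] → i ≡ j
  []-injective refl = refl

  i+i≡0⇒i≡0 : ∀ i → i ℤ.+ i ≡ + 0 → i ≡ + 0
  i+i≡0⇒i≡0 (+ ℕ.zero)  _  = refl
  i+i≡0⇒i≡0 (+ ℕ.suc n) ()
  i+i≡0⇒i≡0 -[1+ n ]    ()

------------------------------------------------------------------------
-- Modules

module _ {R : Ring c ℓ} (M : LeftModule R m ℓm) where
  open Ring R using (Carrier; _≈_; 0#)
  open LeftModule M

  linearCombination : ∀ {n} → (Fin n → Carrier) → (Fin n → Carrierᴹ) → Carrierᴹ
  linearCombination cs xs = sum +ᴹ-rawMonoid (λ i → cs i *ₗ xs i)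

  Generates : ∀ {n} → (Fin n → Carrierᴹ) → Set _
  Generates xs = ∀ x → ∃[ cs ] x ≈ᴹ linearCombination cs xs

  LinearlyIndependent : ∀ {n} → (Fin n → Carrierᴹ) → Set _
  LinearlyIndependent xs = ∀ cs → linearCombination cs xs ≈ᴹ 0ᴹ → ∀ i → cs i ≈ 0#

  HasDimension : ℕ → Set _
  HasDimension d = ∃[ xs ] Generates {d} xs ∧ LinearlyIndependent xs

  MinimalNumberOfGenerators : ℕ → Set _
  MinimalNumberOfGenerators d =
    (∃[ xs ] Generates {d} xs) ∧ (∀ n (xs : Fin n → Carrierᴹ) → Generates xs → d ℕ.≤ n)

module _ {R : Ring c ℓ} {S : Ring c′ ℓ′} (f : Ring.Carrier R → Ring.Carrier S)
         (f-homo : IsRingHomomorphism (Ring.rawRing R) (Ring.rawRing S) f)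
         where
  private
    module f = IsRingHomomorphism f-homo

  restrictScalars : LeftModule S m ℓm → LeftModule R m ℓm
  restrictScalars M = record
    { Carrierᴹ = Carrierᴹ
    ; _≈ᴹ_ = _≈ᴹ_
    ; _+ᴹ_ = _+ᴹ_
    ; _*ₗ_ = λ r x → f r *ₗ x
    ; 0ᴹ = 0ᴹ
    ; -ᴹ_ = -ᴹ_
    ; isLeftModule = record
      { isLeftSemimodule = record
        { +ᴹ-isCommutativeMonoid = +ᴹ-isCommutativeMonoid
        ; isPreleftSemimodule = record
          { *ₗ-cong = λ r≈s x≈y → *ₗ-cong (f.⟦⟧-cong r≈s) x≈y
          ; *ₗ-zeroˡ = λ x → ≈ᴹ-trans (*ₗ-congʳ f.0#-homo) (*ₗ-zeroˡ x)
          ; *ₗ-distribʳ = λ x r s → ≈ᴹ-trans (*ₗ-congʳ (f.+-homo r s)) (*ₗ-distribʳ x _ _)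
          ; *ₗ-identityˡ = λ x → ≈ᴹ-trans (*ₗ-congʳ f.1#-homo) (*ₗ-identityˡ x)
          ; *ₗ-assoc = λ r s x → ≈ᴹ-trans (*ₗ-congʳ (f.*-homo r s)) (*ₗ-assoc _ _ x)
          ; *ₗ-zeroʳ = λ r → *ₗ-zeroʳ _
          ; *ₗ-distribˡ = λ r → *ₗ-distribˡ _
          }
        }
      ; -ᴹ‿cong = -ᴹ‿cong
      ; -ᴹ‿inverse = -ᴹ‿inverse
      }
    }
    where open LeftModule M

------------------------------------------------------------------------
-- Subrings, ideals, quotients and local rings

module _ (R : Ring c ℓ) where
  open Ring R renaming (refl to ≈-refl; sym to ≈-sym; trans to ≈-trans)
  private
    module +-Props = AbelianGroupProperties +-abelianGroup
    module +-Semi = CommutativeSemigroupProperties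
      (CommutativeMonoid.commutativeSemigroup +-commutativeMonoid)
    open RingProperties R using (-‿distribˡ-*; -‿distribʳ-*; -0#≈0#)

  HasCharacteristic : ℕ → Set ℓ
  HasCharacteristic p = ∀ n → (_×_ +-rawMonoid n 1# ≈ 0#) ⇔ (p ℕ.∣ n)

  IsUnit : Pred Carrier (c ⊔ ℓ)
  IsUnit x = ∃[ y ] (x * y ≈ 1#) ∧ (y * x ≈ 1#)

  record IsAdditiveSubgroup (P : Pred Carrier ℓᴵ) : Set (c ⊔ ℓ ⊔ ℓᴵ) where
    field
      resp : ∀ {x y} → x ≈ y → x ∈ P → y ∈ P
      0∈   : 0# ∈ P
      +∈   : ∀ {x y} → x ∈ P → y ∈ P → x + y ∈ P
      -∈   : ∀ {x} → x ∈ P → - x ∈ P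

  record IsSubring (P : Pred Carrier ℓᴵ) : Set (c ⊔ ℓ ⊔ ℓᴵ) where
    field
      isAdditiveSubgroup : IsAdditiveSubgroup P
      1∈ : 1# ∈ P
      *∈ : ∀ {x y} → x ∈ P → y ∈ P → x * y ∈ P
    open IsAdditiveSubgroup isAdditiveSubgroup public

  record IsLeftIdeal (I : Pred Carrier ℓᴵ) : Set (c ⊔ ℓ ⊔ ℓᴵ) where
    field
      isAdditiveSubgroup : IsAdditiveSubgroup I
      *∈ : ∀ r {x} → x ∈ I → r * x ∈ I

  record IsRightIdeal (I : Pred Carrier ℓᴵ) : Set (c ⊔ ℓ ⊔ ℓᴵ) where
    field
      isAdditiveSubgroup : IsAdditiveSubgroup I
      ∈* : ∀ {x} r → x ∈ I → x * r ∈ I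

  record IsIdeal (I : Pred Carrier ℓᴵ) : Set (c ⊔ ℓ ⊔ ℓᴵ) where
    field
      isAdditiveSubgroup : IsAdditiveSubgroup I
      *∈ : ∀ r {x} → x ∈ I → r * x ∈ I
      ∈* : ∀ {x} r → x ∈ I → x * r ∈ I
    open IsAdditiveSubgroup isAdditiveSubgroup public

  module _ (IsOneSidedIdeal : Pred Carrier ℓᴵ → Set (c ⊔ ℓ ⊔ ℓᴵ)) where

    record IsMaximal (I : Pred Carrier ℓᴵ) : Set (c ⊔ ℓ ⊔ lsuc ℓᴵ) where
      field
        isOneSidedIdeal : IsOneSidedIdeal I
        proper  : 1# ∉ I
        maximal : ∀ J → IsOneSidedIdeal J → 1# ∉ J → I ⊆ J → J ⊆ I

    record IsUniqueMaximal (I : Pred Carrier ℓᴵ) : Set (c ⊔ ℓ ⊔ lsuc ℓᴵ) where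
      field
        isMaximal : IsMaximal I
        unique    : ∀ J → IsMaximal J → J ≐ I

  -- Since R need not be commutative, being local means that the
  -- two-sided ideal 𝔐 is both the only maximal left ideal and the only
  -- maximal right ideal.
  record IsLocalRing (𝔐 : Pred Carrier ℓᴵ) : Set (c ⊔ ℓ ⊔ lsuc ℓᴵ) where
    field
      isIdeal : IsIdeal 𝔐
      uniqueMaximalLeftIdeal  : IsUniqueMaximal IsLeftIdeal 𝔐
      uniqueMaximalRightIdeal : IsUniqueMaximal IsRightIdeal 𝔐

  subring : (P : Pred Carrier ℓᴵ) → IsSubring P → Ring (c ⊔ ℓᴵ) ℓ
  subring P P-isSubring = record
    { Carrier = Σ Carrier P
    ; _≈_ = λ x y → proj₁ x ≈ proj₁ y
    ; _+_ = λ x y → proj₁ x + proj₁ y , P.+∈ (proj₂ x) (proj₂ y)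
    ; _*_ = λ x y → proj₁ x * proj₁ y , P.*∈ (proj₂ x) (proj₂ y)
    ; -_ = λ x → - proj₁ x , P.-∈ (proj₂ x)
    ; 0# = 0# , P.0∈
    ; 1# = 1# , P.1∈
    ; isRing = record
      { +-isAbelianGroup = record
        { isGroup = record
          { isMonoid = record
            { isSemigroup = record
              { isMagma = record
                { isEquivalence = record { refl = ≈-refl ; sym = ≈-sym ; trans = ≈-trans }
                ; ∙-cong = +-cong
                }
              ; assoc = λ x y z → +-assoc _ _ _
              }
            ; identity = (λ x → +-identityˡ _) , (λ x → +-identityʳ _)
            }
          ; inverse = (λ x → -‿inverseˡ _) , (λ x → -‿inverseʳ _)
          ; ⁻¹-cong = -‿cong
          }
        ; comm = λ x y → +-comm _ _
        }
      ; *-cong = *-cong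
      ; *-assoc = λ x y z → *-assoc _ _ _
      ; *-identity = (λ x → *-identityˡ _) , (λ x → *-identityʳ _)
      ; distrib = (λ x y z → distribˡ _ _ _) , (λ x y z → distribʳ _ _ _)
      }
    }
    where module P = IsSubring P-isSubring

  private
    module Cosets {P : Pred Carrier ℓᴵ} (P-isSubgroup : IsAdditiveSubgroup P) where
      open IsAdditiveSubgroup P-isSubgroup

      ≈⇒∼ : ∀ {x y} → x ≈ y → x - y ∈ P
      ≈⇒∼ {x} {y} x≈y = resp (≈-sym (≈-trans (+-congʳ x≈y) (-‿inverseʳ y))) 0∈

      ∼-sym : ∀ {x y} → x - y ∈ P → y - x ∈ P
      ∼-sym {x} {y} p = resp (+-Props.⁻¹-anti-homo‿- x y) (-∈ p)

      ∼-trans : ∀ {x y z} → x - y ∈ P → y - z ∈ P → x - z ∈ P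
      ∼-trans {x} {y} {z} p q = resp eq (+∈ p q)
        where
        eq : (x - y) + (y - z) ≈ x - z
        eq = ≈-trans (+-assoc x (- y) (y - z))
          (+-congˡ (≈-trans (≈-sym (+-assoc (- y) y (- z)))
            (≈-trans (+-congʳ (-‿inverseˡ y)) (+-identityˡ (- z)))))

      ∼-+ : ∀ {x x′ y y′} → x - x′ ∈ P → y - y′ ∈ P → (x + y) - (x′ + y′) ∈ P
      ∼-+ {x} {x′} {y} {y′} p q = resp eq (+∈ p q)
        where
        eq : (x - x′) + (y - y′) ≈ (x + y) - (x′ + y′)
        eq = ≈-trans (+-Semi.interchange x (- x′) y (- y′))
          (+-congˡ (+-Props.⁻¹-∙-comm x′ y′))

      ∼-neg : ∀ {x y} → x - y ∈ P → (- x) - (- y) ∈ P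
      ∼-neg {x} {y} p = resp (≈-sym (+-Props.⁻¹-∙-comm x (- y))) (-∈ p)

    split-* : ∀ x x′ y y′ → (x - x′) * y + x′ * (y - y′) ≈ x * y - x′ * y′
    split-* x x′ y y′ =
      ≈-trans (+-cong (distribʳ y x (- x′)) (distribˡ x′ y (- y′)))
      (≈-trans (+-cong (+-congˡ (≈-sym (-‿distribˡ-* x′ y))) (+-congˡ (≈-sym (-‿distribʳ-* x′ y′))))
      (≈-trans (+-assoc (x * y) (- (x′ * y)) _)
      (+-congˡ (≈-trans (≈-sym (+-assoc (- (x′ * y)) (x′ * y) _))
        (≈-trans (+-congʳ (-‿inverseˡ (x′ * y))) (+-identityˡ _))))))

  quotient : (I : Pred Carrier ℓᴵ) → IsIdeal I → Ring c ℓᴵ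
  quotient I I-isIdeal = record
    { Carrier = Carrier
    ; _≈_ = λ x y → x - y ∈ I
    ; _+_ = _+_
    ; _*_ = _*_
    ; -_ = -_
    ; 0# = 0#
    ; 1# = 1#
    ; isRing = record
      { +-isAbelianGroup = record
        { isGroup = record
          { isMonoid = record
            { isSemigroup = record
              { isMagma = record
                { isEquivalence = record { refl = ≈⇒∼ ≈-refl ; sym = ∼-sym ; trans = ∼-trans }
                ; ∙-cong = ∼-+
                }
              ; assoc = λ x y z → ≈⇒∼ (+-assoc x y z)
              }
            ; identity = (λ x → ≈⇒∼ (+-identityˡ x)) , (λ x → ≈⇒∼ (+-identityʳ x))
            }
          ; inverse = (λ x → ≈⇒∼ (-‿inverseˡ x)) , (λ x → ≈⇒∼ (-‿inverseʳ x))
          ; ⁻¹-cong = ∼-neg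
          }
        ; comm = λ x y → ≈⇒∼ (+-comm x y)
        }
      ; *-cong = λ {x} {x′} {y} {y′} p q →
          I.resp (split-* x x′ y y′) (I.+∈ (I.∈* y p) (I.*∈ x′ q))
      ; *-assoc = λ x y z → ≈⇒∼ (*-assoc x y z)
      ; *-identity = (λ x → ≈⇒∼ (*-identityˡ x)) , (λ x → ≈⇒∼ (*-identityʳ x))
      ; distrib = (λ x y z → ≈⇒∼ (distribˡ x y z)) , (λ x y z → ≈⇒∼ (distribʳ x y z))
      }
    }
    where
    module I = IsIdeal I-isIdeal
    open Cosets I.isAdditiveSubgroup

  data Square (I : Pred Carrier ℓᴵ) : Pred Carrier (c ⊔ ℓ ⊔ ℓᴵ) where
    product : ∀ {x y} → x ∈ I → y ∈ I → x * y ∈ Square I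
    0∈      : 0# ∈ Square I
    +∈      : ∀ {x y} → x ∈ Square I → y ∈ Square I → x + y ∈ Square I
    resp    : ∀ {x y} → x ≈ y → x ∈ Square I → y ∈ Square I

  module _ {I : Pred Carrier ℓᴵ} (I-isIdeal : IsIdeal I) where
    private
      module I = IsIdeal I-isIdeal

      Square-neg : ∀ {x} → x ∈ Square I → - x ∈ Square I
      Square-neg (product {x} {y} p q) = resp (≈-sym (-‿distribˡ-* x y)) (product (I.-∈ p) q)
      Square-neg 0∈ = resp (≈-sym -0#≈0#) 0∈
      Square-neg (+∈ {x} {y} p q) = resp (+-Props.⁻¹-∙-comm x y) (+∈ (Square-neg p) (Square-neg q))
      Square-neg (resp x≈y p) = resp (-‿cong x≈y) (Square-neg p)

      Square-*ₗ : ∀ r {x} → x ∈ Square I → r * x ∈ Square I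
      Square-*ₗ r (product {x} {y} p q) = resp (*-assoc r x y) (product (I.*∈ r p) q)
      Square-*ₗ r 0∈ = resp (≈-sym (zeroʳ r)) 0∈
      Square-*ₗ r (+∈ {x} {y} p q) = resp (≈-sym (distribˡ r x y)) (+∈ (Square-*ₗ r p) (Square-*ₗ r q))
      Square-*ₗ r (resp x≈y p) = resp (*-congˡ x≈y) (Square-*ₗ r p)

      Square-isAdditiveSubgroup : IsAdditiveSubgroup (Square I)
      Square-isAdditiveSubgroup = record { resp = resp ; 0∈ = 0∈ ; +∈ = +∈ ; -∈ = Square-neg }

      open Cosets Square-isAdditiveSubgroup

    -- I/I² as a module over R/I
    cotangentModule : LeftModule (quotient I I-isIdeal) (c ⊔ ℓᴵ) (c ⊔ ℓ ⊔ ℓᴵ)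
    cotangentModule = record
      { Carrierᴹ = Σ Carrier I
      ; _≈ᴹ_ = λ x y → proj₁ x - proj₁ y ∈ Square I
      ; _+ᴹ_ = λ x y → proj₁ x + proj₁ y , I.+∈ (proj₂ x) (proj₂ y)
      ; _*ₗ_ = λ r x → r * proj₁ x , I.*∈ r (proj₂ x)
      ; 0ᴹ = 0# , I.0∈
      ; -ᴹ_ = λ x → - proj₁ x , I.-∈ (proj₂ x)
      ; isLeftModule = record
        { isLeftSemimodule = record
          { +ᴹ-isCommutativeMonoid = record
            { isMonoid = record
              { isSemigroup = record
                { isMagma = record
                  { isEquivalence = record { refl = ≈⇒∼ ≈-refl ; sym = ∼-sym ; trans = ∼-trans }
                  ; ∙-cong = ∼-+
                  }
                ; assoc = λ x y z → ≈⇒∼ (+-assoc _ _ _)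
                }
              ; identity = (λ x → ≈⇒∼ (+-identityˡ _)) , (λ x → ≈⇒∼ (+-identityʳ _))
              }
            ; comm = λ x y → ≈⇒∼ (+-comm _ _)
            }
          ; isPreleftSemimodule = record
            { *ₗ-cong = λ {r} {s} {x} {y} r∼s x∼y →
                resp (split-* r s (proj₁ x) (proj₁ y))
                  (+∈ (product r∼s (proj₂ x)) (Square-*ₗ s x∼y))
            ; *ₗ-zeroˡ = λ x → ≈⇒∼ (zeroˡ _)
            ; *ₗ-distribʳ = λ x r s → ≈⇒∼ (distribʳ _ _ _)
            ; *ₗ-identityˡ = λ x → ≈⇒∼ (*-identityˡ _)
            ; *ₗ-assoc = λ r s x → ≈⇒∼ (*-assoc _ _ _)
            ; *ₗ-zeroʳ = λ r → ≈⇒∼ (zeroʳ _)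
            ; *ₗ-distribˡ = λ r x y → ≈⇒∼ (distribˡ _ _ _)
            }
          }
        ; -ᴹ‿cong = ∼-neg
        ; -ᴹ‿inverse = (λ x → ≈⇒∼ (-‿inverseˡ _)) , (λ x → ≈⇒∼ (-‿inverseʳ _))
        }
      }

------------------------------------------------------------------------
-- Discretely valued fields

record Field c ℓ : Set (lsuc (c ⊔ ℓ)) where
  field
    commutativeRing : CommutativeRing c ℓ
  open CommutativeRing commutativeRing public
  field
    1≉0     : 1# ≉ 0#
    inverse : ∀ {x} → x ≉ 0# → ∃[ y ] x * y ≈ 1#

record DiscreteValuation (F : Field c ℓ) : Set (c ⊔ ℓ) where
  open Field F renaming (refl to ≈-refl; sym to ≈-sym; trans to ≈-trans)
  field
    v      : Carrier → ℤ ⁺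
    v-cong : ∀ {x y} → x ≈ y → v x ≡ v y
    v-∞    : ∀ x → v x ≡ ⊤⁺ ⇔ x ≈ 0#
    v-*    : ∀ x y → v (x * y) ≡ v x +⁺ v y
    v-+    : ∀ {i} x y → i ≤⁺ v x → i ≤⁺ v y → i ≤⁺ v (x + y)
    -- the valuation is normalized
    v-surjective : ∀ i → ∃[ x ] v x ≡ [ i ]

  𝔓^ : ℤ ⁺ → Pred Carrier _
  𝔓^ i x = i ≤⁺ v x

  Converges : (ℕ → Carrier) → Carrier → Set
  Converges xs x = ∀ i → ∃[ N ] ∀ m → N ℕ.≤ m → [ i ] ≤⁺ v (xs m - x)

  Cauchy : (ℕ → Carrier) → Set
  Cauchy xs = ∀ i → ∃[ N ] ∀ m n → N ℕ.≤ m → N ℕ.≤ n → [ i ] ≤⁺ v (xs m - xs n)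

  Complete : Set c
  Complete = ∀ xs → Cauchy xs → ∃[ x ] Converges xs x

  private
    v1≡0 : v 1# ≡ [ + 0 ]
    v1≡0 = go (v 1#) refl (trans (sym (v-* 1# 1#)) (v-cong (*-identityˡ 1#)))
      where
      go : ∀ i → v 1# ≡ i → v 1# +⁺ v 1# ≡ v 1# → v 1# ≡ [ + 0 ]
      go ⊤⁺ eq _ = ⊥-elim (1≉0 (Equivalence.to (v-∞ 1#) eq))
      go [ i ] eq eq′ rewrite eq = cong [_] 
        (AbelianGroupProperties.identityʳ-unique ℤ.+-0-abelianGroup i i ([]-injective eq′))

    open RingProperties ring using (-‿distribˡ-*; -‿involutive)

    v-1≡0 : v (- 1#) ≡ [ + 0 ]
    v-1≡0 = go (v (- 1#)) refl (trans (sym (v-* (- 1#) (- 1#))) (trans (v-cong -1*-1≈1) v1≡0))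
      where
      -1*-1≈1 : (- 1#) * (- 1#) ≈ 1#
      -1*-1≈1 = ≈-trans (≈-sym (-‿distribˡ-* 1# (- 1#)))
        (≈-trans (-‿cong (*-identityˡ (- 1#))) (-‿involutive 1#))
      go : ∀ i → v (- 1#) ≡ i → v (- 1#) +⁺ v (- 1#) ≡ [ + 0 ] → v (- 1#) ≡ [ + 0 ]
      go ⊤⁺ eq eq′ rewrite eq with () ← eq′
      go [ i ] eq eq′ rewrite eq = cong [_] (i+i≡0⇒i≡0 i ([]-injective eq′))

    v-neg : ∀ x → v (- x) ≡ v x
    v-neg x = trans (v-cong (≈-trans (-‿cong (≈-sym (*-identityˡ x))) (-‿distribˡ-* 1# x)))
      (trans (v-* (- 1#) x) (trans (cong (_+⁺ v x) v-1≡0) (+⁺-identityˡ (v x))))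

  𝔓^-isAdditiveSubgroup : ∀ i → IsAdditiveSubgroup ring (𝔓^ i)
  𝔓^-isAdditiveSubgroup i = record
    { resp = λ x≈y → subst (i ≤⁺_) (v-cong x≈y)
    ; 0∈ = subst (i ≤⁺_) (sym (Equivalence.from (v-∞ 0#) ≈-refl)) (i ≤⊤⁺)
    ; +∈ = λ {x} {y} → v-+ x y
    ; -∈ = λ {x} → subst (i ≤⁺_) (sym (v-neg x))
    }

  𝔒-isSubring : IsSubring ring (𝔓^ [ + 0 ])
  𝔒-isSubring = record
    { isAdditiveSubgroup = 𝔓^-isAdditiveSubgroup _
    ; 1∈ = subst ([ + 0 ] ≤⁺_) (sym v1≡0) (≤⁺-refl _)
    ; *∈ = λ {x} {y} p q → subst ([ + 0 ] ≤⁺_) (sym (v-* x y)) (+⁺-mono-≤⁺ p q)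
    }

  𝔒 : Ring c ℓ
  𝔒 = subring ring (𝔓^ [ + 0 ]) 𝔒-isSubring

  𝔓 : Pred (Ring.Carrier 𝔒) _
  𝔓 x = proj₁ x ∈ 𝔓^ [ + 1 ]

  𝔓-isIdeal : IsIdeal 𝔒 𝔓
  𝔓-isIdeal = record
    { isAdditiveSubgroup = record
      { resp = λ {x} {y} → P.resp {proj₁ x} {proj₁ y}
      ; 0∈ = P.0∈
      ; +∈ = λ {x} {y} → P.+∈ {proj₁ x} {proj₁ y}
      ; -∈ = λ {x} → P.-∈ {proj₁ x}
      }
    ; *∈ = λ r {x} p → subst ([ + 1 ] ≤⁺_) (sym (v-* (proj₁ r) (proj₁ x))) (+⁺-mono-≤⁺ (proj₂ r) p)
    ; ∈* = λ {x} r p → subst ([ + 1 ] ≤⁺_) (sym (v-* (proj₁ x) (proj₁ r))) (+⁺-mono-≤⁺ p (proj₂ r))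
    }
    where module P = IsAdditiveSubgroup (𝔓^-isAdditiveSubgroup [ + 1 ])

  residueRing : Ring c _
  residueRing = quotient 𝔒 𝔓 𝔓-isIdeal

------------------------------------------------------------------------
-- Algebras and extensions over a field

record Algebra (K : Field k ℓk) a ℓa : Set (k ⊔ ℓk ⊔ lsuc (a ⊔ ℓa)) where
  private
    module K = Field K
  field
    ring : Ring a ℓa
  open Ring ring public
  field
    η       : K.Carrier → Carrier
    η-homo  : IsRingHomomorphism K.rawRing rawRing η
    central : ∀ x α → η x * α ≈ α * η x

  vectorSpace : LeftModule K.ring a ℓa
  vectorSpace = restrictScalars {S = ring} η η-homo regularModule

record Extension (K : Field k ℓk) l ℓl : Set (k ⊔ ℓk ⊔ lsuc (l ⊔ ℓl)) where
  private
    module K = Field K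
  field
    extensionField : Field l ℓl
  open Field extensionField public
  field
    ι      : K.Carrier → Carrier
    ι-homo : IsRingHomomorphism K.rawRing rawRing ι

  vectorSpace : LeftModule K.ring l ℓl
  vectorSpace = restrictScalars {S = ring} ι ι-homo regularModule

-- An extension of degree d whose ramification index is also d.
record TotallyRamified {K : Field k ℓk} (vK : DiscreteValuation K)
         (L : Extension K l ℓl) (vL : DiscreteValuation (Extension.extensionField L))
         (d : ℕ) : Set (k ⊔ ℓk ⊔ l ⊔ ℓl) where
  private
    module vK = DiscreteValuation vK
    module vL = DiscreteValuation vL
  open Extension L
  field
    degree            : HasDimension vectorSpace d
    ramificationIndex : ∀ x → vL.v (ι x) ≡ d ·⁺ vK.v x

record Action {K : Field k ℓk} (A : Algebra K a ℓa) (L : Extension K l ℓl)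
         : Set (k ⊔ ℓk ⊔ a ⊔ ℓa ⊔ l ⊔ ℓl) where
  private
    module A = Algebra A
    module L = Extension L
  infixr 7 _·_
  field
    _·_          : A.Carrier → L.Carrier → L.Carrier
    isLeftModule : IsLeftModule A.ring L._≈_ L._+_ L.0# L.-_ _·_
    ·-linearˡ    : ∀ c α x → (A.η c A.* α) · x L.≈ L.ι c L.* (α · x)
    ·-linearʳ    : ∀ c α x → α · (L.ι c L.* x) L.≈ L.ι c L.* (α · x)
  open IsLeftModule isLeftModule public

------------------------------------------------------------------------
-- The associated order 𝔄 of 𝔓_L^h

module AssociatedOrder
         {K : Field k ℓk} {vK : DiscreteValuation K}
         {L : Extension K l ℓl} {vL : DiscreteValuation (Extension.extensionField L)} {d : ℕ}
         (L/K : TotallyRamified vK L vL d)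
         {A : Algebra K a ℓa} (A↷L : Action A L)
         (h : ℤ)
         where
  private
    module K = Field K
    module vK = DiscreteValuation vK
    module vL = DiscreteValuation vL
    module L = Extension L
    module A = Algebra A
    module ι = IsRingHomomorphism L.ι-homo
    module η = IsRingHomomorphism A.η-homo
    open Action A↷L
    module P = IsAdditiveSubgroup (vL.𝔓^-isAdditiveSubgroup [ h ])

  Stabilizes : Pred A.Carrier _
  Stabilizes α = ∀ x → x ∈ vL.𝔓^ [ h ] → α · x ∈ vL.𝔓^ [ h ]

  Stabilizes-isSubring : IsSubring A.ring Stabilizes
  Stabilizes-isSubring = record
    { isAdditiveSubgroup = record
      { resp = λ α≈β p x x∈ → P.resp (*ₗ-congʳ α≈β) (p x x∈)
      ; 0∈ = λ x x∈ → P.resp (L.sym (*ₗ-zeroˡ x)) P.0∈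
      ; +∈ = λ p q x x∈ → P.resp (L.sym (*ₗ-distribʳ x _ _)) (P.+∈ (p x x∈) (q x x∈))
      ; -∈ = λ {α} p x x∈ → P.resp (neg-· α x) (P.-∈ (p x x∈))
      }
    ; 1∈ = λ x x∈ → P.resp (L.sym (*ₗ-identityˡ x)) x∈
    ; *∈ = λ p q x x∈ → P.resp (L.sym (*ₗ-assoc _ _ x)) (p _ (q x x∈))
    }
    where
    neg-· : ∀ α x → L.- (α · x) L.≈ (A.- α) · x
    neg-· α x = L.sym (AbelianGroupProperties.inverseˡ-unique L.+-abelianGroup _ _
      (L.trans (L.sym (*ₗ-distribʳ x (A.- α) α))
        (L.trans (*ₗ-congʳ (A.-‿inverseˡ α)) (*ₗ-zeroˡ x))))

  𝔄 : Ring _ _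
  𝔄 = subring A.ring Stabilizes Stabilizes-isSubring

  𝔓ᴸʰ : LeftModule 𝔄 _ _
  𝔓ᴸʰ = record
    { Carrierᴹ = Σ L.Carrier (vL.𝔓^ [ h ])
    ; _≈ᴹ_ = λ x y → proj₁ x L.≈ proj₁ y
    ; _+ᴹ_ = λ x y → proj₁ x L.+ proj₁ y , P.+∈ (proj₂ x) (proj₂ y)
    ; _*ₗ_ = λ α x → proj₁ α · proj₁ x , proj₂ α (proj₁ x) (proj₂ x)
    ; 0ᴹ = L.0# , P.0∈
    ; -ᴹ_ = λ x → L.- proj₁ x , P.-∈ (proj₂ x)
    ; isLeftModule = record
      { isLeftSemimodule = record
        { +ᴹ-isCommutativeMonoid = record
          { isMonoid = record
            { isSemigroup = record
              { isMagma = record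
                { isEquivalence = record { refl = L.refl ; sym = L.sym ; trans = L.trans }
                ; ∙-cong = L.+-cong
                }
              ; assoc = λ x y z → L.+-assoc _ _ _
              }
            ; identity = (λ x → L.+-identityˡ _) , (λ x → L.+-identityʳ _)
            }
          ; comm = λ x y → L.+-comm _ _
          }
        ; isPreleftSemimodule = record
          { *ₗ-cong = *ₗ-cong
          ; *ₗ-zeroˡ = λ x → *ₗ-zeroˡ _
          ; *ₗ-distribʳ = λ x α β → *ₗ-distribʳ _ _ _
          ; *ₗ-identityˡ = λ x → *ₗ-identityˡ _
          ; *ₗ-assoc = λ α β x → *ₗ-assoc _ _ _
          ; *ₗ-zeroʳ = λ α → *ₗ-zeroʳ _
          ; *ₗ-distribˡ = λ α x y → *ₗ-distribˡ _ _ _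
          }
        }
      ; -ᴹ‿cong = L.-‿cong
      ; -ᴹ‿inverse = (λ x → L.-‿inverseˡ _) , (λ x → L.-‿inverseʳ _)
      }
    }

  𝔒→𝔄 : Ring.Carrier vK.𝔒 → Ring.Carrier 𝔄
  𝔒→𝔄 (c , 0≤vc) = A.η c , λ x x∈ → P.resp (L.sym (η-· x))
    (subst ([ h ] ≤⁺_) (sym (vL.v-* (L.ι c) x))
      (subst (λ i → [ i ] ≤⁺ vL.v (L.ι c) +⁺ vL.v x) (ℤ.+-identityˡ h)
        (+⁺-mono-≤⁺ 0≤vιc x∈)))
    where
    0≤vιc : [ + 0 ] ≤⁺ vL.v (L.ι c)
    0≤vιc = subst ([ + 0 ] ≤⁺_) (sym (TotallyRamified.ramificationIndex L/K c)) (·⁺-nonneg d 0≤vc)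
    η-· : ∀ x → A.η c · x L.≈ L.ι c L.* x
    η-· x = L.trans (*ₗ-congʳ (A.sym (A.*-identityʳ (A.η c))))
      (L.trans (·-linearˡ c A.1# x) (L.*-congˡ (*ₗ-identityˡ x)))

  -- HasResidueFieldκ says that 𝔒→𝔄 induces an isomorphism κ ≅ 𝔄/𝔐.
  module _ {𝔐 : Pred (Ring.Carrier 𝔄) ℓᴵ} (𝔐-isIdeal : IsIdeal 𝔄 𝔐) where

    HasResidueFieldκ : Set _
    HasResidueFieldκ =
      IsRingIsomorphism (Ring.rawRing vK.residueRing) (Ring.rawRing (quotient 𝔄 𝔐 𝔐-isIdeal)) 𝔒→𝔄

    -- 𝔐/𝔐² as a vector space over κ ≅ 𝔄/𝔐
    cotangentSpace : HasResidueFieldκ → LeftModule vK.residueRing _ _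
    cotangentSpace κ≅𝔄/𝔐 =
      restrictScalars {S = quotient 𝔄 𝔐 𝔐-isIdeal} 𝔒→𝔄
        (IsRingIsomorphism.isRingHomomorphism κ≅𝔄/𝔐) (cotangentModule 𝔄 𝔐-isIdeal)

------------------------------------------------------------------------
-- Combinatorics of 𝕊_{pⁿ}

-- The index i : Fin n stands for the index i + 1 ∈ {1, …, n}, so that
-- β i is b_{i+1} and the exponent n - (i + 1) is n ∸ suc (toℕ i).
module Shifts (p : ℕ) (p-prime : Prime p) (n : ℕ) (β : Fin n → ℤ) where
  private
    instance
      p-nonZero : NonZero p
      p-nonZero = prime⇒nonZero p-prime

    p^-nonZero : ∀ e → NonZero (p ^ e)
    p^-nonZero e = ℕ.m^n≢0 p e

  𝕊 : Set
  𝕊 = Fin (p ^ n)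

  exponent : Fin n → ℕ
  exponent i = n ∸ ℕ.suc (toℕ i)

  digit : 𝕊 → Fin n → ℕ
  digit s i = (toℕ s / p ^ exponent i) % p
    where instance _ = p^-nonZero (exponent i)

  infix 4 _≼_ _≺_ _≼?_ _≺?_
  _≼_ _≺_ : 𝕊 → 𝕊 → Set
  s ≼ t = ∀ i → digit s i ℕ.≤ digit t i
  s ≺ t = (s ≼ t) ∧ (s ≢ t)

  _≼?_ : ∀ s t → Dec (s ≼ t)
  s ≼? t = Fin.all? (λ i → digit s i ℕ.≤? digit t i)

  _≺?_ : ∀ s t → Dec (s ≺ t)
  s ≺? t = (s ≼? t) ×-dec ¬? (s Fin.≟ t)

  0ˢ : 𝕊
  0ˢ = fromℕ< (ℕ.m^n>0 p n)

  infixl 6 _-ˢ_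
  _-ˢ_ : 𝕊 → 𝕊 → 𝕊
  u -ˢ s = fromℕ< (ℕ.≤-<-trans (ℕ.m∸n≤m (toℕ u) (toℕ s)) (Fin.toℕ<n u))

  𝔟 : 𝕊 → ℤ
  𝔟 s = sum ℤ.+-0-rawMonoid (λ i → + (digit s i ℕ.* p ^ exponent i) ℤ.* β i)

  -- The search succeeds, with exactly one candidate, as soon as all β i
  -- are prime to p; the default 0ˢ is then never used.
  𝔞 : ℤ → 𝕊
  𝔞 t = witness (Fin.any? (λ s → + (p ^ n) ℤ.∣? (𝔟 s ℤ.+ t)))
    where
    witness : Dec (∃[ s ] + (p ^ n) ℤ.∣ (𝔟 s ℤ.+ t)) → 𝕊
    witness (yes (s , _)) = s
    witness (no _)        = 0ˢ

  module _ (h b : ℤ) where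

    -- _/ℕ_ rounds towards -∞.
    d : 𝕊 → ℤ
    d s = (𝔟 s ℤ.+ b ℤ.- h) ℤ./ℕ (p ^ n)
      where instance _ = p^-nonZero n

    -- The default value of the minimum is the term u = s.
    w : 𝕊 → ℤ
    w s = Extrema.min ℤ.≤-totalOrder (d s ℤ.- d (s -ˢ s))
            (map (λ u → d u ℤ.- d (u -ˢ s)) (filter (s ≼?_) (allFin (p ^ n))))

    𝒟 : Pred 𝕊 _
    𝒟 u = ∀ s → 0ˢ ≺ s → s ≼ u → d (u -ˢ s) ℤ.+ w s ℤ.< d u

    ℰ : Pred 𝕊 _
    ℰ u = ∀ s → 0ˢ ≺ s → s ≺ u → w (u -ˢ s) ℤ.+ w s ℤ.< w u

    𝒟? : ∀ u → Dec (𝒟 u)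
    𝒟? u = Fin.all? (λ s → (0ˢ ≺? s) →-dec ((s ≼? u) →-dec (_ ℤ.<? _)))

    ℰ? : ∀ u → Dec (ℰ u)
    ℰ? u = Fin.all? (λ s → (0ˢ ≺? s) →-dec ((s ≺? u) →-dec (_ ℤ.<? _)))

    ∣𝒟∣ ∣ℰ∣ : ℕ
    ∣𝒟∣ = length (filter 𝒟? (allFin (p ^ n)))
    ∣ℰ∣ = length (filter ℰ? (allFin (p ^ n)))

------------------------------------------------------------------------
-- Scaffolds

module _ {K : Field k ℓk} (vK : DiscreteValuation K)
         {L : Extension K l ℓl} (vL : DiscreteValuation (Extension.extensionField L))
         {A : Algebra K a ℓa} (A↷L : Action A L)
         (p : ℕ) (p-prime : Prime p) (n : ℕ) (β : Fin n → ℤ)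
         where
  private
    module K = Field K
    module vK = DiscreteValuation vK
    module vL = DiscreteValuation vL
    module L = Extension L
    module A = Algebra A
    open Action A↷L
    open Shifts p p-prime n β

  -- x ≡ y modulo z𝔓_L^𝔗.  As v z = ∞ only for z = 0, this is equality
  -- for 𝔗 = ∞.
  CongruentMod : L.Carrier → ℤ ⁺ → L.Carrier → L.Carrier → Set _
  CongruentMod z 𝔗 x y = ∃[ r ] (r ∈ vL.𝔓^ 𝔗) ∧ (x L.- y L.≈ z L.* r)

  record Scaffold (𝔗 : ℤ ⁺) : Set (k ⊔ ℓk ⊔ a ⊔ ℓa ⊔ l ⊔ ℓl) where
    field
      λᴸ   : ℤ → L.Carrier
      v-λᴸ : ∀ t → vL.v (λᴸ t) ≡ [ t ]
      -- the element y is the inverse of λᴸ t₂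
      λᴸ-ratio : ∀ t₁ t₂ → + (p ^ n) ℤ.∣ (t₁ ℤ.- t₂) →
                 ∀ y → λᴸ t₂ L.* y L.≈ L.1# → ∃[ x ] λᴸ t₁ L.* y L.≈ L.ι x
      Ψ   : Fin n → A.Carrier
      Ψ·1 : ∀ i → Ψ i · L.1# L.≈ L.0#
      Ψ·λᴸ : ∀ i t → let t′ = t ℤ.+ + (p ^ exponent i) ℤ.* β i in
             Σ[ u ∈ Ring.Carrier vK.𝔒 ] IsUnit vK.𝔒 u ∧
               (1 ℕ.≤ digit (𝔞 t) i →
                  CongruentMod (λᴸ t′) 𝔗 (Ψ i · λᴸ t) (L.ι (proj₁ u) L.* λᴸ t′)) ∧
               (digit (𝔞 t) i ≡ 0 →
                  CongruentMod (λᴸ t′) 𝔗 (Ψ i · λᴸ t) L.0#)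

{-# OPTIONS --safe #-}

-- Put M = 𝔓_L^h, let π be a uniformizer of K, λᵘ = λ_{b+𝔟(u)}, and let Ψ⁽ˢ⁾
-- be a product in which each Ψᵢ occurs s_(n-i) times.  By the congruences of
-- the scaffold Ψ⁽ˢ⁾ sends λᵘ to a unit multiple of λ^{u+s} if s and u add
-- without carries, and to 0 otherwise, up to an error term.  As the values
-- b + 𝔟(u) are incongruent modulo pⁿ, the elements y_u = π^{-d(u)} λᵘ are an
-- 𝔒_K-basis of M, and the hypothesis on 𝔗 says precisely that for
-- Φₛ = π^{-w(s)} Ψ⁽ˢ⁾ the error terms of Φₛ y_u lie in πM.  So modulo πM,
--     Φₛ y_u = unit · y_{u+s}  if there is no carry and d(u+s) = d(u) + w(s),
-- and Φₛ y_u = 0 otherwise.  Since w(s) is attained, this determines every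
-- coefficient of α ∈ A modulo π from the action of α on M/πM; hence the Φₛ are
-- an 𝔒_K-basis of 𝔄 and, modulo π𝔄, ΦₛΦₜ is a unit multiple of Φ_{s+t} if there
-- is no carry and w(s+t) = w(s) + w(t), and 0 otherwise.
--
-- The coefficient ε(α) of Φ₀ = 1 is given by α·1 = ε(α), because Ψᵢ·1 = 0; so
-- ε : 𝔄 → 𝔒_K is a ring homomorphism, and 𝔐 = ε⁻¹(𝔓_K).  If ε(α) is a unit,
-- then right multiplication by α is triangular with unit diagonal on 𝔄/π𝔄,
-- and Nakayama's lemma gives 𝔄α = 𝔄.  The y_u with u ∈ 𝒟 are a basis of
-- M/𝔐M, and π together with the Φ_u, 0 ≠ u ∈ ℰ, is a basis of 𝔐/𝔐².
module Submission where

open import Defs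
open import Level using (Level; 0ℓ; Lift; lift; _⊔_)
open import Algebra.Bundles using (AbelianGroup; CommutativeMonoid; Ring)
open import Algebra.Definitions.RawMonoid using (sum)
open import Algebra.Module.Bundles using (LeftModule)
open import Algebra.Morphism.Structures using (IsRingHomomorphism)
import Algebra.Properties.AbelianGroup as AbelianGroupProperties
import Algebra.Properties.CommutativeMonoid.Sum as Sum
import Algebra.Properties.CommutativeSemigroup as CommutativeSemigroupProperties
import Algebra.Properties.Group as GroupProperties
import Algebra.Properties.Ring as RingProperties
import Algebra.Properties.Semiring.Sum as SemiringSum
open import Data.Fin.Base using (Fin; zero; suc; toℕ; punchIn; inject≤; fromℕ<; finToFun; funToFin; remainder) renaming (quotient to quotientᶠ)
open import Data.Fin.Induction using (<-wellFounded; >-wellFounded)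
import Data.Fin.Properties as Fin
open import Data.Integer.Base as ℤ using (ℤ; +_)
open import Data.Integer.Coprimality as Coprime using (Coprime)
import Data.Integer.DivMod as ℤ using ([n/ℕd]*d≤n; n<s[n/ℕd]*d; 0≤n⇒0≤n/ℕd)
import Data.Integer.Divisibility as ℤᵤ using (_∣_)
import Data.Integer.Divisibility.Signed as ℤ using (_∣_; _∣?_; divides; ∣⇒∣ᵤ; ∣-trans; ∣m∣n⇒∣m-n; ∣m+n∣m⇒∣n; *-cancelʳ-∣)
import Data.Integer.Properties as ℤ
open import Data.Integer.Tactic.RingSolver using (solve-∀)
open import Data.List.Base using (List; []; _∷_; _++_; allFin; filter; length; lookup; map; replicate)
import Data.List.Extrema as Extrema
open import Data.List.Membership.Propositional.Properties using (∈-filter⁺; ∈-filter⁻; ∈-allFin; ∈-lookup; ∈-map⁺; ∈-map⁻)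
import Data.List.Relation.Unary.All as All
import Data.List.Relation.Unary.AllPairs as AllPairs
import Data.List.Relation.Unary.Any as Any
import Data.List.Relation.Unary.Any.Properties as Any
open import Data.List.Relation.Unary.Unique.Propositional using (Unique)
import Data.List.Relation.Unary.Unique.Propositional.Properties as Unique
open import Data.Nat.Base as ℕ using (ℕ; _^_; _∸_)
import Data.Nat.Divisibility as ℕ using (∣⇒≤; n∣m*n)
open import Data.Nat.DivMod using (_/_; _%_; m*n/n≡m; +-distrib-/-∣ˡ; m<n⇒m/n≡0; m<n⇒m%n≡m; [m+kn]%n≡m%n)
open import Data.Nat.Primality using (Prime; prime⇒nonZero)
import Data.Nat.Properties as ℕ
open import Data.Product.Base using (Σ-syntax; ∃₂; ∃-syntax; _×_; _,_; proj₁; proj₂)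
open import Data.Sum.Base using (_⊎_; inj₁; inj₂)
open import Data.Vec.Functional as Vector using (insertAt)
open import Data.Vec.Functional.Properties using (insertAt-lookup; insertAt-punchIn)
open import Function.Base using (_∘_; _$_)
open import Function.Bundles using (module Equivalence)
open import Function.Definitions using (Injective)
import Induction.WellFounded as WF
import Relation.Binary.Construct.Add.Supremum.NonStrict ℤ._≤_ as ≤⁺
open import Relation.Binary.Definitions using (tri<; tri≈; tri>)
open import Relation.Binary.PropositionalEquality as ≡ using (_≡_; _≢_; refl; sym; trans; cong; cong₂; subst)
import Relation.Binary.Reasoning.Setoid as ≈-Reasoning
open import Relation.Nullary using (¬_; Dec; yes; no; contradiction)
open import Relation.Nullary.Decidable using (¬?; decidable-stable; _→-dec_; _×-dec_)
open import Relation.Unary using (Pred; Decidable)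

-- Two obstacles shape the argument. A scaffold describes `Ψ i` only on the elements λ_t and only up
-- to an error, whereas in a product of several `Ψ i` the later factors also act on the errors
-- already made. `Ψ-shift` bounds this by expanding an arbitrary element of L in the y_u, where no
-- cancellation can occur. Secondly, A need not be commutative: the factors of Ψ⁽ˢ⁾ come in a fixed
-- order, which is harmless as the estimates see only how often each factor occurs, and inverses in
-- 𝔄 are first found on one side.
--
-- The bound on 𝔗 originates in d(0) ≥ 0, that is, in h ≤ b. It gives pⁿw(s) ≤ 𝔟(s) + b - h. So
-- division by a power of π with exponent w(s) costs at most 𝔟(s) + b - h, of which 𝔟(s) is regained
-- by the shift; b - h remains, and pⁿ is the one further factor π.
--
-- The combinatorics (`ShiftTable`) and the valuations (`AdaptedBases`) meet only in the alternative
-- whether a coefficient is a unit or lies in 𝔓_K. This is why the units of the scaffold are never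
-- tracked.

-- Finite sums in a ring

module Summation {c ℓ : Level} (R : Ring c ℓ) where
  open Ring R hiding (zero) renaming (refl to ≈-refl; sym to ≈-sym; trans to ≈-trans)
  private module S = SemiringSum semiring

  opaque
    ∑ : ∀ {n} → (Fin n → Carrier) → Carrier
    ∑ = S.sum

  opaque
    unfolding ∑

    ∑-[] : ∀ (f : Fin 0 → Carrier) → ∑ f ≈ 0#
    ∑-[] f = ≈-refl

    ∑-∷ : ∀ {n} (f : Fin (ℕ.suc n) → Carrier) → ∑ f ≈ f zero + ∑ (λ i → f (suc i))
    ∑-∷ f = ≈-refl

    ∑≈sum : ∀ {n} (f : Fin n → Carrier) → ∑ f ≈ sum +-rawMonoid f
    ∑≈sum f = ≈-refl

    ∑-cong : ∀ {n} {f g : Fin n → Carrier} → (∀ i → f i ≈ g i) → ∑ f ≈ ∑ g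
    ∑-cong = S.sum-cong-≋

    ∑-+ : ∀ {n} (f g : Fin n → Carrier) → ∑ (λ i → f i + g i) ≈ ∑ f + ∑ g
    ∑-+ = S.∑-distrib-+

    ∑-swap : ∀ {m n} (f : Fin m → Fin n → Carrier) → ∑ (λ i → ∑ (λ j → f i j)) ≈ ∑ (λ j → ∑ (λ i → f i j))
    ∑-swap = S.∑-comm

    ∑-remove : ∀ {n} (f : Fin (ℕ.suc n) → Carrier) i → ∑ f ≈ f i + ∑ (λ k → f (punchIn i k))
    ∑-remove f i = S.sum-remove {i = i} f

    *-∑ : ∀ {n} x (f : Fin n → Carrier) → x * ∑ f ≈ ∑ (λ i → x * f i)
    *-∑ = S.*-distribˡ-sum

    ∑-* : ∀ {n} x (f : Fin n → Carrier) → ∑ f * x ≈ ∑ (λ i → f i * x)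
    ∑-* = S.*-distribʳ-sum

    ∑-zero : ∀ {n} {f : Fin n → Carrier} → (∀ i → f i ≈ 0#) → ∑ f ≈ 0#
    ∑-zero {n} p = ≈-trans (∑-cong p) (S.sum-replicate-zero n)

  ∑-single : ∀ {n} (f : Fin n → Carrier) j → (∀ k → k ≢ j → f k ≈ 0#) → ∑ f ≈ f j
  ∑-single {ℕ.suc n} f j p = ≈-trans (∑-remove f j)
    (≈-trans (+-congˡ (∑-zero (λ k → p (punchIn j k) (Fin.punchInᵢ≢i j k)))) (+-identityʳ _))

-- Ultrametric estimates in a discretely valued field

module Valued {c ℓ : Level} {F : Field c ℓ} (vF : DiscreteValuation F) where
  open Field F hiding (zero) renaming (refl to ≈-refl; sym to ≈-sym; trans to ≈-trans)
  open DiscreteValuation vF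
  open AbelianGroupProperties +-abelianGroup using (xyx⁻¹≈y)
  open Summation ring
  open CommutativeSemigroupProperties (CommutativeMonoid.commutativeSemigroup +-commutativeMonoid) using (interchange)

  V : ℤ → Pred Carrier 0ℓ
  V i = 𝔓^ [ i ]

  Unit : Pred Carrier 0ℓ
  Unit x = v x ≡ [ + 0 ]

  private
    module 𝔓^ i = IsAdditiveSubgroup (𝔓^-isAdditiveSubgroup [ i ])

    []-injective : ∀ {i j : ℤ} → _≡_ {A = ℤ ⁺} [ i ] [ j ] → i ≡ j
    []-injective refl = refl

  V-resp : ∀ {i x y} → x ≈ y → V i x → V i y
  V-resp {i} = 𝔓^.resp i

  V-0# : ∀ {i} → V i 0#
  V-0# {i} = 𝔓^.0∈ i

  V-+ : ∀ {i x y} → V i x → V i y → V i (x + y)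
  V-+ {i} = 𝔓^.+∈ i

  V-neg : ∀ {i x} → V i x → V i (- x)
  V-neg {i} = 𝔓^.-∈ i

  V-- : ∀ {i x y} → V i x → V i y → V i (x - y)
  V-- p q = V-+ p (V-neg q)

  V-≤ : ∀ {i j x} → i ℤ.≤ j → V j x → V i x
  V-≤ i≤j = ≤⁺.≤⁺-trans ℤ.≤-trans [ i≤j ]

  V? : ∀ i x → Dec (V i x)
  V? i x = ≤⁺.≤⁺-dec ℤ._≤?_ [ i ] (v x)

  V-* : ∀ {i j x y} → V i x → V j y → V (i ℤ.+ j) (x * y)
  V-* {i} {j} {x} {y} p q = subst ([ i ℤ.+ j ] ≤⁺_) (sym (v-* x y)) (mono p q)
    where
    mono : ∀ {a b} → [ i ] ≤⁺ a → [ j ] ≤⁺ b → [ i ℤ.+ j ] ≤⁺ a +⁺ b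
    mono [ p ]   [ q ]   = [ ℤ.+-mono-≤ p q ]
    mono [ p ]   (_ ≤⊤⁺) = _ ≤⊤⁺
    mono (_ ≤⊤⁺) _       = _ ≤⊤⁺

  V-0* : ∀ {i x y} → V (+ 0) x → V i y → V i (x * y)
  V-0* {i} {x} {y} p q = subst (λ j → V j (x * y)) (ℤ.+-identityˡ i) (V-* p q)

  V-*0 : ∀ {i x y} → V i x → V (+ 0) y → V i (x * y)
  V-*0 {i} {x} {y} p q = subst (λ j → V j (x * y)) (ℤ.+-identityʳ i) (V-* p q)

  V-∑ : ∀ {i n} {f : Fin n → Carrier} → (∀ j → V i (f j)) → V i (∑ f)
  V-∑ {n = ℕ.zero}  p = V-resp (≈-sym (∑-[] _)) V-0#
  V-∑ {n = ℕ.suc n} p = V-resp (≈-sym (∑-∷ _)) (V-+ (p zero) (V-∑ (p ∘ suc)))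

  v⇒V : ∀ {i x} → v x ≡ [ i ] → V i x
  v⇒V {i} eq = subst ([ i ] ≤⁺_) (sym eq) [ ℤ.≤-refl ]

  v≡⇒V-≤ : ∀ {i j x} → v x ≡ [ i ] → V j x → j ℤ.≤ i
  v≡⇒V-≤ {j = j} eq p = ≤⁺.[≤]-injective (subst ([ j ] ≤⁺_) eq p)

  v-*-fin : ∀ {i j x y} → v x ≡ [ i ] → v y ≡ [ j ] → v (x * y) ≡ [ i ℤ.+ j ]
  v-*-fin {x = x} {y} p q = trans (v-* x y) (cong₂ _+⁺_ p q)

  v-fin⇒≉0 : ∀ {i x} → v x ≡ [ i ] → x ≉ 0#
  v-fin⇒≉0 {x = x} p x≈0 with () ← trans (sym p) (Equivalence.from (v-∞ x) x≈0)

  ≉0⇒v-fin : ∀ {x} → x ≉ 0# → ∃[ i ] v x ≡ [ i ]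
  ≉0⇒v-fin {x} x≉0 with v x in eq
  ... | [ i ] = i , refl
  ... | ⊤⁺    = contradiction (Equivalence.to (v-∞ x) eq) x≉0

  ⋂V⇒≈0 : ∀ {x} → (∀ i → V i x) → x ≈ 0#
  ⋂V⇒≈0 {x} p with v x in eq
  ... | ⊤⁺    = Equivalence.to (v-∞ x) eq
  ... | [ i ] = contradiction (≤⁺.[≤]-injective (p (ℤ.suc i))) (ℤ.<⇒≱ (ℤ.suc[i]≤j⇒i<j ℤ.≤-refl))

  _≈0? : ∀ x → Dec (x ≈ 0#)
  x ≈0? with v x in eq
  ... | [ i ] = no (v-fin⇒≉0 eq)
  ... | ⊤⁺    = yes (Equivalence.to (v-∞ x) eq)

  v-1# : Unit 1#
  v-1# with ≉0⇒v-fin 1≉0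
  ... | i , eq = trans eq (cong [_]
    (AbelianGroupProperties.identityʳ-unique ℤ.+-0-abelianGroup i i
      ([]-injective (trans (sym (v-*-fin eq eq)) (trans (v-cong (*-identityˡ 1#)) eq)))))

  v-inverse : ∀ {i x} → v x ≡ [ i ] → ∃[ y ] (x * y ≈ 1#) × v y ≡ [ ℤ.- i ]
  v-inverse {i} {x} eq with inverse (v-fin⇒≉0 eq)
  ... | y , xy≈1 with v y in eqy | trans (sym (v-* x y)) (trans (v-cong xy≈1) v-1#)
  ... | [ j ] | eq′ rewrite eq = y , xy≈1 , trans eqy (cong [_]
    (AbelianGroupProperties.inverseʳ-unique ℤ.+-0-abelianGroup i j ([]-injective eq′)))
  ... | ⊤⁺    | eq′ rewrite eq with () ← eq′

  V-cancelˡ : ∀ {i j x y} → v x ≡ [ i ] → V (i ℤ.+ j) (x * y) → V j y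
  V-cancelˡ {i} {j} {x} {y} eq p = subst (λ k → V k y) eqℤ (V-resp eqF (V-* (v⇒V v-x⁻¹) p))
    where
    x⁻¹   = proj₁ (v-inverse eq)
    v-x⁻¹ = proj₂ (proj₂ (v-inverse eq))
    eqℤ : ℤ.- i ℤ.+ (i ℤ.+ j) ≡ j
    eqℤ = trans (sym (ℤ.+-assoc (ℤ.- i) i j)) (trans (cong (ℤ._+ j) (ℤ.+-inverseˡ i)) (ℤ.+-identityˡ j))
    eqF : x⁻¹ * (x * y) ≈ y
    eqF = ≈-trans (≈-sym (*-assoc _ _ _))
      (≈-trans (*-congʳ (≈-trans (*-comm _ _) (proj₁ (proj₂ (v-inverse eq))))) (*-identityˡ y))

  Unit⇒V0 : ∀ {x} → Unit x → V (+ 0) x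
  Unit⇒V0 = v⇒V

  V1⇒V0 : ∀ {x} → V (+ 1) x → V (+ 0) x
  V1⇒V0 = V-≤ (ℤ.+≤+ ℕ.z≤n)

  Unit⇒¬V1 : ∀ {x} → Unit x → ¬ V (+ 1) x
  Unit⇒¬V1 eq p with () ← ℕ.≤⇒≯ (ℤ.drop‿+≤+ (v≡⇒V-≤ eq p)) (ℕ.s≤s ℕ.z≤n)

  V1+⇒ : ∀ {i x} → ¬ V (i ℤ.+ + 1) x → V i x → v x ≡ [ i ]
  V1+⇒ {i} {x} ¬p q with v x
  ... | ⊤⁺    = contradiction (_ ≤⊤⁺) ¬p
  ... | [ j ] = cong [_] (ℤ.≤-antisym
    (ℤ.≮⇒≥ λ i<j → ¬p [ subst (ℤ._≤ j) (ℤ.+-comm (+ 1) i) (ℤ.i<j⇒suc[i]≤j i<j) ])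
    (≤⁺.[≤]-injective q))

  V0∧¬V1⇒Unit : ∀ {x} → V (+ 0) x → ¬ V (+ 1) x → Unit x
  V0∧¬V1⇒Unit p ¬q = V1+⇒ ¬q p

  V-cancelUnitˡ : ∀ {j x y} → Unit x → V j (x * y) → V j y
  V-cancelUnitˡ {j} {x} {y} u p = V-cancelˡ u (subst (λ k → V k (x * y)) (sym (ℤ.+-identityˡ j)) p)

  V-≡ : ∀ {i x y} → V i (x - y) → V i y → V i x
  V-≡ {x = x} {y} p q = V-resp (≈-trans (+-assoc _ _ _) (≈-trans (+-congˡ (-‿inverseˡ y)) (+-identityʳ x))) (V-+ p q)

  V-swap : ∀ {i x y} → V i (x - y) → V i (y - x)
  V-swap {x = x} {y} p = V-resp (AbelianGroupProperties.⁻¹-anti-homo‿- +-abelianGroup x y) (V-neg p)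

  ≈⇒V : ∀ {i x y} → x ≈ y → V i (x - y)
  ≈⇒V {y = y} x≈y = V-resp (≈-sym (≈-trans (+-congʳ x≈y) (-‿inverseʳ y))) V-0#

  V-trans : ∀ {i x y z} → V i (x - y) → V i (y - z) → V i (x - z)
  V-trans {x = x} {y} {z} p q = V-resp
    (≈-trans (+-assoc x (- y) (y - z)) (+-congˡ (≈-trans (≈-sym (+-assoc (- y) y (- z)))
      (≈-trans (+-congʳ (-‿inverseˡ y)) (+-identityˡ (- z))))))
    (V-+ p q)

  V-+-cong : ∀ {i x x′ y y′} → V i (x - x′) → V i (y - y′) → V i ((x + y) - (x′ + y′))
  V-+-cong {x = x} {x′} {y} {y′} p q = V-resp
    (≈-trans (interchange x (- x′) y (- y′)) (+-congˡ (AbelianGroupProperties.⁻¹-∙-comm +-abelianGroup x′ y′)))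
    (V-+ p q)

  Unit-≡ : ∀ {x y} → V (+ 1) (x - y) → Unit y → Unit x
  Unit-≡ p u = V0∧¬V1⇒Unit (V-≡ (V1⇒V0 p) (Unit⇒V0 u)) λ q → Unit⇒¬V1 u (V-≡ (V-swap p) q)

  Unit-*⁻ : ∀ {x y} → V (+ 0) x → V (+ 0) y → Unit (x * y) → Unit x
  Unit-*⁻ p q u = V0∧¬V1⇒Unit p λ p′ → Unit⇒¬V1 u (V-*0 p′ q)

  ∑-isolate : ∀ {i n} (f : Fin n → Carrier) j → (∀ k → k ≢ j → V i (f k)) → V i (∑ f - f j)
  ∑-isolate {n = ℕ.suc n} f j p = V-resp eq (V-∑ λ k → p (punchIn j k) (Fin.punchInᵢ≢i j k))
    where
    eq : ∑ (λ k → f (punchIn j k)) ≈ ∑ f - f j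
    eq = ≈-sym (≈-trans (+-congʳ (∑-remove f j)) (xyx⁻¹≈y (f j) _))

  private
    -- Terms of different value do not cancel. If v x = a < k, then x = (x + y) - y in the case a <
    -- v y, and y = (x + y) - x in the case v y < a, would give a term a value above its own. The
    -- hypothesis lets x and y share a value only if that value is ∞.
    ultra : ∀ {k x y} → (v x ≡ v y → v x ≡ ⊤⁺) → V k (x + y) → V k x
    ultra {k} {x} {y} distinct p = go (v x) refl (v y) refl
      where
      x≈ : (x + y) - y ≈ x
      x≈ = ≈-trans (+-assoc _ _ _) (≈-trans (+-congˡ (-‿inverseʳ y)) (+-identityʳ x))
      go : ∀ a → v x ≡ a → ∀ b → v y ≡ b → V k x
      go ⊤⁺ eq _ _ = subst ([ k ] ≤⁺_) (sym eq) (_ ≤⊤⁺)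
      go [ a ] eq b eq′ with k ℤ.≤? a
      ... | yes k≤a = subst ([ k ] ≤⁺_) (sym eq) [ k≤a ]
      go [ a ] eq ⊤⁺ eq′ | no _ = V-resp x≈ (V-- p (subst ([ k ] ≤⁺_) (sym eq′) (_ ≤⊤⁺)))
      go [ a ] eq [ b ] eq′ | no k≰a with ℤ.<-cmp a b
      ... | tri≈ _ refl _ with () ← trans (sym eq) (distinct (trans eq (sym eq′)))
      ... | tri< a<b _ _ = contradiction (v≡⇒V-≤ eq
              (V-resp x≈ (V-- (V-≤ (ℤ.i<j⇒suc[i]≤j (ℤ.≰⇒> k≰a)) p) (V-≤ (ℤ.i<j⇒suc[i]≤j a<b) (v⇒V eq′)))))
              (ℤ.<⇒≱ (ℤ.suc[i]≤j⇒i<j ℤ.≤-refl))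
      ... | tri> _ _ b<a = contradiction (v≡⇒V-≤ eq′
              (V-resp (xyx⁻¹≈y x y) (V-- (V-≤ (ℤ.≤-trans (ℤ.i<j⇒suc[i]≤j b<a) (ℤ.<⇒≤ (ℤ.≰⇒> k≰a))) p)
                                         (V-≤ (ℤ.i<j⇒suc[i]≤j b<a) (v⇒V eq)))))
              (ℤ.<⇒≱ (ℤ.suc[i]≤j⇒i<j ℤ.≤-refl))

  -- The value ∞ may be shared, since several terms of a linear combination may vanish.
  Separated : ∀ {n} → (Fin n → Carrier) → Set
  Separated f = ∀ i j → i ≢ j → v (f i) ≡ v (f j) → v (f i) ≡ ⊤⁺

  -- The induction carries along that v (∑ f) is ∞ or the value of some term. Hence the head is
  -- separated from the sum of the tail because it is separated from each term of the tail, and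
  -- `ultra` applies to both.
  V-∑⁻ : ∀ {k n} {f : Fin n → Carrier} → Separated f → V k (∑ f) → ∀ i → V k (f i)
  V-∑⁻ {k} {n} {f} sep = proj₁ (go n f sep) k
    where
    go : ∀ n (f : Fin n → Carrier) → Separated f →
         (∀ k → V k (∑ f) → ∀ i → V k (f i)) × (v (∑ f) ≡ ⊤⁺ ⊎ ∃[ i ] v (∑ f) ≡ v (f i))
    go ℕ.zero    f sep = (λ _ _ ()) , inj₁ (Equivalence.from (v-∞ _) (∑-[] f))
    go (ℕ.suc n) f sep = (λ k p → below k (V-resp (∑-∷ f) p)) ,
      subst (λ a → a ≡ ⊤⁺ ⊎ ∃[ i ] a ≡ v (f i)) (v-cong (≈-sym (∑-∷ f))) attained
      where
      x = f zero
      R = ∑ (λ i → f (suc i))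
      IH = go n (λ i → f (suc i)) (λ i j i≢j → sep (suc i) (suc j) (i≢j ∘ Fin.suc-injective))
      sep-R : v x ≡ v R → v x ≡ ⊤⁺
      sep-R eq with proj₂ IH
      ... | inj₁ R≡⊤       = trans eq R≡⊤
      ... | inj₂ (j , R≡j) = sep zero (suc j) (λ ()) (trans eq R≡j)
      below-x : ∀ {k} → V k (x + R) → V k x
      below-x = ultra sep-R
      below-R : ∀ {k} → V k (x + R) → V k R
      below-R p = ultra (λ eq → trans eq (sep-R (sym eq))) (V-resp (+-comm x R) p)
      below : ∀ k → V k (x + R) → ∀ i → V k (f i)
      below k p zero    = below-x p
      below k p (suc i) = proj₁ IH k (below-R p) i
      attained : v (x + R) ≡ ⊤⁺ ⊎ ∃[ i ] v (x + R) ≡ v (f i)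
      attained with v (x + R) in eq
      ... | ⊤⁺ = inj₁ refl
      ... | [ k ] with ≤⁺.≤⁺-total ℤ.≤-total (v x) (v R)
      ... | inj₁ x≤R = inj₂ (zero , ≤⁺.≤⁺-antisym-≡ ℤ.≤-antisym (below-x (v⇒V eq))
              (subst (v x ≤⁺_) eq (v-+ x R (≤⁺.≤⁺-reflexive-≡ ℤ.≤-reflexive refl) x≤R)))
      ... | inj₂ R≤x with proj₂ IH
      ... | inj₁ R≡⊤ with () ← subst ([_] k ≡_) refl (trans (sym eq) (≤⁺.≤⁺-antisym-≡ ℤ.≤-antisym (_ ≤⊤⁺)
              (subst (_≤⁺ v (x + R)) R≡⊤ (v-+ x R R≤x (≤⁺.≤⁺-reflexive-≡ ℤ.≤-reflexive refl)))))
      ... | inj₂ (j , R≡j) = inj₂ (suc j , trans (≤⁺.≤⁺-antisym-≡ ℤ.≤-antisym (below-R (v⇒V eq))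
              (subst (v R ≤⁺_) eq (v-+ x R R≤x (≤⁺.≤⁺-reflexive-≡ ℤ.≤-reflexive refl)))) R≡j)

-- Linear combinations and coordinates

module Combination {c ℓ m ℓm : Level} {R : Ring c ℓ} (M : LeftModule R m ℓm) where
  open Ring R using (Carrier; _≈_; _+_; _*_; 0#; 1#; _≉_)
  private module R = Ring R
  open LeftModule M
  open Summation R
  private
    module Σᴹ = Sum +ᴹ-commutativeMonoid
    module M± = AbelianGroupProperties +ᴹ-abelianGroup

  opaque
    lc : ∀ {n} → (Fin n → Carrier) → (Fin n → Carrierᴹ) → Carrierᴹ
    lc = linearCombination M

  opaque
    unfolding lc

    lc≈linearCombination : ∀ {n} (cs : Fin n → Carrier) xs → lc cs xs ≈ᴹ linearCombination M cs xs
    lc≈linearCombination cs xs = ≈ᴹ-refl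

    lc-[] : ∀ (cs : Fin 0 → Carrier) xs → lc cs xs ≈ᴹ 0ᴹ
    lc-[] cs xs = ≈ᴹ-refl

    lc-∷ : ∀ {n} (cs : Fin (ℕ.suc n) → Carrier) xs →
           lc cs xs ≈ᴹ cs zero *ₗ xs zero +ᴹ lc (λ i → cs (suc i)) (λ i → xs (suc i))
    lc-∷ cs xs = ≈ᴹ-refl

    lc-cong : ∀ {n} {cs ds : Fin n → Carrier} {xs ys : Fin n → Carrierᴹ} →
              (∀ i → cs i ≈ ds i) → (∀ i → xs i ≈ᴹ ys i) → lc cs xs ≈ᴹ lc ds ys
    lc-cong p q = Σᴹ.sum-cong-≋ (λ i → *ₗ-cong (p i) (q i))

    lc-zero : ∀ {n} {cs : Fin n → Carrier} {xs : Fin n → Carrierᴹ} →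
              (∀ i → cs i *ₗ xs i ≈ᴹ 0ᴹ) → lc cs xs ≈ᴹ 0ᴹ
    lc-zero {n} p = ≈ᴹ-trans (Σᴹ.sum-cong-≋ p) (Σᴹ.sum-replicate-zero n)

    lc-+ : ∀ {n} (cs ds : Fin n → Carrier) (xs : Fin n → Carrierᴹ) →
           lc cs xs +ᴹ lc ds xs ≈ᴹ lc (λ i → cs i + ds i) xs
    lc-+ cs ds xs = ≈ᴹ-trans (≈ᴹ-sym (Σᴹ.∑-distrib-+ (λ i → cs i *ₗ xs i) (λ i → ds i *ₗ xs i)))
      (Σᴹ.sum-cong-≋ (λ i → ≈ᴹ-sym (*ₗ-distribʳ (xs i) (cs i) (ds i))))

    lc-single : ∀ {n} (cs : Fin n → Carrier) (xs : Fin n → Carrierᴹ) j →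
                (∀ i → i ≢ j → cs i *ₗ xs i ≈ᴹ 0ᴹ) → lc cs xs ≈ᴹ cs j *ₗ xs j
    lc-single {n = ℕ.suc n} cs xs j p = ≈ᴹ-trans (Σᴹ.sum-remove {i = j} (λ i → cs i *ₗ xs i))
      (≈ᴹ-trans (+ᴹ-congˡ (lc-zero {cs = λ k → cs (punchIn j k)} {xs = λ k → xs (punchIn j k)}
        (λ k → p (punchIn j k) (Fin.punchInᵢ≢i j k)))) (+ᴹ-identityʳ _))

  lc-congˡ : ∀ {n} {cs ds : Fin n → Carrier} {xs : Fin n → Carrierᴹ} →
             (∀ i → cs i ≈ ds i) → lc cs xs ≈ᴹ lc ds xs
  lc-congˡ p = lc-cong p (λ _ → ≈ᴹ-refl)

  lc-congʳ : ∀ {n} {cs : Fin n → Carrier} {xs ys : Fin n → Carrierᴹ} →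
             (∀ i → xs i ≈ᴹ ys i) → lc cs xs ≈ᴹ lc cs ys
  lc-congʳ = lc-cong (λ _ → R.refl)

  lc-zeroˡ : ∀ {n} {cs : Fin n → Carrier} {xs : Fin n → Carrierᴹ} →
             (∀ i → cs i ≈ 0#) → lc cs xs ≈ᴹ 0ᴹ
  lc-zeroˡ p = lc-zero (λ i → ≈ᴹ-trans (*ₗ-congʳ (p i)) (*ₗ-zeroˡ _))

  lc-*ₗ : ∀ {n} r (cs : Fin n → Carrier) (xs : Fin n → Carrierᴹ) → r *ₗ lc cs xs ≈ᴹ lc (λ i → r * cs i) xs
  lc-*ₗ {ℕ.zero}  r cs xs = ≈ᴹ-trans (*ₗ-congˡ (lc-[] cs xs)) (≈ᴹ-trans (*ₗ-zeroʳ r) (≈ᴹ-sym (lc-[] _ xs)))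
  lc-*ₗ {ℕ.suc n} r cs xs = ≈ᴹ-trans (*ₗ-congˡ (lc-∷ cs xs)) (≈ᴹ-trans (*ₗ-distribˡ r _ _)
    (≈ᴹ-trans (+ᴹ-cong (≈ᴹ-sym (*ₗ-assoc r _ _)) (lc-*ₗ r _ _)) (≈ᴹ-sym (lc-∷ _ xs))))

  lc-neg : ∀ {n} (cs : Fin n → Carrier) (xs : Fin n → Carrierᴹ) → -ᴹ lc cs xs ≈ᴹ lc (λ i → R.- cs i) xs
  lc-neg cs xs = ≈ᴹ-sym (M±.inverseʳ-unique _ _ (≈ᴹ-trans (lc-+ cs _ xs) (lc-zeroˡ (λ i → R.-‿inverseʳ (cs i)))))

  lc-lc : ∀ {n n′} (cs : Fin n → Carrier) (as : Fin n → Fin n′ → Carrier) (xs : Fin n′ → Carrierᴹ) →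
          lc cs (λ i → lc (as i) xs) ≈ᴹ lc (λ j → ∑ (λ i → cs i * as i j)) xs
  lc-lc {ℕ.zero}  cs as xs = ≈ᴹ-trans (lc-[] cs _) (≈ᴹ-sym (lc-zeroˡ (λ _ → ∑-[] _)))
  lc-lc {ℕ.suc n} cs as xs = ≈ᴹ-trans (lc-∷ cs _)
    (≈ᴹ-trans (+ᴹ-cong (lc-*ₗ (cs zero) (as zero) xs) (lc-lc (λ i → cs (suc i)) (λ i → as (suc i)) xs))
    (≈ᴹ-trans (lc-+ _ _ xs) (lc-congˡ (λ j → R.sym (∑-∷ _)))))

  single : ∀ {n} → Fin n → Carrier → Fin n → Carrier
  single j r i with i Fin.≟ j
  ... | yes _ = r
  ... | no  _ = 0#

  single-≡ : ∀ {n} (j : Fin n) r → single j r j ≡ r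
  single-≡ j r with j Fin.≟ j
  ... | yes _  = refl
  ... | no j≢j = contradiction refl j≢j

  single-≢ : ∀ {n} {i j : Fin n} r → i ≢ j → single j r i ≡ 0#
  single-≢ {i = i} {j} r i≢j with i Fin.≟ j
  ... | yes i≡j = contradiction i≡j i≢j
  ... | no  _   = refl

  lc-single* : ∀ {n} (j : Fin n) r xs → lc (single j r) xs ≈ᴹ r *ₗ xs j
  lc-single* j r xs = ≈ᴹ-trans
    (lc-single _ xs j (λ i i≢j → ≈ᴹ-trans (*ₗ-congʳ (R.reflexive (single-≢ r i≢j))) (*ₗ-zeroˡ _)))
    (*ₗ-congʳ (R.reflexive (single-≡ j r)))

  lc-remove : ∀ {n} (cs : Fin n → Carrier) (xs : Fin n → Carrierᴹ) j →
              ∃[ ds ] (lc cs xs ≈ᴹ cs j *ₗ xs j +ᴹ lc ds xs)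
                    × (∀ i → i ≢ j → ds i ≡ cs i) × (ds j ≡ 0#)
  lc-remove cs xs j = ds , eq , ds-≢ , ds-≡
    where
    ds : Fin _ → Carrier
    ds i with i Fin.≟ j
    ... | yes _ = 0#
    ... | no  _ = cs i
    ds-≢ : ∀ i → i ≢ j → ds i ≡ cs i
    ds-≢ i i≢j with i Fin.≟ j
    ... | yes i≡j = contradiction i≡j i≢j
    ... | no  _   = refl
    ds-≡ : ds j ≡ 0#
    ds-≡ with j Fin.≟ j
    ... | yes _  = refl
    ... | no j≢j = contradiction refl j≢j
    cs-ds : ∀ i → i ≢ j → cs i R.- ds i ≈ 0#
    cs-ds i i≢j = R.trans (R.+-congˡ (R.-‿cong (R.reflexive (ds-≢ i i≢j)))) (R.-‿inverseʳ (cs i))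
    eq : lc cs xs ≈ᴹ cs j *ₗ xs j +ᴹ lc ds xs
    eq = begin
      lc cs xs
        ≈⟨ lc-congˡ (λ i → R.trans (R.sym (R.+-identityʳ (cs i))) (R.trans (R.+-congˡ (R.sym (R.-‿inverseˡ (ds i)))) (R.sym (R.+-assoc _ _ _)))) ⟩
      lc (λ i → (cs i R.- ds i) + ds i) xs
        ≈⟨ lc-+ _ ds xs ⟨
      lc (λ i → cs i R.- ds i) xs +ᴹ lc ds xs
        ≈⟨ +ᴹ-congʳ (lc-single _ xs j (λ i i≢j → ≈ᴹ-trans (*ₗ-congʳ (cs-ds i i≢j)) (*ₗ-zeroˡ _))) ⟩
      (cs j R.- ds j) *ₗ xs j +ᴹ lc ds xs
        ≈⟨ +ᴹ-congʳ (*ₗ-congʳ (R.trans (R.+-congˡ (R.trans (R.-‿cong (R.reflexive ds-≡)) (RingProperties.-0#≈0# R))) (R.+-identityʳ (cs j)))) ⟩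
      cs j *ₗ xs j +ᴹ lc ds xs ∎
      where open ≈-Reasoning ≈ᴹ-setoid

  record Basis {n} (xs : Fin n → Carrierᴹ) : Set (c ⊔ ℓ ⊔ m ⊔ ℓm) where
    field
      generates   : Generates M xs
      independent : LinearlyIndependent M xs

    coord : Carrierᴹ → Fin n → Carrier
    coord x = proj₁ (generates x)

    expand : ∀ x → x ≈ᴹ lc (coord x) xs
    expand x = ≈ᴹ-trans (proj₂ (generates x)) (≈ᴹ-sym (lc≈linearCombination _ xs))

    lc-injective : ∀ {cs ds} → lc cs xs ≈ᴹ lc ds xs → ∀ i → cs i ≈ ds i
    lc-injective {cs = cs} {ds = ds} eq i = R.trans (R.sym (R.+-identityʳ (cs i)))
      (R.trans (R.+-congˡ (R.sym (R.-‿inverseˡ (ds i)))) (R.trans (R.sym (R.+-assoc _ _ _))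
        (R.trans (R.+-congʳ (independent (λ i → cs i R.- ds i) (≈ᴹ-trans (≈ᴹ-sym (lc≈linearCombination _ xs)) zero-lc) i)) (R.+-identityˡ (ds i)))))
      where
      zero-lc : lc (λ i → cs i R.- ds i) xs ≈ᴹ 0ᴹ
      zero-lc = ≈ᴹ-trans (≈ᴹ-sym (lc-+ cs _ xs)) (≈ᴹ-trans (+ᴹ-cong eq (≈ᴹ-sym (lc-neg ds xs))) (-ᴹ‿inverseʳ _))

    -- Independence makes the coefficients chosen by `generates` unique; the linearity of `coord`
    -- below follows from this.
    coord-lc : ∀ {x cs} → x ≈ᴹ lc cs xs → ∀ i → coord x i ≈ cs i
    coord-lc {x} eq = lc-injective (≈ᴹ-trans (≈ᴹ-sym (expand x)) eq)

    coord-cong : ∀ {x y} → x ≈ᴹ y → ∀ i → coord x i ≈ coord y i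
    coord-cong {x} {y} eq = coord-lc (≈ᴹ-trans eq (expand y))

    coord-+ : ∀ x y i → coord (x +ᴹ y) i ≈ coord x i + coord y i
    coord-+ x y = coord-lc (≈ᴹ-trans (+ᴹ-cong (expand x) (expand y)) (lc-+ _ _ xs))

    coord-*ₗ : ∀ r x i → coord (r *ₗ x) i ≈ r * coord x i
    coord-*ₗ r x = coord-lc (≈ᴹ-trans (*ₗ-congˡ (expand x)) (lc-*ₗ r (coord x) xs))

    coord-neg : ∀ x i → coord (-ᴹ x) i ≈ R.- coord x i
    coord-neg x = coord-lc (≈ᴹ-trans (-ᴹ‿cong (expand x)) (lc-neg (coord x) xs))

    coord-lc∘ : ∀ {n′} (cs : Fin n′ → Carrier) ys i → coord (lc cs ys) i ≈ ∑ (λ j → cs j * coord (ys j) i)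
    coord-lc∘ cs ys = coord-lc (≈ᴹ-trans (lc-congʳ (λ j → expand (ys j))) (lc-lc cs (λ j → coord (ys j)) xs))

    coord-0 : ∀ i → coord 0ᴹ i ≈ 0#
    coord-0 = coord-lc (≈ᴹ-sym (lc-zeroˡ (λ _ → R.refl)))

    private
      expand-self : ∀ j → xs j ≈ᴹ lc (single j 1#) xs
      expand-self j = ≈ᴹ-sym (≈ᴹ-trans (lc-single* j 1# xs) (*ₗ-identityˡ _))

    coord-self : ∀ j → coord (xs j) j ≈ 1#
    coord-self j = R.trans (coord-lc (expand-self j) j) (R.reflexive (single-≡ j 1#))

    coord-other : ∀ {i j} → i ≢ j → coord (xs j) i ≈ 0#
    coord-other {i} {j} i≢j = R.trans (coord-lc (expand-self j) i) (R.reflexive (single-≢ 1# i≢j))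

module LinearMap {c ℓ m ℓm m′ ℓm′ : Level} {R : Ring c ℓ} (M : LeftModule R m ℓm) (M′ : LeftModule R m′ ℓm′) where
  private
    module R  = Ring R
    module M  = LeftModule M
    module M′ = LeftModule M′

    open Combination M using () renaming (lc to lcᴹ; lc-[] to lcᴹ-[]; lc-∷ to lcᴹ-∷)
    open Combination M′ using (lc; lc-[]; lc-∷)

  lc-map : (f : M.Carrierᴹ → M′.Carrierᴹ) → (∀ {x y} → x M.≈ᴹ y → f x M′.≈ᴹ f y) →
           (∀ x y → f (x M.+ᴹ y) M′.≈ᴹ f x M′.+ᴹ f y) → (∀ r x → f (r M.*ₗ x) M′.≈ᴹ r M′.*ₗ f x) →
           ∀ {n} (cs : Fin n → R.Carrier) xs → f (lcᴹ cs xs) M′.≈ᴹ lc cs (λ i → f (xs i))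
  lc-map f f-cong f-+ f-* {ℕ.zero} cs xs = M′.≈ᴹ-trans
    (f-cong (M.≈ᴹ-trans (lcᴹ-[] cs xs) (M.≈ᴹ-sym (M.*ₗ-zeroˡ M.0ᴹ))))
    (M′.≈ᴹ-trans (f-* R.0# M.0ᴹ) (M′.≈ᴹ-trans (M′.*ₗ-zeroˡ _) (M′.≈ᴹ-sym (lc-[] cs _))))
  lc-map f f-cong f-+ f-* {ℕ.suc n} cs xs = M′.≈ᴹ-trans (f-cong (lcᴹ-∷ cs xs))
    (M′.≈ᴹ-trans (f-+ _ _)
      (M′.≈ᴹ-trans (M′.+ᴹ-cong (f-* _ _) (lc-map f f-cong f-+ f-* _ _)) (M′.≈ᴹ-sym (lc-∷ cs _))))

-- Linear algebra over a division ring

module DivisionRing {r ℓ : Level} (R : Ring r ℓ)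
         (_≈0? : ∀ x → Dec (Ring._≈_ R x (Ring.0# R)))
         (1≉0 : ¬ Ring._≈_ R (Ring.1# R) (Ring.0# R))
         (invˡ : ∀ x → ¬ Ring._≈_ R x (Ring.0# R) → ∃[ y ] Ring._≈_ R (Ring._*_ R y x) (Ring.1# R))
         where
  open Ring R hiding (zero) renaming (refl to ≈-refl; sym to ≈-sym; trans to ≈-trans)
  open Summation R
  open RingProperties R using (-‿distribˡ-*; -‿distribʳ-*)

  -- Gaussian elimination with the unknowns on the left. If the first equation is trivial, it is
  -- dropped together with the first unknown, which is set to 0. Otherwise the unknown `p` has an
  -- invertible coefficient there: a multiple of row `p` is subtracted from every other row, and the
  -- value at `p` is chosen afterwards so that the first equation holds.
  homogeneous-system : ∀ m (a : Fin (ℕ.suc m) → Fin m → Carrier) →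
    Σ[ c ∈ (Fin (ℕ.suc m) → Carrier) ] (Σ[ j ∈ Fin (ℕ.suc m) ] c j ≉ 0#) × (∀ i → ∑ (λ j → c j * a j i) ≈ 0#)
  homogeneous-system ℕ.zero    a = (λ _ → 1#) , (zero , 1≉0) , λ ()
  homogeneous-system (ℕ.suc m) a with Fin.any? (λ j → ¬? (a j zero ≈0?))
  ... | no none = c , (suc (proj₁ c′≉0) , proj₂ c′≉0) , solves
    where
    a₀≈0 : ∀ j → a j zero ≈ 0#
    a₀≈0 j = decidable-stable (a j zero ≈0?) (λ a≉0 → none (j , a≉0))
    IH = homogeneous-system m (λ j i → a (suc j) (suc i))
    c′ = proj₁ IH
    c′≉0 = proj₁ (proj₂ IH)
    c : Fin (ℕ.suc (ℕ.suc m)) → Carrier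
    c = 0# Vector.∷ c′
    solves : ∀ i → ∑ (λ j → c j * a j i) ≈ 0#
    solves zero    = ∑-zero (λ j → ≈-trans (*-congˡ (a₀≈0 j)) (zeroʳ (c j)))
    solves (suc i) = ≈-trans (∑-∷ _) (≈-trans (+-cong (zeroˡ _) (proj₂ (proj₂ IH) i)) (+-identityˡ 0#))
  ... | yes (p , aₚ≉0) = c , (punchIn p (proj₁ c′≉0) , c≉0) , solves
    where
    a⁻¹ = proj₁ (invˡ _ aₚ≉0)
    b : Fin (ℕ.suc m) → Fin (ℕ.suc m) → Carrier
    b k i = a (punchIn p k) i - (a (punchIn p k) zero * a⁻¹) * a p i
    IH = homogeneous-system m (λ k i → b k (suc i))
    c′ = proj₁ IH
    c′≉0 = proj₁ (proj₂ IH)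
    S = ∑ (λ k → c′ k * a (punchIn p k) zero)
    c : Fin (ℕ.suc (ℕ.suc m)) → Carrier
    c = insertAt c′ p (- (S * a⁻¹))
    c≉0 : c (punchIn p (proj₁ c′≉0)) ≉ 0#
    c≉0 eq = proj₂ c′≉0 (≈-trans (reflexive (sym (insertAt-punchIn c′ p _ (proj₁ c′≉0)))) eq)
    b₀≈0 : ∀ k → b k zero ≈ 0#
    b₀≈0 k = ≈-trans (+-congˡ (-‿cong (≈-trans (*-assoc _ _ _) (≈-trans (*-congˡ (proj₂ (invˡ _ aₚ≉0))) (*-identityʳ _)))))
      (-‿inverseʳ _)
    eliminated : ∀ i → ∑ (λ j → c j * a j i) ≈ ∑ (λ k → c′ k * b k i)
    eliminated i = begin
      ∑ (λ j → c j * a j i)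
        ≈⟨ ∑-remove _ p ⟩
      c p * a p i + ∑ (λ k → c (punchIn p k) * a (punchIn p k) i)
        ≈⟨ +-cong (*-congʳ (reflexive (insertAt-lookup c′ p _)))
                  (∑-cong (λ k → *-congʳ (reflexive (insertAt-punchIn c′ p _ k)))) ⟩
      - (S * a⁻¹) * a p i + ∑ (λ k → c′ k * a (punchIn p k) i)
        ≈⟨ +-congʳ (≈-trans (*-congʳ (-‿distribʳ-* S a⁻¹)) (≈-trans (*-assoc _ _ _) (∑-* _ _))) ⟩
      ∑ (λ k → (c′ k * a (punchIn p k) zero) * (- a⁻¹ * a p i)) + ∑ (λ k → c′ k * a (punchIn p k) i)
        ≈⟨ ∑-+ _ _ ⟨
      ∑ (λ k → (c′ k * a (punchIn p k) zero) * (- a⁻¹ * a p i) + c′ k * a (punchIn p k) i)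
        ≈⟨ ∑-cong (λ k → ≈-trans (+-comm _ _) (≈-trans (+-congˡ (≈-trans (*-assoc _ _ _)
             (*-congˡ (≈-trans (*-congˡ (≈-sym (-‿distribˡ-* _ _))) (≈-trans (≈-sym (-‿distribʳ-* _ _)) (-‿cong (≈-sym (*-assoc _ _ _))))))))
             (≈-sym (distribˡ _ _ _)))) ⟩
      ∑ (λ k → c′ k * b k i) ∎
      where open ≈-Reasoning setoid
    solves : ∀ i → ∑ (λ j → c j * a j i) ≈ 0#
    solves zero    = ≈-trans (eliminated zero) (∑-zero (λ k → ≈-trans (*-congˡ (b₀≈0 k)) (zeroʳ (c′ k))))
    solves (suc i) = ≈-trans (eliminated (suc i)) (proj₂ (proj₂ IH) i)

  -- If m < n, then m + 1 rows of `a` satisfy a nontrivial relation c, and c = c(ax) = (ca)x = 0 is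
  -- a contradiction.
  identity-factors⇒≤ : ∀ {n m} (a : Fin n → Fin m → Carrier) (x : Fin m → Fin n → Carrier) →
    (∀ u → ∑ (λ i → a u i * x i u) ≈ 1#) → (∀ u v → u ≢ v → ∑ (λ i → a u i * x i v) ≈ 0#) → n ℕ.≤ m
  identity-factors⇒≤ {n} {m} a x diagonal off-diagonal = ℕ.≮⇒≥ impossible
    where
    impossible : ¬ m ℕ.< n
    impossible m<n with homogeneous-system m (λ u i → a (inject≤ u m<n) i)
    ... | c , (j , cj≉0) , solves = cj≉0 $ begin
      c j
        ≈⟨ *-identityʳ _ ⟨
      c j * 1#
        ≈⟨ *-congˡ (diagonal (inj j)) ⟨
      c j * ∑ (λ i → a (inj j) i * x i (inj j))
        ≈⟨ ∑-single _ j (λ k k≢j → ≈-trans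
             (*-congˡ (off-diagonal _ _ (k≢j ∘ Fin.inject≤-injective m<n m<n _ _))) (zeroʳ _)) ⟨
      ∑ (λ u → c u * ∑ (λ i → a (inj u) i * x i (inj j)))
        ≈⟨ ∑-cong (λ u → ≈-trans (*-∑ _ _) (∑-cong (λ i → ≈-sym (*-assoc _ _ _)))) ⟩
      ∑ (λ u → ∑ (λ i → (c u * a (inj u) i) * x i (inj j)))
        ≈⟨ ∑-swap _ ⟩
      ∑ (λ i → ∑ (λ u → (c u * a (inj u) i) * x i (inj j)))
        ≈⟨ ∑-zero (λ i → ≈-trans (≈-sym (∑-* _ _)) (≈-trans (*-congʳ (solves i)) (zeroˡ _))) ⟩
      0# ∎
      where
      inj = λ u → inject≤ u m<n
      open ≈-Reasoning setoid

  module _ {m ℓm : Level} (M : LeftModule R m ℓm) where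
    open LeftModule M
    open Combination M

    -- The n + 1 vectors z, ys expanded in the n generators xs satisfy a nontrivial relation. Its
    -- coefficient at z is nonzero because the ys are independent, and the relation can be solved
    -- for z.
    independent⇒generates : ∀ {n} {xs ys : Fin n → Carrierᴹ} →
      Generates M xs → LinearlyIndependent M ys → Generates M ys
    independent⇒generates {n} {xs} {ys} gen indep z
      with homogeneous-system n (λ j → proj₁ (gen ((z Vector.∷ ys) j)))
    ... | c , (j , cj≉0) , solves = coefficients , eq
      where
      gen′ : ∀ x → x ≈ᴹ lc (proj₁ (gen x)) xs
      gen′ x = ≈ᴹ-trans (proj₂ (gen x)) (≈ᴹ-sym (lc≈linearCombination _ xs))
      relation : lc c (z Vector.∷ ys) ≈ᴹ 0ᴹ
      relation = ≈ᴹ-trans (lc-congʳ (λ j → gen′ ((z Vector.∷ ys) j)))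
        (≈ᴹ-trans (lc-lc c (λ j → proj₁ (gen ((z Vector.∷ ys) j))) xs) (lc-zeroˡ solves))
      relation-∷ : c zero *ₗ z +ᴹ lc (c ∘ suc) ys ≈ᴹ 0ᴹ
      relation-∷ = ≈ᴹ-trans (≈ᴹ-sym (lc-∷ c (z Vector.∷ ys))) relation
      c₀≉0 : c zero ≉ 0#
      c₀≉0 c₀≈0 = nonzero j cj≉0
        where
        tail≈0 : lc (c ∘ suc) ys ≈ᴹ 0ᴹ
        tail≈0 = ≈ᴹ-trans (≈ᴹ-sym (+ᴹ-identityˡ _))
          (≈ᴹ-trans (+ᴹ-congʳ (≈ᴹ-sym (≈ᴹ-trans (*ₗ-congʳ c₀≈0) (*ₗ-zeroˡ z)))) relation-∷)
        nonzero : ∀ j → ¬ c j ≉ 0#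
        nonzero zero    c≉0 = c≉0 c₀≈0
        nonzero (suc k) c≉0 = c≉0 (indep (c ∘ suc) (≈ᴹ-trans (≈ᴹ-sym (lc≈linearCombination _ ys)) tail≈0) k)
      c₀⁻¹ = proj₁ (invˡ _ c₀≉0)
      coefficients : Fin n → Carrier
      coefficients k = - (c₀⁻¹ * c (suc k))
      eq : z ≈ᴹ linearCombination M coefficients ys
      eq = begin
        z                                 ≈⟨ *ₗ-identityˡ z ⟨
        1# *ₗ z                           ≈⟨ *ₗ-congʳ (proj₂ (invˡ _ c₀≉0)) ⟨
        (c₀⁻¹ * c zero) *ₗ z              ≈⟨ *ₗ-assoc _ _ _ ⟩
        c₀⁻¹ *ₗ (c zero *ₗ z)             ≈⟨ *ₗ-congˡ (AbelianGroupProperties.inverseˡ-unique +ᴹ-abelianGroup _ _ relation-∷) ⟩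
        c₀⁻¹ *ₗ (-ᴹ lc (c ∘ suc) ys)      ≈⟨ *ₗ-congˡ (lc-neg _ ys) ⟩
        c₀⁻¹ *ₗ lc (λ k → - c (suc k)) ys ≈⟨ lc-*ₗ c₀⁻¹ _ ys ⟩
        lc (λ k → c₀⁻¹ * - c (suc k)) ys  ≈⟨ lc-congˡ (λ k → ≈-sym (-‿distribʳ-* _ _)) ⟩
        lc coefficients ys                ≈⟨ lc≈linearCombination _ ys ⟩
        linearCombination M coefficients ys ∎
        where open ≈-Reasoning ≈ᴹ-setoid

-- Lattices over 𝔒_K and Nakayama's lemma

module Lattice {k ℓk m ℓm : Level} {K : Field k ℓk} (vK : DiscreteValuation K)
         (M : LeftModule (Field.ring K) m ℓm) where
  open Field K using (Carrier; _≈_; _+_; _*_; _-_; -_; 0#; 1#)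
  private module K = Field K
  open Valued vK
  open LeftModule M
  open Combination M

  -- An 𝔒_K-submodule, given as a predicate on the ambient K-space. In this form powers of 𝔓_L,
  -- 𝔄-submodules of 𝔓_L^h, left ideals of 𝔄 and 𝔐² can be added and compared inside L or A.
  record IsLattice {ℓn : Level} (N : Pred Carrierᴹ ℓn) : Set (k ⊔ m ⊔ ℓm ⊔ ℓn) where
    field
      ∈-resp : ∀ {x y} → x ≈ᴹ y → N x → N y
      0ᴹ∈   : N 0ᴹ
      ∈-+   : ∀ {x y} → N x → N y → N (x +ᴹ y)
      ∈-*   : ∀ {c x} → V (+ 0) c → N x → N (c *ₗ x)

    ∈-neg : ∀ {x} → N x → N (-ᴹ x)
    ∈-neg {x} x∈ = ∈-resp
      (AbelianGroupProperties.inverseʳ-unique +ᴹ-abelianGroup _ _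
        (≈ᴹ-trans (+ᴹ-congʳ (≈ᴹ-sym (*ₗ-identityˡ x)))
        (≈ᴹ-trans (≈ᴹ-sym (*ₗ-distribʳ x 1# (- 1#))) (≈ᴹ-trans (*ₗ-congʳ (K.-‿inverseʳ 1#)) (*ₗ-zeroˡ x)))))
      (∈-* (V-neg (Unit⇒V0 v-1#)) x∈)

    ∈-lc : ∀ {n} {cs : Fin n → Carrier} {xs} → (∀ i → N (cs i *ₗ xs i)) → N (lc cs xs)
    ∈-lc {ℕ.zero}  p = ∈-resp (≈ᴹ-sym (lc-[] _ _)) 0ᴹ∈
    ∈-lc {ℕ.suc n} p = ∈-resp (≈ᴹ-sym (lc-∷ _ _)) (∈-+ (p zero) (∈-lc (λ i → p (suc i))))

    ∈-unit⁻ : ∀ {c x} → Unit c → N (c *ₗ x) → N x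
    ∈-unit⁻ {c} {x} u p with v-inverse u
    ... | c⁻¹ , cc⁻¹≈1 , u⁻¹ = ∈-resp
      (≈ᴹ-trans (≈ᴹ-sym (*ₗ-assoc _ _ _))
        (≈ᴹ-trans (*ₗ-congʳ (K.trans (K.*-comm _ _) cc⁻¹≈1)) (*ₗ-identityˡ x)))
      (∈-* (Unit⇒V0 u⁻¹) p)

    -- With `∈-unit⁻` this solves a triangular congruence for its leading vector: the other terms
    -- are already in N and the leading coefficient is a unit.
    ∈-isolate : ∀ {n} {cs : Fin n → Carrier} {xs} j → N (lc cs xs) →
                  (∀ i → i ≢ j → N (cs i *ₗ xs i)) → N (cs j *ₗ xs j)
    ∈-isolate {cs = cs} {xs} j p q with lc-remove cs xs j
    ... | ds , eq , ds-≢ , ds-≡ = ∈-resp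
      (≈ᴹ-trans (+ᴹ-congʳ eq) (≈ᴹ-trans (+ᴹ-assoc _ _ _) (≈ᴹ-trans (+ᴹ-congˡ (-ᴹ‿inverseʳ _)) (+ᴹ-identityʳ _))))
      (∈-+ p (∈-neg (∈-lc ds∈)))
      where
      ds∈ : ∀ i → N (ds i *ₗ xs i)
      ds∈ i with i Fin.≟ j
      ... | yes refl = ∈-resp (≈ᴹ-sym (≈ᴹ-trans (*ₗ-congʳ (K.reflexive ds-≡)) (*ₗ-zeroˡ _))) 0ᴹ∈
      ... | no i≢j   = ∈-resp (*ₗ-congʳ (K.reflexive (sym (ds-≢ i i≢j)))) (q i i≢j)

  Join : ∀ {ℓ₁ ℓ₂} → Pred Carrierᴹ ℓ₁ → Pred Carrierᴹ ℓ₂ → Pred Carrierᴹ (m ⊔ ℓm ⊔ ℓ₁ ⊔ ℓ₂)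
  Join N P x = ∃[ y ] ∃[ z ] N y × P z × x ≈ᴹ y +ᴹ z

  module _ {ℓ₁ ℓ₂ : Level} {N : Pred Carrierᴹ ℓ₁} {P : Pred Carrierᴹ ℓ₂} (latN : IsLattice N) (latP : IsLattice P) where
    private
      module N = IsLattice latN
      module P = IsLattice latP

    Join-isLattice : IsLattice (Join N P)
    Join-isLattice = record
      { ∈-resp = λ eq → λ (y , z , y∈ , z∈ , eq′) → y , z , y∈ , z∈ , ≈ᴹ-trans (≈ᴹ-sym eq) eq′
      ; 0ᴹ∈   = 0ᴹ , 0ᴹ , N.0ᴹ∈ , P.0ᴹ∈ , ≈ᴹ-sym (+ᴹ-identityˡ 0ᴹ)
      ; ∈-+   = λ (y , z , y∈ , z∈ , eq) (y′ , z′ , y′∈ , z′∈ , eq′) →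
                 y +ᴹ y′ , z +ᴹ z′ , N.∈-+ y∈ y′∈ , P.∈-+ z∈ z′∈ , ≈ᴹ-trans (+ᴹ-cong eq eq′) (interchange y z y′ z′)
      ; ∈-*   = λ {c} c∈ (y , z , y∈ , z∈ , eq) →
                 c *ₗ y , c *ₗ z , N.∈-* c∈ y∈ , P.∈-* c∈ z∈ , ≈ᴹ-trans (*ₗ-congˡ eq) (*ₗ-distribˡ c y z)
      }
      where open CommutativeSemigroupProperties (CommutativeMonoid.commutativeSemigroup +ᴹ-commutativeMonoid) using (interchange)

    ⊆Joinˡ : ∀ {x} → N x → Join N P x
    ⊆Joinˡ {x} x∈ = x , 0ᴹ , x∈ , P.0ᴹ∈ , ≈ᴹ-sym (+ᴹ-identityʳ x)

    ⊆Joinʳ : ∀ {x} → P x → Join N P x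
    ⊆Joinʳ {x} x∈ = 0ᴹ , x , N.0ᴹ∈ , x∈ , ≈ᴹ-sym (+ᴹ-identityˡ x)

  -- The first generator is eliminated by inverting 1 - c₀₀, which is a
  -- unit as c₀₀ ∈ 𝔓; this is substituted into the other relations.
  nakayama : ∀ {ℓn} {N : Pred Carrierᴹ ℓn} → IsLattice N → ∀ {n} (y : Fin n → Carrierᴹ) →
    (∀ i → ∃[ z ] Σ[ c ∈ (Fin n → Carrier) ] N z × (∀ j → V (+ 1) (c j)) × y i ≈ᴹ z +ᴹ lc c y) →
    ∀ i → N (y i)
  nakayama {N = N} lat {ℕ.suc n} y rel = λ { zero → y₀∈ ; (suc i) → y′∈ i }
    where
    open IsLattice lat
    open ≈-Reasoning ≈ᴹ-setoid
    open CommutativeSemigroupProperties (CommutativeMonoid.commutativeSemigroup +ᴹ-commutativeMonoid)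
      using (x∙yz≈y∙xz)
    z = λ i → proj₁ (rel i)
    c = λ i → proj₁ (proj₂ (rel i))
    z∈ = λ i → proj₁ (proj₂ (proj₂ (rel i)))
    c∈ = λ i → proj₁ (proj₂ (proj₂ (proj₂ (rel i))))
    y′ = λ i → y (suc i)
    rel-∷ : ∀ i → y i ≈ᴹ z i +ᴹ (c i zero *ₗ y zero +ᴹ lc (λ j → c i (suc j)) y′)
    rel-∷ i = ≈ᴹ-trans (proj₂ (proj₂ (proj₂ (proj₂ (rel i))))) (+ᴹ-congˡ (lc-∷ _ _))
    e = 1# - c zero zero
    e-unit : Unit e
    e-unit = Unit-≡ (V-resp (K.sym (AbelianGroupProperties.xyx⁻¹≈y K.+-abelianGroup 1# _)) (V-neg (c∈ zero zero))) v-1#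
    e⁻¹ = proj₁ (v-inverse e-unit)
    e⁻¹∈ : V (+ 0) e⁻¹
    e⁻¹∈ = Unit⇒V0 (proj₂ (proj₂ (v-inverse e-unit)))
    e⁻¹e≈1 : e⁻¹ * e ≈ 1#
    e⁻¹e≈1 = K.trans (K.*-comm _ _) (proj₁ (proj₂ (v-inverse e-unit)))
    r = z zero +ᴹ lc (λ j → c zero (suc j)) y′
    e*y₀ : e *ₗ y zero ≈ᴹ r
    e*y₀ = begin
      e *ₗ y zero
        ≈⟨ *ₗ-distribʳ _ _ _ ⟩
      1# *ₗ y zero +ᴹ (- c zero zero) *ₗ y zero
        ≈⟨ +ᴹ-cong (≈ᴹ-trans (*ₗ-identityˡ _) (≈ᴹ-trans (rel-∷ zero) (x∙yz≈y∙xz _ _ _))) ≈ᴹ-refl ⟩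
      (c zero zero *ₗ y zero +ᴹ r) +ᴹ (- c zero zero) *ₗ y zero
        ≈⟨ ≈ᴹ-trans (+ᴹ-congʳ (+ᴹ-comm _ _)) (+ᴹ-assoc _ _ _) ⟩
      r +ᴹ (c zero zero *ₗ y zero +ᴹ (- c zero zero) *ₗ y zero)
        ≈⟨ +ᴹ-congˡ (≈ᴹ-trans (≈ᴹ-sym (*ₗ-distribʳ _ _ _)) (≈ᴹ-trans (*ₗ-congʳ (K.-‿inverseʳ _)) (*ₗ-zeroˡ _))) ⟩
      r +ᴹ 0ᴹ
        ≈⟨ +ᴹ-identityʳ r ⟩
      r ∎
    y₀≈ : y zero ≈ᴹ e⁻¹ *ₗ z zero +ᴹ lc (λ j → e⁻¹ * c zero (suc j)) y′
    y₀≈ = begin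
      y zero                  ≈⟨ *ₗ-identityˡ _ ⟨
      1# *ₗ y zero            ≈⟨ *ₗ-congʳ e⁻¹e≈1 ⟨
      (e⁻¹ * e) *ₗ y zero     ≈⟨ *ₗ-assoc _ _ _ ⟩
      e⁻¹ *ₗ (e *ₗ y zero)    ≈⟨ *ₗ-congˡ e*y₀ ⟩
      e⁻¹ *ₗ r                ≈⟨ *ₗ-distribˡ _ _ _ ⟩
      e⁻¹ *ₗ z zero +ᴹ e⁻¹ *ₗ lc (λ j → c zero (suc j)) y′ ≈⟨ +ᴹ-congˡ (lc-*ₗ _ _ _) ⟩
      e⁻¹ *ₗ z zero +ᴹ lc (λ j → e⁻¹ * c zero (suc j)) y′ ∎
    y′∈ : ∀ i → N (y′ i)
    y′∈ = nakayama lat y′ λ i →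
      z (suc i) +ᴹ c (suc i) zero *ₗ (e⁻¹ *ₗ z zero) ,
      (λ j → c (suc i) zero * (e⁻¹ * c zero (suc j)) + c (suc i) (suc j)) ,
      ∈-+ (z∈ (suc i)) (∈-* (V1⇒V0 (c∈ (suc i) zero)) (∈-* e⁻¹∈ (z∈ zero))) ,
      (λ j → V-+ (V-*0 (c∈ (suc i) zero) (V-0* e⁻¹∈ (V1⇒V0 (c∈ zero (suc j))))) (c∈ (suc i) (suc j))) ,
      (begin
        y (suc i)
          ≈⟨ rel-∷ (suc i) ⟩
        z (suc i) +ᴹ (c (suc i) zero *ₗ y zero +ᴹ lc (λ j → c (suc i) (suc j)) y′)
          ≈⟨ +ᴹ-congˡ (+ᴹ-congʳ (≈ᴹ-trans (*ₗ-congˡ y₀≈) (≈ᴹ-trans (*ₗ-distribˡ _ _ _) (+ᴹ-congˡ (lc-*ₗ _ _ _))))) ⟩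
        z (suc i) +ᴹ ((c (suc i) zero *ₗ (e⁻¹ *ₗ z zero) +ᴹ lc _ y′) +ᴹ lc _ y′)
          ≈⟨ ≈ᴹ-trans (+ᴹ-congˡ (+ᴹ-assoc _ _ _)) (≈ᴹ-sym (+ᴹ-assoc _ _ _)) ⟩
        (z (suc i) +ᴹ c (suc i) zero *ₗ (e⁻¹ *ₗ z zero)) +ᴹ (lc _ y′ +ᴹ lc _ y′)
          ≈⟨ +ᴹ-congˡ (lc-+ _ _ y′) ⟩
        (z (suc i) +ᴹ c (suc i) zero *ₗ (e⁻¹ *ₗ z zero)) +ᴹ lc _ y′ ∎)
    y₀∈ : N (y zero)
    y₀∈ = ∈-resp (≈ᴹ-sym y₀≈) (∈-+ (∈-* e⁻¹∈ (z∈ zero))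
      (∈-lc (λ j → ∈-* (V-0* e⁻¹∈ (V1⇒V0 (c∈ zero (suc j)))) (y′∈ j))))

-- The interface between combinatorics and valuations

-- Acts s u t says that Φₛ maps y_u to a unit multiple of y_t modulo
-- π𝔓_L^h, and Mult s s′ r that Φₛ Φₛ′ is a unit multiple of Φᵣ modulo π𝔄.
record ShiftTable (N : ℕ) : Set₁ where
  field
    0ˢ   : Fin N
    Acts : Fin N → Fin N → Fin N → Set
    Mult : Fin N → Fin N → Fin N → Set
    acts? : ∀ s u t → Dec (Acts s u t)
    mult? : ∀ s s′ r → Dec (Mult s s′ r)
    acts-total      : ∀ s → ∃₂ λ u t → Acts s u t
    acts-injective  : ∀ {s s′ u t} → Acts s u t → Acts s′ u t → s ≡ s′
    acts-functional : ∀ {s u t t′} → Acts s u t → Acts s u t′ → t ≡ t′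
    acts-∘⇒mult     : ∀ {s s′ r u m t} → Acts s′ u m → Acts s m t → Acts r u t → Mult s s′ r
    mult⇒acts-∘     : ∀ {s s′ r u t} → Mult s s′ r → Acts r u t → ∃[ m ] Acts s′ u m × Acts s m t
    mult-identityʳ  : ∀ s → Mult s 0ˢ s
    mult-functional : ∀ {s s′ r r′} → Mult s s′ r → Mult s s′ r′ → r ≡ r′
    mult-increasing : ∀ {s s′ r} → Mult s s′ r → s′ ≢ 0ˢ → toℕ s ℕ.< toℕ r
    𝒟  : Pred (Fin N) 0ℓ
    𝒟? : Decidable 𝒟
    𝒟⇒ : ∀ {u s v} → 𝒟 u → Acts s v u → s ≡ 0ˢ
    ¬𝒟⇒ : ∀ {u} → ¬ 𝒟 u → ∃₂ λ s v → s ≢ 0ˢ × Acts s v u × toℕ v ℕ.< toℕ u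
    ℰ  : Pred (Fin N) 0ℓ
    ℰ? : Decidable ℰ
    ℰ⇒ : ∀ {u s s′} → ℰ u → Mult s s′ u → s ≡ 0ˢ ⊎ s′ ≡ 0ˢ
    ¬ℰ⇒ : ∀ {u} → ¬ ℰ u → ∃₂ λ s s′ → s ≢ 0ˢ × s′ ≢ 0ˢ × Mult s s′ u
    0∈ℰ : ℰ 0ˢ

-- What the algebraic part takes from the scaffold. In `y-reduced`, 𝔓_L to the power h + Nm is
-- π^m𝔓_L^h, since the ramification index is N; so the y_u span 𝔓_L^h over 𝔒_K. The last two fields
-- describe Φₛ modulo π as a partial shift with unit coefficients.
record AdaptedBases {k ℓk l ℓl a ℓa : Level} {K : Field k ℓk} {vK : DiscreteValuation K}
         {L : Extension K l ℓl} {vL : DiscreteValuation (Extension.extensionField L)} {N : ℕ}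
         (L/K : TotallyRamified vK L vL N) {A : Algebra K a ℓa} (A↷L : Action A L)
         (h : ℤ) (T : ShiftTable N) : Set (k ⊔ ℓk ⊔ l ⊔ ℓl ⊔ a ⊔ ℓa) where
  private
    module L = Extension L
    module A = Algebra A
    module VK = Valued vK
    module VL = Valued vL
  open ShiftTable T
  open Action A↷L using (_·_)
  open Combination L.vectorSpace
  field
    y       : Fin N → L.Carrier
    y∈      : ∀ u → VL.V h (y u)
    y-reduced : ∀ {m} c → VL.V (h ℤ.+ + N ℤ.* m) (lc c y) → ∀ u → VK.V m (c u)
    y-basis : Basis y
    Φ       : Fin N → A.Carrier
    Φ0≈1    : Φ 0ˢ A.≈ A.1#
    Φ·1≈0   : ∀ {s} → s ≢ 0ˢ → Φ s · L.1# L.≈ L.0#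
  open Basis y-basis
  field
    acts⇒unit : ∀ {s u t} → Acts s u t → VK.Unit (coord (Φ s · y u) t)
    ¬acts⇒𝔓   : ∀ {s u t} → ¬ Acts s u t → VK.V (+ 1) (coord (Φ s · y u) t)

-- The order 𝔄, its basis and its structure constants modulo 𝔓_K

module Order {k ℓk l ℓl a ℓa : Level} {K : Field k ℓk} {vK : DiscreteValuation K}
         {L : Extension K l ℓl} {vL : DiscreteValuation (Extension.extensionField L)} {N : ℕ}
         (L/K : TotallyRamified vK L vL N) {A : Algebra K a ℓa} (A-dim : HasDimension (Algebra.vectorSpace A) N)
         (A↷L : Action A L) (h : ℤ) (T : ShiftTable N) (B : AdaptedBases L/K A↷L h T) where
  private
    module K = Field K
    module L = Extension L
    module A = Algebra A
    module VL = Valued vL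
    module ι = IsRingHomomorphism L.ι-homo
    module LC = Combination L.vectorSpace
    module AC = Combination A.vectorSpace
    module LL = Lattice vK L.vectorSpace
    module AL = Lattice vK A.vectorSpace
  open Valued vK
  open Summation K.ring
  open ShiftTable T
  open AdaptedBases B
  open Action A↷L hiding (*ₗ-cong)
  private module Act = Action A↷L
  open AssociatedOrder L/K A↷L h
  open LC.Basis y-basis using () renaming (coord to coordᴸ; coord-lc to coordᴸ-lc; coord-lc∘ to coordᴸ-lc∘; coord-cong to coordᴸ-cong; expand to expandᴸ)

  K-invˡ : ∀ x → ¬ x K.≈ K.0# → ∃[ y ] y K.* x K.≈ K.1#
  K-invˡ x x≉0 = proj₁ (K.inverse x≉0) , K.trans (K.*-comm _ _) (proj₂ (K.inverse x≉0))

  ·-lc : ∀ α {n} (c : Fin n → K.Carrier) x → α · LC.lc c x L.≈ LC.lc c (λ i → α · x i)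
  ·-lc α = LinearMap.lc-map L.vectorSpace L.vectorSpace (α ·_) Act.*ₗ-congˡ (Act.*ₗ-distribˡ α) (λ c x → ·-linearʳ c α x)

  lc-· : ∀ x {n} (c : Fin n → K.Carrier) α → AC.lc c α · x L.≈ LC.lc c (λ i → α i · x)
  lc-· x = LinearMap.lc-map A.vectorSpace L.vectorSpace (_· x) Act.*ₗ-congʳ (Act.*ₗ-distribʳ x) (λ c α → ·-linearˡ c α x)

  *-lc : ∀ α {n} (c : Fin n → K.Carrier) β → α A.* AC.lc c β A.≈ AC.lc c (λ i → α A.* β i)
  *-lc α = LinearMap.lc-map A.vectorSpace A.vectorSpace (α A.*_) A.*-congˡ (A.distribˡ α)
    (λ c β → A.trans (A.sym (A.*-assoc _ _ _)) (A.trans (A.*-congʳ (A.sym (A.central c α))) (A.*-assoc _ _ _)))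

  lc-* : ∀ β {n} (c : Fin n → K.Carrier) α → AC.lc c α A.* β A.≈ AC.lc c (λ i → α i A.* β)
  lc-* β = LinearMap.lc-map A.vectorSpace A.vectorSpace (A._* β) A.*-congʳ (A.distribʳ β) (λ c α → A.*-assoc _ _ _)

  ι-V : ∀ {m c} → V m c → VL.V (+ N ℤ.* m) (L.ι c)
  ι-V {m} {c} p = subst ([ + N ℤ.* m ] ≤⁺_) (sym (TotallyRamified.ramificationIndex L/K c)) (mono p)
    where
    mono : ∀ {x} → [ m ] ≤⁺ x → [ + N ℤ.* m ] ≤⁺ N ·⁺ x
    mono [ p ]   = [ ℤ.*-monoˡ-≤-nonNeg (+ N) p ]
    mono (_ ≤⊤⁺) = _ ≤⊤⁺

  ι-V0 : ∀ {c} → V (+ 0) c → VL.V (+ 0) (L.ι c)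
  ι-V0 {c} p = subst (λ i → VL.V i (L.ι c)) (ℤ.*-zeroʳ (+ N)) (ι-V p)

  𝔓ᴸ-isLattice : ∀ i → LL.IsLattice (VL.V i)
  𝔓ᴸ-isLattice i = record
    { ∈-resp = VL.V-resp ; 0ᴹ∈ = VL.V-0# ; ∈-+ = VL.V-+ ; ∈-* = λ c∈ → VL.V-0* (ι-V0 c∈) }

  lc-y∈ : ∀ {m} {c : Fin N → K.Carrier} → (∀ u → V m (c u)) → VL.V (h ℤ.+ + N ℤ.* m) (LC.lc c y)
  lc-y∈ {m} {c} c∈ = LL.IsLattice.∈-lc (𝔓ᴸ-isLattice _)
    (λ u → subst (λ i → VL.V i (L.ι (c u) L.* y u)) (ℤ.+-comm _ h) (VL.V-* (ι-V (c∈ u)) (y∈ u)))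

  private
    h+N*0 : h ℤ.+ + N ℤ.* + 0 ≡ h
    h+N*0 = trans (cong (λ i → h ℤ.+ i) (ℤ.*-zeroʳ (+ N))) (ℤ.+-identityʳ h)

  coordᴸ∈ : ∀ {m x} → VL.V (h ℤ.+ + N ℤ.* m) x → ∀ u → V m (coordᴸ x u)
  coordᴸ∈ {x = x} x∈ = y-reduced (coordᴸ x) (VL.V-resp (expandᴸ x) x∈)

  coordᴸ∈⁻ : ∀ {m x} → (∀ u → V m (coordᴸ x u)) → VL.V (h ℤ.+ + N ℤ.* m) x
  coordᴸ∈⁻ {x = x} x∈ = VL.V-resp (L.sym (expandᴸ x)) (lc-y∈ x∈)

  coordᴸ-V0 : ∀ {x} → VL.V h x → ∀ u → V (+ 0) (coordᴸ x u)
  coordᴸ-V0 {x} x∈ = coordᴸ∈ (subst (λ i → VL.V i x) (sym h+N*0) x∈)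

  coordᴸ-V0⁻ : ∀ {x} → (∀ u → V (+ 0) (coordᴸ x u)) → VL.V h x
  coordᴸ-V0⁻ {x} x∈ = subst (λ i → VL.V i x) h+N*0 (coordᴸ∈⁻ x∈)

  mat : Fin N → Fin N → Fin N → K.Carrier
  mat s u t = coordᴸ (Φ s · y u) t

  mat-V0 : ∀ s u t → V (+ 0) (mat s u t)
  mat-V0 s u t with acts? s u t
  ... | yes a = Unit⇒V0 (acts⇒unit a)
  ... | no ¬a = V1⇒V0 (¬acts⇒𝔓 ¬a)

  coordᴸ-lc·y : ∀ (c : Fin N → K.Carrier) u t → coordᴸ (AC.lc c Φ · y u) t K.≈ ∑ (λ s → c s K.* mat s u t)
  coordᴸ-lc·y c u t = K.trans (coordᴸ-cong (lc-· (y u) c Φ) t) (coordᴸ-lc∘ c (λ s → Φ s · y u) t)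

  -- By `acts-injective`, Φᵣ is the only basis element that sends y_u to y_t modulo 𝔓_K; every other
  -- summand gains one in value.
  coefficient-isolate : ∀ {j c r u t} → (∀ s → V j (c s)) → Acts r u t →
    V (j ℤ.+ + 1) (coordᴸ (AC.lc c Φ · y u) t K.- c r K.* mat r u t)
  coefficient-isolate {j} {c} {r} {u} {t} c∈ a = V-resp (K.+-congʳ (K.sym (coordᴸ-lc·y c u t)))
    (∑-isolate _ r (λ s s≢r → V-* (c∈ s) (¬acts⇒𝔓 (λ a′ → s≢r (acts-injective a′ a)))))

  private
    bounded : ∀ {n} (c : Fin n → K.Carrier) → ∃[ j ] ∀ i → V j (c i)
    bounded {ℕ.zero}  c = + 0 , λ ()
    bounded {ℕ.suc n} c with bounded (λ i → c (suc i)) | c zero ≈0?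
    ... | j , p | yes c₀≈0 = j , λ { zero → V-resp (K.sym c₀≈0) V-0# ; (suc i) → p i }
    ... | j , p | no c₀≉0 with ≉0⇒v-fin c₀≉0
    ... | i₀ , eq = i₀ ℤ.⊓ j , λ { zero → V-≤ (ℤ.i⊓j≤i i₀ j) (v⇒V eq) ; (suc i) → V-≤ (ℤ.i⊓j≤j i₀ j) (p i) }

  -- From any common lower bound j < m of the values of the c s, one climbs by one at a time:
  -- `acts-total` gives a place (u , t) where Φₛ has a unit coefficient, and there c s is read off
  -- from the t-th coordinate of αy_u modulo terms of value j + 1. That the Φₛ are independent is
  -- not presupposed; it is deduced from this.
  coefficients∈ : ∀ {m} (c : Fin N → K.Carrier) →
    (∀ u → VL.V (h ℤ.+ + N ℤ.* m) (AC.lc c Φ · y u)) → ∀ s → V m (c s)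
  coefficients∈ {m} c p with bounded c
  ... | j , c∈ with ℤ.≤-total m j
  ... | inj₁ m≤j = λ s → V-≤ m≤j (c∈ s)
  ... | inj₂ j≤m = subst (λ i → ∀ s → V i (c s)) j+k≡m (climb ℤ.∣ m ℤ.- j ∣ (ℤ.≤-reflexive j+k≡m))
    where
    j+k≡m : j ℤ.+ + ℤ.∣ m ℤ.- j ∣ ≡ m
    j+k≡m = trans (cong (λ i → j ℤ.+ i) (ℤ.0≤i⇒+∣i∣≡i (ℤ.i≤j⇒0≤j-i j≤m)))
      (trans (ℤ.+-comm j _) (trans (ℤ.+-assoc m (ℤ.- j) j) (trans (cong (λ i → m ℤ.+ i) (ℤ.+-inverseˡ j)) (ℤ.+-identityʳ m))))
    step : ∀ {i} → i ℤ.+ + 1 ℤ.≤ m → (∀ s → V i (c s)) → ∀ s → V (i ℤ.+ + 1) (c s)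
    step {i} i<m c∈ s with acts-total s
    ... | u , t , a = V-cancelUnitˡ (acts⇒unit a) (V-resp (K.*-comm _ _)
      (V-≡ (V-swap (coefficient-isolate c∈ a)) (V-≤ i<m (coordᴸ∈ (p u) t))))
    climb : ∀ k → j ℤ.+ + k ℤ.≤ m → ∀ s → V (j ℤ.+ + k) (c s)
    climb ℕ.zero    _   = subst (λ i → ∀ s → V i (c s)) (sym (ℤ.+-identityʳ j)) c∈
    climb (ℕ.suc k) k<m = subst (λ i → ∀ s → V i (c s)) (sym +suc)
      (step (subst (ℤ._≤ m) +suc k<m) (climb k (ℤ.≤-trans (ℤ.+-monoʳ-≤ j (ℤ.+≤+ (ℕ.n≤1+n k))) k<m)))
      where
      +suc : j ℤ.+ + ℕ.suc k ≡ j ℤ.+ + k ℤ.+ + 1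
      +suc = trans (cong (λ i → j ℤ.+ + i) (ℕ.+-comm 1 k)) (sym (ℤ.+-assoc j (+ k) (+ 1)))

  opaque
    -- A linear relation between the Φₛ annihilates all y_u, so its coefficients lie in every power
    -- of 𝔓_K and vanish. The dimension of A then gives generation.
    Φ-basis : AC.Basis Φ
    Φ-basis = record { generates = independent⇒generates A.vectorSpace (proj₁ (proj₂ A-dim)) independent ; independent = independent }
      where
      open DivisionRing K.ring _≈0? K.1≉0 K-invˡ
      independent : LinearlyIndependent A.vectorSpace Φ
      independent c eq s = ⋂V⇒≈0 λ m → coefficients∈ {m} c (λ u → VL.V-resp (L.sym (annihilates u)) VL.V-0#) s
        where
        annihilates : ∀ u → AC.lc c Φ · y u L.≈ L.0#
        annihilates u = L.trans (Act.*ₗ-congʳ (A.trans (AC.lc≈linearCombination c Φ) eq)) (Act.*ₗ-zeroˡ (y u))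

  open AC.Basis Φ-basis public hiding (generates; independent; lc-injective)

  coord∈ : ∀ {m α} → (∀ u → VL.V (h ℤ.+ + N ℤ.* m) (α · y u)) → ∀ s → V m (coord α s)
  coord∈ {α = α} p = coefficients∈ (coord α) (λ u → VL.V-resp (Act.*ₗ-congʳ (expand α)) (p u))

  coord-V0 : ∀ {α} → Stabilizes α → ∀ s → V (+ 0) (coord α s)
  coord-V0 {α} α∈ = coord∈ (λ u → subst (λ i → VL.V i (α · y u)) (sym h+N*0) (α∈ (y u) (y∈ u)))

  Stabilizes-isLattice : AL.IsLattice Stabilizes
  Stabilizes-isLattice = record
    { ∈-resp = S.resp ; 0ᴹ∈ = S.0∈ ; ∈-+ = S.+∈ ; ∈-* = λ {c} c∈ α∈ → S.*∈ (proj₂ (𝔒→𝔄 (c , c∈))) α∈ }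
    where module S = IsSubring Stabilizes-isSubring

  Φ∈ : ∀ s → Stabilizes (Φ s)
  Φ∈ s x x∈ = VL.V-resp (L.sym (L.trans (Act.*ₗ-congˡ (expandᴸ x)) (·-lc (Φ s) (coordᴸ x) y)))
    (LL.IsLattice.∈-lc (𝔓ᴸ-isLattice h) (λ u → LL.IsLattice.∈-* (𝔓ᴸ-isLattice h) (coordᴸ-V0 x∈ u)
      (coordᴸ-V0⁻ (mat-V0 s u))))

  -- The structure constants of A in the basis Φ.
  con : Fin N → Fin N → Fin N → K.Carrier
  con s s′ = coord (Φ s A.* Φ s′)

  con-V0 : ∀ s s′ r → V (+ 0) (con s s′ r)
  con-V0 s s′ = coord-V0 (IsSubring.*∈ Stabilizes-isSubring (Φ∈ s) (Φ∈ s′))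

  private
    -- The t-th coordinate of ΦₛΦₛ′y_u is computed in two ways: by composing the two matrices, and
    -- by expanding the product in Φ, where only the term at r survives.
    con-mat : ∀ {s s′ r u t} → Acts r u t →
      V (+ 1) (∑ (λ m → mat s′ u m K.* mat s m t) K.- con s s′ r K.* mat r u t)
    con-mat {s} {s′} {r} {u} {t} a = V-resp (K.+-congʳ eq) (coefficient-isolate (con-V0 s s′) a)
      where
      eq : coordᴸ (AC.lc (con s s′) Φ · y u) t K.≈ ∑ (λ m → mat s′ u m K.* mat s m t)
      eq = K.trans (coordᴸ-cong (L.trans (Act.*ₗ-congʳ (A.sym (expand _))) (L.trans (Act.*ₗ-assoc (Φ s) (Φ s′) (y u))
          (L.trans (Act.*ₗ-congˡ (expandᴸ (Φ s′ · y u))) (·-lc (Φ s) _ y)))) t)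
        (coordᴸ-lc∘ (mat s′ u) (λ m → Φ s · y m) t)

  mat-mat-V1 : ∀ {s s′ u m t} → ¬ (Acts s′ u m × Acts s m t) → V (+ 1) (mat s′ u m K.* mat s m t)
  mat-mat-V1 {s} {s′} {u} {m} {t} ¬a with acts? s′ u m | acts? s m t
  ... | no ¬a₁ | _      = V-*0 (¬acts⇒𝔓 ¬a₁) (mat-V0 s m t)
  ... | yes _  | no ¬a₂ = V-0* (mat-V0 s′ u m) (¬acts⇒𝔓 ¬a₂)
  ... | yes a₁ | yes a₂ = contradiction (a₁ , a₂) ¬a

  -- In the matrix product of `con-mat` exactly the intermediate index m from `mult⇒acts-∘`
  -- contributes a unit; the structure constant divides this unit.
  mult⇒unit : ∀ {s s′ r} → Mult s s′ r → Unit (con s s′ r)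
  mult⇒unit {s} {s′} {r} μ with acts-total r
  ... | u , t , a with mult⇒acts-∘ μ a
  ... | m , a₁ , a₂ = Unit-*⁻ (con-V0 s s′ r) (mat-V0 r u t) (Unit-≡ (V-swap (con-mat a))
    (Unit-≡ (∑-isolate _ m (λ m′ m′≢m → mat-mat-V1 (λ (a₁′ , _) → m′≢m (acts-functional a₁′ a₁))))
      (v-*-fin (acts⇒unit a₁) (acts⇒unit a₂))))

  -- An intermediate index would give `Mult s s′ r` by `acts-∘⇒mult`, so every term of the matrix
  -- product lies in 𝔓_K, and the unit `mat r u t` can be cancelled.
  ¬mult⇒𝔓 : ∀ {s s′ r} → ¬ Mult s s′ r → V (+ 1) (con s s′ r)
  ¬mult⇒𝔓 {s} {s′} {r} ¬μ with acts-total r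
  ... | u , t , a = V-cancelUnitˡ (acts⇒unit a) (V-resp (K.*-comm _ _) (V-≡ (V-swap (con-mat a))
    (V-∑ (λ m → mat-mat-V1 (λ (a₁ , a₂) → ¬μ (acts-∘⇒mult a₁ a₂ a))))))

  ε : A.Carrier → K.Carrier
  ε α = coord α 0ˢ

  ·1≈ιε : ∀ α → α · L.1# L.≈ L.ι (ε α)
  ·1≈ιε α = begin
    α · L.1#                              ≈⟨ Act.*ₗ-congʳ (expand α) ⟩
    AC.lc (coord α) Φ · L.1#              ≈⟨ lc-· L.1# (coord α) Φ ⟩
    LC.lc (coord α) (λ s → Φ s · L.1#)    ≈⟨ LC.lc-single _ _ 0ˢ (λ s s≢0 → L.trans (L.*-congˡ (Φ·1≈0 s≢0)) (L.zeroʳ _)) ⟩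
    L.ι (ε α) L.* (Φ 0ˢ · L.1#)           ≈⟨ L.*-congˡ (L.trans (Act.*ₗ-congʳ Φ0≈1) (Act.*ₗ-identityˡ L.1#)) ⟩
    L.ι (ε α) L.* L.1#                    ≈⟨ L.*-identityʳ _ ⟩
    L.ι (ε α)                             ∎
    where open ≈-Reasoning L.setoid

  private
    ι-injective : ∀ {x y} → L.ι x L.≈ L.ι y → x K.≈ y
    ι-injective {x} {y} eq = ⋂V⇒≈ λ i → ι-reflects i
      where
      ⋂V⇒≈ : (∀ i → V i (x K.- y)) → x K.≈ y
      ⋂V⇒≈ p = K.trans (K.sym (K.+-identityʳ x)) (K.trans (K.+-congˡ (K.sym (K.-‿inverseˡ y)))
        (K.trans (K.sym (K.+-assoc _ _ _)) (K.trans (K.+-congʳ (⋂V⇒≈0 p)) (K.+-identityˡ y))))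
      ι-reflects : ∀ i → V i (x K.- y)
      ι-reflects i with (x K.- y) ≈0?
      ... | yes x-y≈0 = V-resp (K.sym x-y≈0) V-0#
      ... | no  x-y≉0 with K.inverse x-y≉0
      ... | z , eq′ = contradiction (begin
        L.1#                              ≈⟨ ι.1#-homo ⟨
        L.ι K.1#                          ≈⟨ ι.⟦⟧-cong eq′ ⟨
        L.ι ((x K.- y) K.* z)             ≈⟨ ι.*-homo _ _ ⟩
        L.ι (x K.- y) L.* L.ι z           ≈⟨ L.*-congʳ (L.trans (ι.+-homo _ _) (L.trans (L.+-cong eq (ι.-‿homo y)) (L.-‿inverseʳ _))) ⟩
        L.0# L.* L.ι z                    ≈⟨ L.zeroˡ _ ⟩
        L.0#                              ∎) L.1≉0
        where open ≈-Reasoning L.setoid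

  ε-* : ∀ α β → ε (α A.* β) K.≈ ε α K.* ε β
  ε-* α β = ι-injective (begin
    L.ι (ε (α A.* β))           ≈⟨ ·1≈ιε (α A.* β) ⟨
    (α A.* β) · L.1#            ≈⟨ Act.*ₗ-assoc α β L.1# ⟩
    α · (β · L.1#)              ≈⟨ Act.*ₗ-congˡ (L.trans (·1≈ιε β) (L.sym (L.*-identityʳ _))) ⟩
    α · (L.ι (ε β) L.* L.1#)    ≈⟨ ·-linearʳ (ε β) α L.1# ⟩
    L.ι (ε β) L.* (α · L.1#)    ≈⟨ L.trans (L.*-comm _ _) (L.*-congʳ (·1≈ιε α)) ⟩
    L.ι (ε α) L.* L.ι (ε β)     ≈⟨ ι.*-homo _ _ ⟨
    L.ι (ε α K.* ε β)           ∎)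
    where open ≈-Reasoning L.setoid

  ε-1 : ε A.1# K.≈ K.1#
  ε-1 = K.trans (K.sym (coord-cong Φ0≈1 0ˢ)) (coord-self 0ˢ)

  η-· : ∀ c x → A.η c · x L.≈ L.ι c L.* x
  η-· c x = L.trans (Act.*ₗ-congʳ (A.sym (A.*-identityʳ (A.η c))))
    (L.trans (·-linearˡ c A.1# x) (L.*-congˡ (Act.*ₗ-identityˡ x)))

  ·-πM : ∀ {α x} → Stabilizes α → VL.V (h ℤ.+ + N ℤ.* + 1) x → VL.V (h ℤ.+ + N ℤ.* + 1) (α · x)
  ·-πM {α} {x} α∈ x∈ = VL.V-resp (L.sym (L.trans (Act.*ₗ-congˡ (expandᴸ x)) (·-lc α (coordᴸ x) y)))
    (LL.IsLattice.∈-lc (𝔓ᴸ-isLattice _) (λ u → subst (λ i → VL.V i (L.ι (coordᴸ x u) L.* (α · y u))) (ℤ.+-comm _ h)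
      (VL.V-* (ι-V (coordᴸ∈ x∈ u)) (α∈ (y u) (y∈ u)))))

-- Enumeration of a decidable subset of `Fin N`

module Selection {N : ℕ} {P : Pred (Fin N) 0ℓ} (P? : Decidable P) where

  count : ℕ
  count = length (filter P? (allFin N))

  sel : Fin count → Fin N
  sel = lookup (filter P? (allFin N))

  sel∈ : ∀ i → P (sel i)
  sel∈ i = proj₂ (∈-filter⁻ P? {xs = allFin N} (∈-lookup {xs = filter P? (allFin N)} i))

  sel-surjective : ∀ {u} → P u → ∃[ i ] u ≡ sel i
  sel-surjective {u} u∈ = Any.index u∈xs , Any.lookup-index u∈xs
    where u∈xs = ∈-filter⁺ P? (∈-allFin u) u∈

  sel-injective : ∀ {i j} → sel i ≡ sel j → i ≡ j
  sel-injective = go (Unique.filter⁺ P? (Unique.allFin⁺ N)) _ _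
    where
    go : ∀ {xs : List (Fin N)} → Unique xs → ∀ i j → lookup xs i ≡ lookup xs j → i ≡ j
    go {_ ∷ _} _                    zero    zero    _  = refl
    go {_ ∷ _} (x≢ AllPairs.∷ _)    zero    (suc j) eq = contradiction eq (All.lookup x≢ (∈-lookup j))
    go {_ ∷ _} (x≢ AllPairs.∷ _)    (suc i) zero    eq = contradiction (sym eq) (All.lookup x≢ (∈-lookup i))
    go {_ ∷ _} (_ AllPairs.∷ uniq)  (suc i) (suc j) eq = cong suc (go uniq i j eq)

-- The minimal number of generators of 𝔓_L^h

module Generators {k ℓk l ℓl a ℓa : Level} {K : Field k ℓk} {vK : DiscreteValuation K}
         {L : Extension K l ℓl} {vL : DiscreteValuation (Extension.extensionField L)} {N : ℕ}
         (L/K : TotallyRamified vK L vL N) {A : Algebra K a ℓa} (A-dim : HasDimension (Algebra.vectorSpace A) N)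
         (A↷L : Action A L) (h : ℤ) (T : ShiftTable N) (B : AdaptedBases L/K A↷L h T) where
  private
    module K = Field K
    module L = Extension L
    module A = Algebra A
    module VL = Valued vL
    module vK = DiscreteValuation vK
    module LC = Combination L.vectorSpace
    module LL = Lattice vK L.vectorSpace
  open Valued vK
  open Summation K.ring
  open ShiftTable T
  open AdaptedBases B
  open Action A↷L hiding (*ₗ-cong)
  private module Act = Action A↷L
  open AssociatedOrder L/K A↷L h
  open Order L/K A-dim A↷L h T B
  open LC.Basis y-basis using () renaming (coord to coordᴸ; coord-lc to coordᴸ-lc; coord-lc∘ to coordᴸ-lc∘;
    coord-cong to coordᴸ-cong; expand to expandᴸ; coord-+ to coordᴸ-+; coord-self to coordᴸ-self; coord-other to coordᴸ-other)
  open Selection 𝒟?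
  private
    module M = LeftModule 𝔓ᴸʰ
    module MC = Combination 𝔓ᴸʰ

  generator : Fin count → M.Carrierᴹ
  generator i = y (sel i) , y∈ (sel i)

  -- The 𝔄-submodule generated by the y_u with u ∈ 𝒟, stated for elements of L so that it is a
  -- lattice to which `nakayama` applies.
  Generated : Pred L.Carrier _
  Generated x = Σ[ x∈ ∈ VL.V h x ] ∃[ cs ] (x , x∈) M.≈ᴹ MC.lc cs generator

  πM : Pred L.Carrier 0ℓ
  πM = VL.V (h ℤ.+ + N ℤ.* + 1)

  πM-isLattice : LL.IsLattice πM
  πM-isLattice = 𝔓ᴸ-isLattice _

  Generated-· : ∀ {α x} → Stabilizes α → Generated x → Generated (α · x)
  Generated-· {α} α∈ (x∈ , cs , eq) = α∈ _ x∈ , (λ i → Ring._*_ 𝔄 (α , α∈) (cs i)) ,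
    L.trans (Act.*ₗ-congˡ eq) (MC.lc-*ₗ (α , α∈) cs generator)

  Generated-resp : ∀ {x x′} → x L.≈ x′ → Generated x → Generated x′
  Generated-resp eq (x∈ , cs , eq′) = VL.V-resp eq x∈ , cs , L.trans (L.sym eq) eq′

  Generated-isLattice : LL.IsLattice Generated
  Generated-isLattice = record
    { ∈-resp = Generated-resp
    ; 0ᴹ∈ = VL.V-0# , (λ _ → Ring.0# 𝔄) , L.sym (MC.lc-zeroˡ {cs = λ _ → Ring.0# 𝔄} {xs = generator} (λ _ → A.refl))
    ; ∈-+ = λ { (x∈ , cs , eq) (x′∈ , cs′ , eq′) →
        VL.V-+ x∈ x′∈ , (λ i → Ring._+_ 𝔄 (cs i) (cs′ i)) , L.trans (L.+-cong eq eq′) (MC.lc-+ cs cs′ generator) }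
    ; ∈-* = λ {c} {x} c∈ gx → Generated-resp (η-· c x) (Generated-· (proj₂ (𝔒→𝔄 (c , c∈))) gx)
    }

  private
    G+πM = LL.Join Generated πM
    module G+πM = LL.IsLattice (LL.Join-isLattice Generated-isLattice πM-isLattice)

    G+πM-· : ∀ {α x} → Stabilizes α → G+πM x → G+πM (α · x)
    G+πM-· {α} α∈ (z , z′ , z∈ , z′∈ , eq) = α · z , α · z′ , Generated-· α∈ z∈ , ·-πM α∈ z′∈ ,
      L.trans (Act.*ₗ-congˡ eq) (Act.*ₗ-distribˡ α z z′)

    -- Induction on u: for u outside 𝒟 there are s ≠ 0 and v < u such that Φₛy_v is a unit multiple
    -- of y_u modulo πM, and y_v is already known.
    y∈Join : ∀ u → G+πM (y u)
    y∈Join = WF.All.wfRec <-wellFounded _ (λ u → G+πM (y u)) step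
      where
      step : ∀ u → (∀ {v} → toℕ v ℕ.< toℕ u → G+πM (y v)) → G+πM (y u)
      step u IH with 𝒟? u
      ... | yes u∈ with sel-surjective u∈
      ... | i , refl = LL.⊆Joinˡ Generated-isLattice πM-isLattice
        (y∈ (sel i) , MC.single i (Ring.1# 𝔄) ,
         L.sym (L.trans (MC.lc-single* i (Ring.1# 𝔄) generator) (Act.*ₗ-identityˡ _)))
      step u IH | no u∉ with ¬𝒟⇒ u∉
      ... | s , v , s≢0 , a , v<u = G+πM.∈-unit⁻ (acts⇒unit a)
        (G+πM.∈-isolate u (G+πM.∈-resp (expandᴸ (Φ s · y v)) (G+πM-· (Φ∈ s) (IH v<u)))
          (λ t t≢u → LL.⊆Joinʳ Generated-isLattice πM-isLattice
            (subst (λ i → VL.V i (L.ι (mat s v t) L.* y t)) (ℤ.+-comm _ h)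
              (VL.V-* (ι-V (¬acts⇒𝔓 (λ a′ → t≢u (acts-functional a′ a)))) (y∈ t)))))

  y-generated : ∀ u → Generated (y u)
  y-generated = LL.nakayama Generated-isLattice y λ u → let (z , z′ , z∈ , z′∈ , eq) = y∈Join u in
    z , coordᴸ z′ , z∈ , coordᴸ∈ z′∈ , L.trans eq (L.+-congˡ (expandᴸ z′))

  generator-generates : Generates 𝔓ᴸʰ generator
  generator-generates (x , x∈) = let (_ , cs , eq) = x-generated in
    cs , L.trans eq (MC.lc≈linearCombination cs generator)
    where
    x-generated : Generated x
    x-generated = LL.IsLattice.∈-resp Generated-isLattice (L.sym (expandᴸ x))
      (LL.IsLattice.∈-lc Generated-isLattice (λ u → LL.IsLattice.∈-* Generated-isLattice (coordᴸ-V0 x∈ u) (y-generated u)))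

  -- By `𝒟⇒` only Φ₀ = 1 contributes to the coordinate at v modulo 𝔓_K. Thus this coordinate induces
  -- an 𝔄-linear map from 𝔓_L^h to κ, where 𝔄 acts on κ through ε.
  𝒟-residue : ∀ {α x v} → Stabilizes α → VL.V h x → 𝒟 v → V (+ 1) (coordᴸ (α · x) v K.- ε α K.* coordᴸ x v)
  𝒟-residue {α} {x} {v} α∈ x∈ v∈ = V-resp (K.+-cong (K.sym total) (K.-‿cong (K.*-congˡ (coordᴸ-cong Φ0·x v))))
    (∑-isolate _ 0ˢ (λ s s≢0 → V-0* (coord-V0 α∈ s) (V-resp (K.sym (Φ·x s)) (V-∑ (λ u →
      V-0* (coordᴸ-V0 x∈ u) (¬acts⇒𝔓 (λ a → s≢0 (𝒟⇒ v∈ a))))))))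
    where
    total : coordᴸ (α · x) v K.≈ ∑ (λ s → coord α s K.* coordᴸ (Φ s · x) v)
    total = K.trans (coordᴸ-cong (L.trans (Act.*ₗ-congʳ (expand α)) (lc-· x (coord α) Φ)) v)
      (coordᴸ-lc∘ (coord α) (λ s → Φ s · x) v)
    Φ·x : ∀ s → coordᴸ (Φ s · x) v K.≈ ∑ (λ u → coordᴸ x u K.* mat s u v)
    Φ·x s = K.trans (coordᴸ-cong (L.trans (Act.*ₗ-congˡ (expandᴸ x)) (·-lc (Φ s) (coordᴸ x) y)) v)
      (coordᴸ-lc∘ (coordᴸ x) (λ u → Φ s · y u) v)
    Φ0·x : Φ 0ˢ · x L.≈ x
    Φ0·x = L.trans (Act.*ₗ-congʳ Φ0≈1) (Act.*ₗ-identityˡ x)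

  private
    κ = vK.residueRing
    module κ = Ring κ
    module Σκ = Summation κ

    V1⇒≈0κ : ∀ {x} → V (+ 1) (proj₁ x) → x κ.≈ κ.0#
    V1⇒≈0κ p = V-- p V-0#

    ≈0κ⇒V1 : ∀ {x} → x κ.≈ κ.0# → V (+ 1) (proj₁ x)
    ≈0κ⇒V1 p = V-≡ p V-0#

    _≈0κ? : ∀ x → Dec (x κ.≈ κ.0#)
    x ≈0κ? = V? (+ 1) (proj₁ x K.- K.0#)

    1≉0κ : ¬ κ.1# κ.≈ κ.0#
    1≉0κ 1≈0 = Unit⇒¬V1 v-1# (≈0κ⇒V1 {κ.1#} 1≈0)

    inverseκ : ∀ x → ¬ x κ.≈ κ.0# → ∃[ y ] (y κ.* x) κ.≈ κ.1#
    inverseκ x x≉0 = (x⁻¹ , Unit⇒V0 u) , ≈⇒V (K.trans (K.*-comm _ _) xx⁻¹≈1)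
      where
      x-inverse = v-inverse (V0∧¬V1⇒Unit (proj₂ x) (λ p → x≉0 (V1⇒≈0κ {x} p)))
      x⁻¹ = proj₁ x-inverse
      xx⁻¹≈1 = proj₁ (proj₂ x-inverse)
      u = proj₂ (proj₂ x-inverse)

    module D = DivisionRing κ _≈0κ? 1≉0κ inverseκ

    coordκ : M.Carrierᴹ → Fin N → κ.Carrier
    coordκ (x , x∈) v = coordᴸ x v , coordᴸ-V0 x∈ v

    εκ : Ring.Carrier 𝔄 → κ.Carrier
    εκ (α , α∈) = ε α , coord-V0 α∈ 0ˢ

    coordκ-lc : ∀ {v} → 𝒟 v → ∀ {n} (cs : Fin n → Ring.Carrier 𝔄) xs →
      V (+ 1) (coordᴸ (proj₁ (MC.lc cs xs)) v K.- proj₁ (Σκ.∑ (λ i → εκ (cs i) κ.* coordκ (xs i) v)))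
    coordκ-lc {v} v∈ {ℕ.zero} cs xs = V-trans
      (≈⇒V (K.trans (coordᴸ-cong (MC.lc-[] cs xs) v) (LC.Basis.coord-0 y-basis v))) (V-swap (Σκ.∑-[] _))
    coordκ-lc {v} v∈ {ℕ.suc n} cs xs = V-trans (≈⇒V (K.trans (coordᴸ-cong (MC.lc-∷ cs xs) v) (coordᴸ-+ _ _ v)))
      (V-trans (V-+-cong (𝒟-residue (proj₂ (cs zero)) (proj₂ (xs zero)) v∈)
                         (coordκ-lc v∈ (λ i → cs (suc i)) (λ i → xs (suc i))))
        (V-swap (Σκ.∑-∷ _)))

  -- Expanding the y_u with u ∈ 𝒟 in the generators xs and taking residues of the coordinates in 𝒟
  -- factors the identity matrix of size |𝒟| over κ through κⁿ.
  minimal : ∀ n (xs : Fin n → M.Carrierᴹ) → Generates 𝔓ᴸʰ xs → count ℕ.≤ n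
  minimal n xs gen = D.identity-factors⇒≤ (λ u j → εκ (coefficient u j)) (λ j u → coordκ (xs j) (sel u))
    (λ u → V-trans (V-swap (expansion u u)) (≈⇒V (coordᴸ-self (sel u))))
    (λ u v u≢v → V-trans (V-swap (expansion u v)) (≈⇒V (coordᴸ-other (λ eq → u≢v (sel-injective (sym eq))))))
    where
    coefficient = λ u → proj₁ (gen (generator u))
    expansion : ∀ u v → V (+ 1) (coordᴸ (y (sel u)) (sel v) K.- proj₁ (Σκ.∑ (λ j → εκ (coefficient u j) κ.* coordκ (xs j) (sel v))))
    expansion u v = V-trans
      (≈⇒V (coordᴸ-cong (L.trans (proj₂ (gen (generator u))) (L.sym (MC.lc≈linearCombination _ xs))) (sel v)))
      (coordκ-lc (sel∈ v) (coefficient u) xs)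

  minimalNumberOfGenerators : MinimalNumberOfGenerators 𝔓ᴸʰ count
  minimalNumberOfGenerators = (generator , generator-generates) , minimal

-- 𝔄 is local with residue field κ

module LocalRing {k ℓk l ℓl a ℓa : Level} (ℓᴵ : Level) {K : Field k ℓk} {vK : DiscreteValuation K}
         {L : Extension K l ℓl} {vL : DiscreteValuation (Extension.extensionField L)} {N : ℕ}
         (L/K : TotallyRamified vK L vL N) {A : Algebra K a ℓa} (A-dim : HasDimension (Algebra.vectorSpace A) N)
         (A↷L : Action A L) (h : ℤ) (T : ShiftTable N) (B : AdaptedBases L/K A↷L h T) where
  private
    module K = Field K
    module A = Algebra A
    module AL = Lattice vK A.vectorSpace
    module η = IsRingHomomorphism A.η-homo
  open Valued vK
  open Summation K.ring
  open ShiftTable T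
  open AdaptedBases B
  open AssociatedOrder L/K A↷L h
  open Order L/K A-dim A↷L h T B
  private
    module S = IsSubring Stabilizes-isSubring
    module 𝔄 = Ring 𝔄

  -- Lifted to the level `ℓᴵ` of the ideals with which it is compared.
  𝔐 : Pred 𝔄.Carrier ℓᴵ
  𝔐 (α , _) = Lift ℓᴵ (V (+ 1) (ε α))

  ε-V0 : ∀ (α : 𝔄.Carrier) → V (+ 0) (ε (proj₁ α))
  ε-V0 (α , α∈) = coord-V0 α∈ 0ˢ

  𝔐-isIdeal : IsIdeal 𝔄 𝔐
  𝔐-isIdeal = record
    { isAdditiveSubgroup = record
      { resp = λ eq (lift p) → lift (V-resp (coord-cong eq 0ˢ) p)
      ; 0∈   = lift (V-resp (K.sym (coord-0 0ˢ)) V-0#)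
      ; +∈   = λ (lift p) (lift q) → lift (V-resp (K.sym (coord-+ _ _ 0ˢ)) (V-+ p q))
      ; -∈   = λ (lift p) → lift (V-resp (K.sym (coord-neg _ 0ˢ)) (V-neg p))
      }
    ; *∈ = λ r {x} (lift p) → lift (V-resp (K.sym (ε-* (proj₁ r) (proj₁ x))) (V-0* (ε-V0 r) p))
    ; ∈* = λ {x} r (lift p) → lift (V-resp (K.sym (ε-* (proj₁ x) (proj₁ r))) (V-*0 p (ε-V0 r)))
    }

  private
    module Inverse {α : A.Carrier} (α∈ : Stabilizes α) (εα∉ : ¬ V (+ 1) (ε α)) where

      𝔄α π𝔄 : Pred A.Carrier _
      𝔄α β = ∃[ γ ] Stabilizes γ × β A.≈ γ A.* α
      π𝔄 β = ∀ s → V (+ 1) (coord β s)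

      𝔄α-isLattice : AL.IsLattice 𝔄α
      𝔄α-isLattice = record
        { ∈-resp = λ eq (γ , γ∈ , eq′) → γ , γ∈ , A.trans (A.sym eq) eq′
        ; 0ᴹ∈ = A.0# , S.0∈ , A.sym (A.zeroˡ α)
        ; ∈-+ = λ (γ , γ∈ , eq) (γ′ , γ′∈ , eq′) →
            γ A.+ γ′ , S.+∈ γ∈ γ′∈ , A.trans (A.+-cong eq eq′) (A.sym (A.distribʳ α γ γ′))
        ; ∈-* = λ {c} c∈ (γ , γ∈ , eq) → A.η c A.* γ , S.*∈ (proj₂ (𝔒→𝔄 (c , c∈))) γ∈ ,
            A.trans (A.*-congˡ eq) (A.sym (A.*-assoc _ _ _))
        }

      π𝔄-isLattice : AL.IsLattice π𝔄
      π𝔄-isLattice = record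
        { ∈-resp = λ eq p s → V-resp (coord-cong eq s) (p s)
        ; 0ᴹ∈ = λ s → V-resp (K.sym (coord-0 s)) V-0#
        ; ∈-+ = λ p q s → V-resp (K.sym (coord-+ _ _ s)) (V-+ (p s) (q s))
        ; ∈-* = λ {c} {x} c∈ p s → V-resp (K.sym (coord-*ₗ c x s)) (V-0* c∈ (p s))
        }

      private
        J = AL.Join 𝔄α π𝔄
        module J = AL.IsLattice (AL.Join-isLattice 𝔄α-isLattice π𝔄-isLattice)

        -- The matrix of right multiplication by α in the basis Φ. Modulo 𝔓_K it is upper
        -- triangular, since multiplication by Φₛ with s ≠ 0 strictly raises the index; its diagonal
        -- comes from ε(α)Φ₀ alone.
        e : Fin N → Fin N → K.Carrier
        e t = coord (Φ t A.* α)

        e≈ : ∀ t r → e t r K.≈ ∑ (λ s → coord α s K.* con t s r)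
        e≈ t r = K.trans (coord-cong (A.trans (A.*-congˡ (expand α)) (*-lc (Φ t) (coord α) Φ)) r)
          (coord-lc∘ (coord α) (λ s → Φ t A.* Φ s) r)

        e-V0 : ∀ t r → V (+ 0) (e t r)
        e-V0 t = coord-V0 (S.*∈ (Φ∈ t) α∈)

        e-diagonal : ∀ t → Unit (e t t)
        e-diagonal t = Unit-≡ (V-resp (K.+-congʳ (K.sym (e≈ t t))) (∑-isolate _ 0ˢ (λ s s≢0 →
            V-0* (coord-V0 α∈ s) (¬mult⇒𝔓 (λ μ → ℕ.<-irrefl refl (mult-increasing μ s≢0))))))
          (v-*-fin (V0∧¬V1⇒Unit (coord-V0 α∈ 0ˢ) εα∉) (mult⇒unit (mult-identityʳ t)))

        e-lower : ∀ {t r} → r ≢ t → ¬ toℕ t ℕ.< toℕ r → V (+ 1) (e t r)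
        e-lower {t} {r} r≢t t≮r = V-resp (K.sym (e≈ t r)) (V-∑ (λ s → V-0* (coord-V0 α∈ s) (¬mult⇒𝔓 (¬μ s))))
          where
          ¬μ : ∀ s → ¬ Mult t s r
          ¬μ s μ with s Fin.≟ 0ˢ
          ... | yes refl = r≢t (mult-functional μ (mult-identityʳ t))
          ... | no s≢0   = t≮r (mult-increasing μ s≢0)

        -- Descending induction: modulo π𝔄, the element Φₜα of 𝔄α is a unit multiple of Φₜ plus a
        -- combination of Φᵣ with r > t.
        Φ∈J : ∀ t → J (Φ t)
        Φ∈J = WF.All.wfRec >-wellFounded _ (λ t → J (Φ t)) step
          where
          step : ∀ t → (∀ {r} → toℕ t ℕ.< toℕ r → J (Φ r)) → J (Φ t)
          step t IH = J.∈-unit⁻ (e-diagonal t)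
            (J.∈-isolate {cs = e t} {xs = Φ} t (J.∈-resp (expand (Φ t A.* α)) (AL.⊆Joinˡ 𝔄α-isLattice π𝔄-isLattice (Φ t , Φ∈ t , A.refl))) other)
            where
            other : ∀ r → r ≢ t → J (A.η (e t r) A.* Φ r)
            other r r≢t with toℕ t ℕ.<? toℕ r
            ... | yes t<r = J.∈-* (e-V0 t r) (IH t<r)
            ... | no  t≮r = AL.⊆Joinʳ 𝔄α-isLattice π𝔄-isLattice (λ s →
              V-resp (K.sym (coord-*ₗ (e t r) (Φ r) s)) (V-*0 (e-lower r≢t t≮r) (coord-V0 (Φ∈ r) s)))

      Φ∈𝔄α : ∀ t → 𝔄α (Φ t)
      Φ∈𝔄α = AL.nakayama 𝔄α-isLattice Φ λ t → let (z , z′ , z∈ , z′∈ , eq) = Φ∈J t in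
        z , coord z′ , z∈ , z′∈ , A.trans eq (A.+-congˡ (expand z′))

      leftInverse : ∃[ γ ] Stabilizes γ × γ A.* α A.≈ A.1#
      leftInverse = let (γ , γ∈ , eq) = Φ∈𝔄α 0ˢ in γ , γ∈ , A.trans (A.sym eq) Φ0≈1

      leftInverse∉ : ∀ {γ} → γ A.* α A.≈ A.1# → ¬ V (+ 1) (ε γ)
      leftInverse∉ {γ} eq p = Unit⇒¬V1 v-1# (V-resp (K.trans (K.sym (ε-* γ α)) (K.trans (coord-cong eq 0ˢ) ε-1))
        (V-*0 p (coord-V0 α∈ 0ˢ)))

  -- The left inverse γ of α lies outside 𝔐 too, by multiplicativity of ε, so it has a left inverse
  -- δ; then δ = δγα = α, and γ is a two-sided inverse.
  ∉𝔐⇒unit : ∀ α → ¬ 𝔐 α → IsUnit 𝔄 α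
  ∉𝔐⇒unit (α , α∈) α∉ = invertible (Iα.leftInverse)
    where
    module Iα = Inverse α∈ (λ p → α∉ (lift p))
    invertible : (∃[ γ ] Stabilizes γ × γ A.* α A.≈ A.1#) → IsUnit 𝔄 (α , α∈)
    invertible (γ , γ∈ , γα≈1) = (γ , γ∈) , αγ≈1 (Inverse.leftInverse γ∈ (Iα.leftInverse∉ γα≈1)) , γα≈1
      where
      αγ≈1 : (∃[ δ ] Stabilizes δ × δ A.* γ A.≈ A.1#) → α A.* γ A.≈ A.1#
      αγ≈1 (δ , _ , δγ≈1) = A.trans (A.*-congʳ (A.sym δ≈α)) δγ≈1
        where
        δ≈α : δ A.≈ α
        δ≈α = A.trans (A.sym (A.*-identityʳ δ)) (A.trans (A.*-congˡ (A.sym γα≈1))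
          (A.trans (A.sym (A.*-assoc δ γ α)) (A.trans (A.*-congʳ δγ≈1) (A.*-identityˡ α))))

  𝔐? : ∀ α → Dec (𝔐 α)
  𝔐? (α , _) with V? (+ 1) (ε α)
  ... | yes p = yes (lift p)
  ... | no ¬p = no (λ (lift p) → ¬p p)

  1∉𝔐 : ¬ 𝔐 𝔄.1#
  1∉𝔐 (lift p) = Unit⇒¬V1 v-1# (V-resp ε-1 p)

  private
    module 𝔐 = IsIdeal 𝔐-isIdeal

    proper-left⊆𝔐 : ∀ (J : Pred 𝔄.Carrier ℓᴵ) → IsLeftIdeal 𝔄 J → ¬ J 𝔄.1# → ∀ {α} → J α → 𝔐 α
    proper-left⊆𝔐 J J-ideal 1∉J {α} α∈J = decidable-stable (𝔐? α) λ α∉𝔐 →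
      let (γ , _ , γα≈1) = ∉𝔐⇒unit α α∉𝔐 in
      1∉J (IsAdditiveSubgroup.resp (IsLeftIdeal.isAdditiveSubgroup J-ideal) {γ 𝔄.* α} {𝔄.1#} γα≈1 (IsLeftIdeal.*∈ J-ideal γ α∈J))

    proper-right⊆𝔐 : ∀ (J : Pred 𝔄.Carrier ℓᴵ) → IsRightIdeal 𝔄 J → ¬ J 𝔄.1# → ∀ {α} → J α → 𝔐 α
    proper-right⊆𝔐 J J-ideal 1∉J {α} α∈J = decidable-stable (𝔐? α) λ α∉𝔐 →
      let (γ , αγ≈1 , _) = ∉𝔐⇒unit α α∉𝔐 in
      1∉J (IsAdditiveSubgroup.resp (IsRightIdeal.isAdditiveSubgroup J-ideal) {α 𝔄.* γ} {𝔄.1#} αγ≈1 (IsRightIdeal.∈* J-ideal γ α∈J))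

  𝔄-isLocalRing : IsLocalRing 𝔄 𝔐
  𝔄-isLocalRing = record
    { isIdeal = 𝔐-isIdeal
    ; uniqueMaximalLeftIdeal = record
      { isMaximal = record
        { isOneSidedIdeal = left
        ; proper  = 1∉𝔐
        ; maximal = λ J J-ideal 1∉J _ → proper-left⊆𝔐 J J-ideal 1∉J
        }
      ; unique = λ J J-max →
          let J⊆𝔐 = proper-left⊆𝔐 J (IsMaximal.isOneSidedIdeal J-max) (IsMaximal.proper J-max) in
          J⊆𝔐 , IsMaximal.maximal J-max 𝔐 left 1∉𝔐 J⊆𝔐
      }
    ; uniqueMaximalRightIdeal = record
      { isMaximal = record
        { isOneSidedIdeal = right
        ; proper  = 1∉𝔐
        ; maximal = λ J J-ideal 1∉J _ → proper-right⊆𝔐 J J-ideal 1∉J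
        }
      ; unique = λ J J-max →
          let J⊆𝔐 = proper-right⊆𝔐 J (IsMaximal.isOneSidedIdeal J-max) (IsMaximal.proper J-max) in
          J⊆𝔐 , IsMaximal.maximal J-max 𝔐 right 1∉𝔐 J⊆𝔐
      }
    }
    where
    left : IsLeftIdeal 𝔄 𝔐
    left = record { isAdditiveSubgroup = 𝔐.isAdditiveSubgroup ; *∈ = λ r {x} → 𝔐.*∈ r {x} }
    right : IsRightIdeal 𝔄 𝔐
    right = record { isAdditiveSubgroup = 𝔐.isAdditiveSubgroup ; ∈* = λ {x} r → 𝔐.∈* {x} r }

  ε-η : ∀ c → ε (A.η c) K.≈ c
  ε-η c = K.trans (coord-cong (A.sym (A.*-identityʳ (A.η c))) 0ˢ)
    (K.trans (coord-*ₗ c A.1# 0ˢ) (K.trans (K.*-congˡ ε-1) (K.*-identityʳ c)))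

  ε-- : ∀ α β → ε (α A.- β) K.≈ ε α K.- ε β
  ε-- α β = K.trans (coord-+ α (A.- β) 0ˢ) (K.+-congˡ (coord-neg β 0ˢ))

  private
    ε-cong⇒𝔐 : ∀ {α β} → V (+ 1) (ε α K.- ε β) → V (+ 1) (ε (α A.- β))
    ε-cong⇒𝔐 {α} {β} = V-resp (K.sym (ε-- α β))

    ≈⇒𝔐 : ∀ {α β} → α A.≈ β → Lift ℓᴵ (V (+ 1) (ε (α A.- β)))
    ≈⇒𝔐 {α} {β} eq = lift (ε-cong⇒𝔐 {α} {β} (≈⇒V (coord-cong eq 0ˢ)))

  hasResidueFieldκ : HasResidueFieldκ (IsLocalRing.isIdeal 𝔄-isLocalRing)
  hasResidueFieldκ = record
    { isRingMonomorphism = record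
      { isRingHomomorphism = record
        { isSemiringHomomorphism = record
          { isNearSemiringHomomorphism = record
            { +-isMonoidHomomorphism = record
              { isMagmaHomomorphism = record
                { isRelHomomorphism = record { cong = λ {x} {y} p → lift (ε-cong⇒𝔐 (V-resp (K.sym (η-- (proj₁ x) (proj₁ y))) p)) }
                ; homo = λ x y → ≈⇒𝔐 (η.+-homo (proj₁ x) (proj₁ y))
                }
              ; ε-homo = ≈⇒𝔐 η.0#-homo
              }
            ; *-homo = λ x y → ≈⇒𝔐 (η.*-homo (proj₁ x) (proj₁ y))
            }
          ; 1#-homo = ≈⇒𝔐 η.1#-homo
          }
        ; -‿homo = λ x → ≈⇒𝔐 (η.-‿homo (proj₁ x))
        }
      ; injective = λ {x} {y} (lift p) → V-resp (K.trans (ε-- _ _) (η-- (proj₁ x) (proj₁ y))) p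
      }
    -- `η` is a section of ε, so the scalar ε(α) represents the class of α.
    ; surjective = λ (α , α∈) → (ε α , coord-V0 α∈ 0ˢ) , λ {z} p →
        lift (ε-cong⇒𝔐 (V-resp (K.+-congʳ (K.sym (ε-η (proj₁ z)))) p))
    }
    where
    η-- : ∀ x y → ε (A.η x) K.- ε (A.η y) K.≈ x K.- y
    η-- x y = K.+-cong (ε-η x) (K.-‿cong (ε-η y))

-- The cotangent space 𝔐/𝔐²

module Cotangent {k ℓk l ℓl a ℓa : Level} (ℓᴵ : Level) {K : Field k ℓk} {vK : DiscreteValuation K}
         {L : Extension K l ℓl} {vL : DiscreteValuation (Extension.extensionField L)} {N : ℕ}
         (L/K : TotallyRamified vK L vL N) {A : Algebra K a ℓa} (A-dim : HasDimension (Algebra.vectorSpace A) N)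
         (A↷L : Action A L) (h : ℤ) (T : ShiftTable N) (B : AdaptedBases L/K A↷L h T) where
  private
    module K = Field K
    module A = Algebra A
    module vK = DiscreteValuation vK
    module AC = Combination A.vectorSpace
    module AL = Lattice vK A.vectorSpace
    module 𝔸 = LeftModule A.vectorSpace
  open Valued vK
  open Summation K.ring
  open ShiftTable T
  open AdaptedBases B
  open AssociatedOrder L/K A↷L h
  open Order L/K A-dim A↷L h T B
  open LocalRing ℓᴵ L/K A-dim A↷L h T B
  open Selection ℰ?
  private
    module S = IsSubring Stabilizes-isSubring
    module 𝔄 = Ring 𝔄

  space : LeftModule vK.residueRing _ _
  space = cotangentSpace (IsLocalRing.isIdeal 𝔄-isLocalRing) hasResidueFieldκ
  private module C = LeftModule space

  -- As Φ₀ = 1 is a unit, the basis vector of index 0 is a uniformizer of K.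
  height : Fin N → ℕ
  height u with u Fin.≟ 0ˢ
  ... | yes _ = 1
  ... | no  _ = 0

  height-cases : ∀ u → (u ≡ 0ˢ × height u ≡ 1) ⊎ (u ≢ 0ˢ × height u ≡ 0)
  height-cases u with u Fin.≟ 0ˢ
  ... | yes u≡0 = inj₁ (u≡0 , refl)
  ... | no u≢0  = inj₂ (u≢0 , refl)

  -- For u ≠ 0 this is a unit, so that `e u` is Φ_u up to a unit.
  ϖ : Fin N → K.Carrier
  ϖ u = proj₁ (vK.v-surjective (+ height u))

  v-ϖ : ∀ u → vK.v (ϖ u) ≡ [ + height u ]
  v-ϖ u = proj₂ (vK.v-surjective (+ height u))

  ϖ-V0 : ∀ u → V (+ 0) (ϖ u)
  ϖ-V0 u = V-≤ (ℤ.+≤+ ℕ.z≤n) (v⇒V (v-ϖ u))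

  e : Fin N → A.Carrier
  e u = A.η (ϖ u) A.* Φ u

  e∈ : ∀ u → Stabilizes (e u)
  e∈ u = AL.IsLattice.∈-* Stabilizes-isLattice (ϖ-V0 u) (Φ∈ u)

  coord-e-≡ : ∀ u → coord (e u) u K.≈ ϖ u
  coord-e-≡ u = K.trans (coord-*ₗ (ϖ u) (Φ u) u) (K.trans (K.*-congˡ (coord-self u)) (K.*-identityʳ _))

  coord-e-≢ : ∀ {u r} → r ≢ u → coord (e u) r K.≈ K.0#
  coord-e-≢ {u} {r} r≢u = K.trans (coord-*ₗ (ϖ u) (Φ u) r) (K.trans (K.*-congˡ (coord-other r≢u)) (K.zeroʳ _))

  ε-Φ : ∀ {u} → u ≢ 0ˢ → ε (Φ u) K.≈ K.0#
  ε-Φ u≢0 = coord-other (λ 0≡u → u≢0 (sym 0≡u))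

  e∈𝔐 : ∀ u → V (+ 1) (ε (e u))
  e∈𝔐 u with height-cases u
  ... | inj₁ (refl , eq) = V-resp (K.sym (coord-e-≡ 0ˢ)) (subst (λ i → V (+ i) (ϖ 0ˢ)) eq (v⇒V (v-ϖ 0ˢ)))
  ... | inj₂ (u≢0 , _)   = V-resp (K.sym (coord-e-≢ (λ 0≡u → u≢0 (sym 0≡u)))) V-0#

  generator : Fin count → C.Carrierᴹ
  generator i = (e (sel i) , e∈ (sel i)) , lift (e∈𝔐 (sel i))

  𝔐² : Pred A.Carrier _
  𝔐² α = Σ[ α∈ ∈ Stabilizes α ] Square 𝔄 𝔐 (α , α∈)

  private
    𝔐²-resp : ∀ {α β} → α A.≈ β → 𝔐² α → 𝔐² β
    𝔐²-resp eq (α∈ , sq) = S.resp eq α∈ , resp eq sq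

    Square-* : ∀ (r : 𝔄.Carrier) {x} → Square 𝔄 𝔐 x → Square 𝔄 𝔐 (r 𝔄.* x)
    Square-* r (product {x} {y} p q) = resp (𝔄.*-assoc r x y) (product {x = r 𝔄.* x} {y = y} (IsIdeal.*∈ 𝔐-isIdeal r {x} p) q)
    Square-* r 0∈ = resp (𝔄.sym {r 𝔄.* 𝔄.0#} {𝔄.0#} (𝔄.zeroʳ r)) 0∈
    Square-* r (+∈ {x} {y} p q) = resp (𝔄.sym {r 𝔄.* (x 𝔄.+ y)} {r 𝔄.* x 𝔄.+ r 𝔄.* y} (𝔄.distribˡ r x y)) (+∈ (Square-* r p) (Square-* r q))
    Square-* r (resp {x} {y} x≈y p) = resp (𝔄.*-congˡ {r} {x} {y} x≈y) (Square-* r p)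

  𝔐²-isLattice : AL.IsLattice 𝔐²
  𝔐²-isLattice = record
    { ∈-resp = 𝔐²-resp
    ; 0ᴹ∈ = S.0∈ , 0∈
    ; ∈-+ = λ (α∈ , p) (β∈ , q) → S.+∈ α∈ β∈ , +∈ p q
    ; ∈-* = λ {c} c∈ (α∈ , p) → S.*∈ (proj₂ (𝔒→𝔄 (c , c∈))) α∈ , Square-* (𝔒→𝔄 (c , c∈)) p
    }
  private module 𝔐² = AL.IsLattice 𝔐²-isLattice

  product∈ : ∀ {α β} → Stabilizes α → Stabilizes β → V (+ 1) (ε α) → V (+ 1) (ε β) → 𝔐² (α A.* β)
  product∈ α∈ β∈ p q = S.*∈ α∈ β∈ , product {x = _ , α∈} {y = _ , β∈} (lift p) (lift q)

  private
    -- ΦₛΦₛ′ is a unit multiple of Φ_u plus terms cΦᵣ with c ∈ 𝔓_K. For r ≠ 0 such a term is a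
    -- product of two elements of 𝔐. At r = 0 this would fail, as Φ₀ = 1, but there the coefficient
    -- is ε(Φₛ)ε(Φₛ′) = 0 exactly.
    Φ∈𝔐² : ∀ {s s′ u} → s ≢ 0ˢ → s′ ≢ 0ˢ → Mult s s′ u → 𝔐² (Φ u)
    Φ∈𝔐² {s} {s′} {u} s≢0 s′≢0 μ = 𝔐².∈-unit⁻ (mult⇒unit μ)
      (𝔐².∈-isolate {cs = con s s′} {xs = Φ} u (𝔐².∈-resp (expand (Φ s A.* Φ s′))
        (product∈ (Φ∈ s) (Φ∈ s′) (V-resp (K.sym (ε-Φ s≢0)) V-0#) (V-resp (K.sym (ε-Φ s′≢0)) V-0#))) other)
      where
      con-0 : con s s′ 0ˢ K.≈ K.0#
      con-0 = K.trans (ε-* (Φ s) (Φ s′)) (K.trans (K.*-congʳ (ε-Φ s≢0)) (K.zeroˡ _))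
      other : ∀ r → r ≢ u → 𝔐² (A.η (con s s′ r) A.* Φ r)
      other r r≢u with r Fin.≟ 0ˢ
      ... | yes refl = 𝔐².∈-resp (A.sym (𝔸.≈ᴹ-trans (𝔸.*ₗ-congʳ con-0) (𝔸.*ₗ-zeroˡ (Φ 0ˢ)))) 𝔐².0ᴹ∈
      ... | no r≢0   = product∈ (proj₂ (𝔒→𝔄 (con s s′ r , V1⇒V0 con∈))) (Φ∈ r)
                         (V-resp (K.sym (ε-η _)) con∈) (V-resp (K.sym (ε-Φ r≢0)) V-0#)
        where
        con∈ : V (+ 1) (con s s′ r)
        con∈ = ¬mult⇒𝔓 (λ μ′ → r≢u (mult-functional μ′ μ))

  Spanned : Pred A.Carrier _
  Spanned α = Σ[ c ∈ (Fin count → K.Carrier) ] (∀ i → V (+ 0) (c i)) × α A.≈ AC.lc c (λ i → e (sel i))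

  Spanned-isLattice : AL.IsLattice Spanned
  Spanned-isLattice = record
    { ∈-resp = λ eq (c , c∈ , eq′) → c , c∈ , A.trans (A.sym eq) eq′
    ; 0ᴹ∈ = (λ _ → K.0#) , (λ _ → V-0#) , A.sym (AC.lc-zeroˡ (λ _ → K.refl))
    ; ∈-+ = λ (c , c∈ , eq) (c′ , c′∈ , eq′) → (λ i → c i K.+ c′ i) , (λ i → V-+ (c∈ i) (c′∈ i)) ,
        A.trans (A.+-cong eq eq′) (AC.lc-+ c c′ _)
    ; ∈-* = λ {r} r∈ (c , c∈ , eq) → (λ i → r K.* c i) , (λ i → V-0* r∈ (c∈ i)) ,
        A.trans (A.*-congˡ eq) (AC.lc-*ₗ r c _)
    }

  e-spanned : ∀ {u} → ℰ u → Spanned (e u)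
  e-spanned u∈ = let (i , u≡) = sel-surjective u∈ in
    AC.single i K.1# , single-V0 i ,
    A.trans (A.reflexive (cong e u≡)) (A.sym (A.trans (AC.lc-single* i K.1# _) (𝔸.*ₗ-identityˡ _)))
    where
    single-V0 : ∀ i j → V (+ 0) (AC.single i K.1# j)
    single-V0 i j with j Fin.≟ i
    ... | yes _ = Unit⇒V0 v-1#
    ... | no  _ = V-0#

  private
    J = AL.Join Spanned 𝔐²
    module J = AL.IsLattice (AL.Join-isLattice Spanned-isLattice 𝔐²-isLattice)

    -- Outside ℰ the element Φ_u itself lies in 𝔐². Inside ℰ the coefficient is divisible by `ϖ u`:
    -- at u = 0 because α ∈ 𝔐, elsewhere because `ϖ u` is a unit.
    term∈J : ∀ {α} → Stabilizes α → V (+ 1) (ε α) → ∀ u → J (A.η (coord α u) A.* Φ u)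
    term∈J {α} α∈ εα∈ u with ℰ? u
    ... | no u∉ = let (s , s′ , s≢0 , s′≢0 , μ) = ¬ℰ⇒ u∉ in
      J.∈-* (coord-V0 α∈ u) (AL.⊆Joinʳ Spanned-isLattice 𝔐²-isLattice (Φ∈𝔐² s≢0 s′≢0 μ))
    ... | yes u∈ = J.∈-resp eq (J.∈-* c∈ (AL.⊆Joinˡ Spanned-isLattice 𝔐²-isLattice (e-spanned u∈)))
      where
      ϖ⁻¹ = proj₁ (v-inverse (v-ϖ u))
      c = coord α u K.* ϖ⁻¹
      coord∈height : V (+ height u) (coord α u)
      coord∈height with height-cases u
      ... | inj₁ (refl , eq) = subst (λ i → V (+ i) (ε α)) (sym eq) εα∈
      ... | inj₂ (_ , eq)    = subst (λ i → V (+ i) (coord α u)) (sym eq) (coord-V0 α∈ u)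
      c∈ : V (+ 0) c
      c∈ = subst (λ i → V i c) (ℤ.+-inverseʳ (+ height u)) (V-* coord∈height (v⇒V (proj₂ (proj₂ (v-inverse (v-ϖ u))))))
      eq : A.η c A.* e u A.≈ A.η (coord α u) A.* Φ u
      eq = 𝔸.≈ᴹ-trans (𝔸.≈ᴹ-sym (𝔸.*ₗ-assoc c (ϖ u) (Φ u))) (𝔸.*ₗ-congʳ (K.trans (K.*-assoc _ _ _)
        (K.trans (K.*-congˡ (K.trans (K.*-comm _ _) (proj₁ (proj₂ (v-inverse (v-ϖ u)))))) (K.*-identityʳ _))))

    proj-lc : ∀ {n} (c : Fin n → Ring.Carrier vK.𝔒) (xs : Fin n → C.Carrierᴹ) →
      proj₁ (proj₁ (linearCombination space c xs)) A.≈ AC.lc (λ i → proj₁ (c i)) (λ i → proj₁ (proj₁ (xs i)))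
    proj-lc {ℕ.zero}  c xs = A.sym (AC.lc-[] _ _)
    proj-lc {ℕ.suc n} c xs = A.trans (A.+-congˡ (proj-lc (λ i → c (suc i)) (λ i → xs (suc i)))) (A.sym (AC.lc-∷ _ _))

  generator-generates : Generates space generator
  generator-generates ((α , α∈) , lift εα∈) = from (J.∈-resp (A.sym (expand α)) (J.∈-lc (term∈J α∈ εα∈)))
    where
    from : J α → _
    from (β , γ , (c , c∈ , β≈) , (γ∈ , γ²) , α≈) = (λ i → c i , c∈ i) , resp (A.sym α-lc≈γ) γ²
      where
      α-lc≈γ : α A.- proj₁ (proj₁ (linearCombination space (λ i → c i , c∈ i) generator)) A.≈ γ
      α-lc≈γ = A.trans (A.+-cong α≈ (A.-‿cong (A.trans (proj-lc (λ i → c i , c∈ i) generator) (A.sym β≈))))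
        (AbelianGroupProperties.xyx⁻¹≈y A.+-abelianGroup β γ)

  -- Vanishing of the coordinates in ℰ to the order that membership in 𝔐² forces.
  Deep : Pred A.Carrier _
  Deep α = ∀ u → ℰ u → V (+ ℕ.suc (height u)) (coord α u)

  coord-product : ∀ α β u → coord (α A.* β) u K.≈ ∑ (λ s → coord α s K.* ∑ (λ s′ → coord β s′ K.* con s s′ u))
  coord-product α β u = K.trans
    (K.trans (coord-cong (A.trans (A.*-congʳ (expand α)) (lc-* β (coord α) Φ)) u) (coord-lc∘ (coord α) (λ s → Φ s A.* β) u))
    (∑-cong (λ s → K.*-congˡ (K.trans (coord-cong (A.trans (A.*-congˡ (expand β)) (*-lc (Φ s) (coord β) Φ)) u)
      (coord-lc∘ (coord β) (λ s′ → Φ s A.* Φ s′) u))))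

  -- At u = 0 the coordinate is ε(α)ε(β), of value at least 2. At the other u ∈ ℰ, either the
  -- structure constant lies in 𝔓_K, or s or s′ is 0 by `ℰ⇒` and the factor ε(α) or ε(β) lies in
  -- 𝔓_K.
  product-deep : ∀ {α β} → Stabilizes α → Stabilizes β → V (+ 1) (ε α) → V (+ 1) (ε β) → Deep (α A.* β)
  product-deep {α} {β} α∈ β∈ p q u u∈ with height-cases u
  ... | inj₁ (refl , eq) = subst (λ i → V (+ ℕ.suc i) (ε (α A.* β))) (sym eq) (V-resp (K.sym (ε-* α β)) (V-* p q))
  ... | inj₂ (_ , eq)    = subst (λ i → V (+ ℕ.suc i) (coord (α A.* β) u)) (sym eq) (V-resp (K.sym (coord-product α β u)) (V-∑ λ s → V-resp (K.sym (*-∑ _ _)) (V-∑ λ s′ → term s s′)))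
    where
    term : ∀ s s′ → V (+ 1) (coord α s K.* (coord β s′ K.* con s s′ u))
    term s s′ with mult? s s′ u
    ... | no ¬μ = V-0* (coord-V0 α∈ s) (V-0* (coord-V0 β∈ s′) (¬mult⇒𝔓 ¬μ))
    ... | yes μ with ℰ⇒ u∈ μ
    ... | inj₁ refl = V-*0 p (V-0* (coord-V0 β∈ s′) (con-V0 s s′ u))
    ... | inj₂ refl = V-0* (coord-V0 α∈ s) (V-*0 q (con-V0 s s′ u))

  square-deep : ∀ {x} → Square 𝔄 𝔐 x → Deep (proj₁ x)
  square-deep (product {x} {y} (lift p) (lift q)) = product-deep (proj₂ x) (proj₂ y) p q
  square-deep 0∈ u u∈ = V-resp (K.sym (coord-0 u)) V-0#
  square-deep (+∈ p q) u u∈ = V-resp (K.sym (coord-+ _ _ u)) (V-+ (square-deep p u u∈) (square-deep q u u∈))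
  square-deep (resp eq p) u u∈ = V-resp (coord-cong eq u) (square-deep p u u∈)

  -- The coordinate of the combination at u = sel i is c i times `ϖ u`. Membership in 𝔐² forces its
  -- value to be at least `height u` + 1, which leaves at least 1 for c i.
  generator-independent : LinearlyIndependent space generator
  generator-independent c sq i = V-- (V-cancelˡ (v-ϖ u) (V-resp (K.*-comm _ _) (subst (λ j → V j (proj₁ (c i) K.* ϖ u)) suc≡ deep))) V-0#
    where
    u = sel i
    suc≡ : + ℕ.suc (height u) ≡ + height u ℤ.+ + 1
    suc≡ = cong +_ (ℕ.+-comm 1 (height u))
    coord-i : coord (proj₁ (proj₁ (linearCombination space c generator)) A.- A.0#) u K.≈ proj₁ (c i) K.* ϖ u
    coord-i = K.trans (coord-cong (A.trans (A.+-congˡ (RingProperties.-0#≈0# A.ring)) (A.trans (A.+-identityʳ _) (proj-lc c generator))) u)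
      (K.trans (coord-lc∘ (λ j → proj₁ (c j)) (λ j → e (sel j)) u)
      (K.trans (∑-single _ i (λ j j≢i → K.trans (K.*-congˡ (coord-e-≢ (λ eq → j≢i (sel-injective (sym eq))))) (K.zeroʳ _)))
        (K.*-congˡ (coord-e-≡ u))))
    deep : V (+ ℕ.suc (height u)) (proj₁ (c i) K.* ϖ u)
    deep = V-resp coord-i (square-deep sq u (sel∈ i))

  embeddingDimension : HasDimension space count
  embeddingDimension = generator , generator-generates , generator-independent

  structure : Σ[ 𝔐 ∈ Pred 𝔄.Carrier ℓᴵ ]
              Σ[ 𝔄-local ∈ IsLocalRing 𝔄 𝔐 ]
              Σ[ κ≅𝔄/𝔐 ∈ HasResidueFieldκ (IsLocalRing.isIdeal 𝔄-local) ]
                HasDimension (cotangentSpace (IsLocalRing.isIdeal 𝔄-local) κ≅𝔄/𝔐) count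
  structure = 𝔐 , 𝔄-isLocalRing , hasResidueFieldκ , embeddingDimension

-- Base-p digits and addition without carries

module Digits (p : ℕ) (p-prime : Prime p) (n : ℕ) (β : Fin n → ℤ) where
  open Shifts p p-prime n β
  private
    instance
      p-nonZero : ℕ.NonZero p
      p-nonZero = prime⇒nonZero p-prime

    quotient-combine : ∀ m (s : Fin (p ^ ℕ.suc m)) →
      toℕ s ≡ p ^ m ℕ.* toℕ (quotientᶠ {p} (p ^ m) s) ℕ.+ toℕ (remainder {p} (p ^ m) s)
    quotient-combine m s = trans (cong toℕ (sym (Fin.combine-remQuot {p} (p ^ m) s)))
      (Fin.toℕ-combine (quotientᶠ {p} (p ^ m) s) (remainder {p} (p ^ m) s))

    -- Both sides list the digits from the leading one. For `suc i` the leading digit contributes a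
    -- multiple of p^(e+1), which disappears after division by p^e and reduction modulo p.
    digit-finToFun′ : ∀ m (s : Fin (p ^ m)) i .{{_ : ℕ.NonZero (p ^ (m ∸ ℕ.suc (toℕ i)))}} →
      (toℕ s / p ^ (m ∸ ℕ.suc (toℕ i))) % p ≡ toℕ (finToFun {p} {m} s i)
    digit-finToFun′ (ℕ.suc m) s zero = trans (cong (λ x → (x / p ^ m) % p) (trans (quotient-combine m s) (cong (ℕ._+ toℕ (remainder {p} (p ^ m) s)) (ℕ.*-comm (p ^ m) q))))
      (trans (cong (_% p) (trans (+-distrib-/-∣ˡ _ (ℕ.n∣m*n q)) (cong₂ ℕ._+_ (m*n/n≡m q (p ^ m)) (m<n⇒m/n≡0 (Fin.toℕ<n (remainder {p} (p ^ m) s))))))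
      (trans (cong (_% p) (ℕ.+-identityʳ q)) (m<n⇒m%n≡m (Fin.toℕ<n (quotientᶠ {p} (p ^ m) s)))))
      where q = toℕ (quotientᶠ {p} (p ^ m) s)
    digit-finToFun′ (ℕ.suc m) s (suc i) = trans (cong (λ x → (x / p ^ e) % p) (trans (quotient-combine m s) (cong (ℕ._+ r) pᵐq≡)))
      (trans (cong (_% p) (trans (+-distrib-/-∣ˡ r (ℕ.n∣m*n (k ℕ.* p))) (trans (cong₂ ℕ._+_ (m*n/n≡m (k ℕ.* p) (p ^ e)) refl) (ℕ.+-comm (k ℕ.* p) _))))
      (trans ([m+kn]%n≡m%n (r / p ^ e) k p) (digit-finToFun′ m (remainder {p} (p ^ m) s) i)))
      where
      q = toℕ (quotientᶠ {p} (p ^ m) s)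
      r = toℕ (remainder {p} (p ^ m) s)
      e = m ∸ ℕ.suc (toℕ i)
      k = q ℕ.* p ^ toℕ i
      pᵐ≡ : p ^ m ≡ (p ^ toℕ i ℕ.* p) ℕ.* p ^ e
      pᵐ≡ = trans (cong (p ^_) (sym (ℕ.m+[n∸m]≡n (Fin.toℕ<n i)))) (trans (ℕ.^-distribˡ-+-* p (ℕ.suc (toℕ i)) e)
        (cong (ℕ._* p ^ e) (ℕ.*-comm p _)))
      pᵐq≡ : p ^ m ℕ.* q ≡ (k ℕ.* p) ℕ.* p ^ e
      pᵐq≡ = trans (ℕ.*-comm (p ^ m) q) (trans (cong (q ℕ.*_) pᵐ≡) (trans (sym (ℕ.*-assoc q _ _))
        (cong (ℕ._* p ^ e) (sym (ℕ.*-assoc q _ _)))))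

    value : ∀ m → (Fin m → ℕ) → ℕ
    value ℕ.zero    f = 0
    value (ℕ.suc m) f = p ^ m ℕ.* f zero ℕ.+ value m (λ i → f (suc i))

    value-cong : ∀ m {f g : Fin m → ℕ} → (∀ i → f i ≡ g i) → value m f ≡ value m g
    value-cong ℕ.zero    eq = refl
    value-cong (ℕ.suc m) eq = cong₂ ℕ._+_ (cong (p ^ m ℕ.*_) (eq zero)) (value-cong m (λ i → eq (suc i)))

    value-+ : ∀ m (f g : Fin m → ℕ) → value m (λ i → f i ℕ.+ g i) ≡ value m f ℕ.+ value m g
    value-+ ℕ.zero    f g = refl
    value-+ (ℕ.suc m) f g = trans (cong₂ ℕ._+_ (ℕ.*-distribˡ-+ (p ^ m) (f zero) (g zero)) (value-+ m _ _))
      (CommutativeSemigroupProperties.interchange ℕ.+-commutativeSemigroup (p ^ m ℕ.* f zero) (p ^ m ℕ.* g zero) _ _)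

    value-0 : ∀ m → value m (λ _ → 0) ≡ 0
    value-0 ℕ.zero    = refl
    value-0 (ℕ.suc m) = cong₂ ℕ._+_ (ℕ.*-zeroʳ (p ^ m)) (value-0 m)

    toℕ-value : ∀ m (s : Fin (p ^ m)) → toℕ s ≡ value m (λ i → toℕ (finToFun {p} {m} s i))
    toℕ-value ℕ.zero    zero = refl
    toℕ-value (ℕ.suc m) s    = trans (quotient-combine m s) (cong (_ ℕ.+_) (toℕ-value m (remainder {p} (p ^ m) s)))

  digit-finToFun : ∀ s i → digit s i ≡ toℕ (finToFun {p} {n} s i)
  digit-finToFun s i = digit-finToFun′ n s i {{ℕ.m^n≢0 p (exponent i)}}

  digit<p : ∀ s i → digit s i ℕ.< p
  digit<p s i = subst (ℕ._< p) (sym (digit-finToFun s i)) (Fin.toℕ<n _)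

  fromDigits : (f : Fin n → ℕ) → (∀ i → f i ℕ.< p) → ∃[ s ] ∀ i → digit s i ≡ f i
  fromDigits f f<p = funToFin g , λ i → trans (digit-finToFun (funToFin g) i)
    (trans (cong toℕ (Fin.finToFun-funToFin {n} {p} g i)) (Fin.toℕ-fromℕ< (f<p i)))
    where
    g : Fin n → Fin p
    g i = fromℕ< (f<p i)

  toℕ-digits : ∀ s → toℕ s ≡ value n (digit s)
  toℕ-digits s = trans (toℕ-value n s) (value-cong n (λ i → sym (digit-finToFun s i)))

  digits-injective : ∀ {s t} → (∀ i → digit s i ≡ digit t i) → s ≡ t
  digits-injective {s} {t} eq = Fin.toℕ-injective (trans (toℕ-digits s) (trans (value-cong n eq) (sym (toℕ-digits t))))

  -- u = s + t without carries
  Sum : 𝕊 → 𝕊 → 𝕊 → Set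
  Sum s t u = ∀ i → digit u i ≡ digit s i ℕ.+ digit t i

  sum? : ∀ s t u → Dec (Sum s t u)
  sum? s t u = Fin.all? (λ i → digit u i ℕ.≟ digit s i ℕ.+ digit t i)

  sum-comm : ∀ {s t u} → Sum s t u → Sum t s u
  sum-comm {s} {t} σ i = trans (σ i) (ℕ.+-comm (digit s i) (digit t i))

  sum-cancelʳ : ∀ {s s′ t u} → Sum s t u → Sum s′ t u → s ≡ s′
  sum-cancelʳ {s} {s′} {t} σ σ′ = digits-injective (λ i → ℕ.+-cancelʳ-≡ (digit t i) (digit s i) (digit s′ i) (trans (sym (σ i)) (σ′ i)))

  sum-functional : ∀ {s t u u′} → Sum s t u → Sum s t u′ → u ≡ u′
  sum-functional σ σ′ = digits-injective (λ i → trans (σ i) (sym (σ′ i)))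

  sum⇒≼ : ∀ {s t u} → Sum s t u → s ≼ u
  sum⇒≼ {s} {t} σ i = subst (digit s i ℕ.≤_) (sym (σ i)) (ℕ.m≤m+n (digit s i) (digit t i))

  sum-toℕ : ∀ {s t u} → Sum s t u → toℕ u ≡ toℕ s ℕ.+ toℕ t
  sum-toℕ {s} {t} {u} σ = trans (toℕ-digits u) (trans (value-cong n σ) (trans (value-+ n (digit s) (digit t))
    (cong₂ ℕ._+_ (sym (toℕ-digits s)) (sym (toℕ-digits t)))))

  toℕ--ˢ : ∀ u s → toℕ (u -ˢ s) ≡ toℕ u ∸ toℕ s
  toℕ--ˢ u s = Fin.toℕ-fromℕ< _

  sum⇒-ˢ : ∀ {s t u} → Sum s t u → u -ˢ s ≡ t
  sum⇒-ˢ {s} {t} {u} σ = Fin.toℕ-injective (trans (toℕ--ˢ u s) (trans (cong (_∸ toℕ s) (sum-toℕ {s} {t} {u} σ)) (ℕ.m+n∸m≡n (toℕ s) (toℕ t))))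

  -- `-ˢ` is subtraction of natural numbers. For s ≼ u no borrow occurs: the element t with the
  -- digitwise differences satisfies u = s + t also as numbers, so it is u -ˢ s.
  -ˢ-sum : ∀ {s u} → s ≼ u → Sum s (u -ˢ s) u
  -ˢ-sum {s} {u} s≼u = subst (λ x → Sum s x u) (sym (sum⇒-ˢ {s} {t} {u} σ)) σ
    where
    t-digits = fromDigits (λ i → digit u i ∸ digit s i) (λ i → ℕ.≤-<-trans (ℕ.m∸n≤m (digit u i) (digit s i)) (digit<p u i))
    t = proj₁ t-digits
    σ : Sum s t u
    σ i = trans (sym (ℕ.m+[n∸m]≡n (s≼u i))) (cong (digit s i ℕ.+_) (sym (proj₂ t-digits i)))

  digit-0ˢ : ∀ i → digit 0ˢ i ≡ 0
  digit-0ˢ i = trans (cong (λ s → digit s i) (sym z≡0)) (proj₂ z-digits i)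
    where
    z-digits = fromDigits (λ _ → 0) (λ _ → ℕ.n≢0⇒n>0 (ℕ.≢-nonZero⁻¹ p))
    z≡0 : proj₁ z-digits ≡ 0ˢ
    z≡0 = Fin.toℕ-injective (trans (toℕ-digits (proj₁ z-digits)) (trans (value-cong n (proj₂ z-digits))
      (trans (value-0 n) (sym (Fin.toℕ-fromℕ< (ℕ.m^n>0 p n))))))

  ≢0ˢ⇒toℕ>0 : ∀ {s} → s ≢ 0ˢ → 0 ℕ.< toℕ s
  ≢0ˢ⇒toℕ>0 s≢0 = ℕ.n≢0⇒n>0 (λ eq → s≢0 (Fin.toℕ-injective (trans eq (sym (Fin.toℕ-fromℕ< (ℕ.m^n>0 p n))))))

  0ˢ-sum : ∀ s → Sum 0ˢ s s
  0ˢ-sum s i = sym (cong (ℕ._+ digit s i) (digit-0ˢ i))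

  ≢0ˢ⇒0≺ : ∀ {s} → s ≢ 0ˢ → 0ˢ ≺ s
  ≢0ˢ⇒0≺ {s} s≢0 = sum⇒≼ {0ˢ} {s} {s} (0ˢ-sum s) , λ eq → s≢0 (sym eq)

  sum-increasing : ∀ {s t u} → Sum s t u → s ≢ 0ˢ → toℕ t ℕ.< toℕ u
  sum-increasing {s} {t} {u} σ s≢0 = subst (toℕ t ℕ.<_) (sym (sum-toℕ {s} {t} {u} σ)) (ℕ.+-monoˡ-< (toℕ t) (≢0ˢ⇒toℕ>0 s≢0))

  -- The functions d and w as a shift table

  module Table (h b : ℤ) where
    private
      𝕕 = d h b
      𝕨 = w h b

      i+[j-i]≡j : ∀ i j → i ℤ.+ (j ℤ.- i) ≡ j
      i+[j-i]≡j = solve-∀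

    -- The default value of the minimum is the term at s itself, so a minimizer u ≽ s exists in
    -- either case; the pair returned is u -ˢ s and u.
    w-attained : ∀ s → ∃₂ λ u t → Sum s u t × 𝕕 t ≡ 𝕕 u ℤ.+ 𝕨 s
    w-attained s = from (Extrema.argmin-sel ℤ.≤-totalOrder (λ x → x) (𝕕 s ℤ.- 𝕕 (s -ˢ s))
        (map (λ u → 𝕕 u ℤ.- 𝕕 (u -ˢ s)) (filter (s ≼?_) (allFin (p ^ n)))))
      where
      at : ∀ u → s ≼ u → 𝕨 s ≡ 𝕕 u ℤ.- 𝕕 (u -ˢ s) → ∃₂ λ u t → Sum s u t × 𝕕 t ≡ 𝕕 u ℤ.+ 𝕨 s
      at u s≼u eq = u -ˢ s , u , -ˢ-sum s≼u ,
        sym (trans (cong (λ i → 𝕕 (u -ˢ s) ℤ.+ i) eq) (i+[j-i]≡j (𝕕 (u -ˢ s)) (𝕕 u)))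
      from : _ → _
      from (inj₁ eq) = at s (λ i → ℕ.≤-refl) eq
      from (inj₂ w∈) = let (u , u∈ , eq) = ∈-map⁻ (λ u → 𝕕 u ℤ.- 𝕕 (u -ˢ s)) w∈ in
        at u (proj₂ (∈-filter⁻ (s ≼?_) {xs = allFin (p ^ n)} u∈)) eq

    w-≤ : ∀ {s u t} → Sum s u t → 𝕕 u ℤ.+ 𝕨 s ℤ.≤ 𝕕 t
    w-≤ {s} {u} {t} σ = ℤ.≤-trans (ℤ.+-monoʳ-≤ (𝕕 u) (subst (λ x → 𝕨 s ℤ.≤ 𝕕 t ℤ.- 𝕕 x) (sum⇒-ˢ {s} {u} {t} σ) w≤))
        (ℤ.≤-reflexive (i+[j-i]≡j (𝕕 u) (𝕕 t)))
      where
      w≤ : 𝕨 s ℤ.≤ 𝕕 t ℤ.- 𝕕 (t -ˢ s)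
      w≤ = All.lookup (Extrema.min≤xs ℤ.≤-totalOrder (𝕕 s ℤ.- 𝕕 (s -ˢ s)) _)
        (∈-map⁺ (λ u → 𝕕 u ℤ.- 𝕕 (u -ˢ s)) (∈-filter⁺ (s ≼?_) (∈-allFin t) (sum⇒≼ {s} {u} {t} σ)))

    -- The equality cases of `w-≤` and of `w-superadditive`.
    Acts Mult : 𝕊 → 𝕊 → 𝕊 → Set
    Acts s u t = Sum s u t × 𝕕 t ≡ 𝕕 u ℤ.+ 𝕨 s
    Mult s s′ r = Sum s s′ r × 𝕨 r ≡ 𝕨 s ℤ.+ 𝕨 s′

    w-0ˢ : 𝕨 0ˢ ≡ + 0
    w-0ˢ = let (u , t , σ , eq) = w-attained 0ˢ in
      AbelianGroupProperties.identityʳ-unique ℤ.+-0-abelianGroup (𝕕 u) (𝕨 0ˢ)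
        (sym (trans (cong 𝕕 (sum-functional {0ˢ} {u} {u} {t} (0ˢ-sum u) σ)) eq))

    private
      -- The digit sums of s′ and u are bounded by the digits of t, so this addition has no carry
      -- either.
      sum-assoc : ∀ {s s′ r u t} → Sum s s′ r → Sum r u t → ∃[ m ] Sum s′ u m × Sum s m t
      sum-assoc {s} {s′} {r} {u} {t} σ τ = m , (λ i → proj₂ m-digits i) , λ i → begin
        digit t i                                 ≡⟨ τ i ⟩
        digit r i ℕ.+ digit u i                   ≡⟨ cong (ℕ._+ digit u i) (σ i) ⟩
        digit s i ℕ.+ digit s′ i ℕ.+ digit u i    ≡⟨ ℕ.+-assoc (digit s i) (digit s′ i) (digit u i) ⟩
        digit s i ℕ.+ (digit s′ i ℕ.+ digit u i)  ≡⟨ cong (digit s i ℕ.+_) (proj₂ m-digits i) ⟨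
        digit s i ℕ.+ digit m i                   ∎
        where
        open ≡.≡-Reasoning
        bound : ∀ i → digit s′ i ℕ.+ digit u i ℕ.< p
        bound i = ℕ.≤-<-trans (subst (digit s′ i ℕ.+ digit u i ℕ.≤_)
          (trans (sym (ℕ.+-assoc (digit s i) (digit s′ i) (digit u i))) (trans (cong (ℕ._+ digit u i) (sym (σ i))) (sym (τ i))))
          (ℕ.m≤n+m (digit s′ i ℕ.+ digit u i) (digit s i))) (digit<p t i)
        m-digits = fromDigits (λ i → digit s′ i ℕ.+ digit u i) bound
        m = proj₁ m-digits

      rearrange : ∀ i j k → i ℤ.+ (j ℤ.+ k) ≡ i ℤ.+ k ℤ.+ j
      rearrange = solve-∀

      cancelˡ-≤ : ∀ i {j k} → i ℤ.+ j ℤ.≤ i ℤ.+ k → j ℤ.≤ k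
      cancelˡ-≤ i {j} {k} p = ≡.subst₂ ℤ._≤_ (-i+[i+j]≡j i j) (-i+[i+j]≡j i k) (ℤ.+-monoʳ-≤ (ℤ.- i) p)
        where
        -i+[i+j]≡j : ∀ i j → ℤ.- i ℤ.+ (i ℤ.+ j) ≡ j
        -i+[i+j]≡j = solve-∀

      cancelʳ-≤ : ∀ k {i j} → i ℤ.+ k ℤ.≤ j ℤ.+ k → i ℤ.≤ j
      cancelʳ-≤ k {i} {j} p = cancelˡ-≤ k (≡.subst₂ ℤ._≤_ (ℤ.+-comm i k) (ℤ.+-comm j k) p)

      -- At a pair v, t where w(r) is attained, the passage from v to t is split into a step by s′
      -- and a step by s, and `w-≤` is applied to each.
      w-superadditive : ∀ {s s′ r} → Sum s s′ r → 𝕨 s ℤ.+ 𝕨 s′ ℤ.≤ 𝕨 r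
      w-superadditive {s} {s′} {r} σ =
        let (v , t , τ , eq) = w-attained r
            (m , σ₁ , σ₂) = sum-assoc {s} {s′} {r} {v} {t} σ τ
        in cancelˡ-≤ (𝕕 v) (begin
          𝕕 v ℤ.+ (𝕨 s ℤ.+ 𝕨 s′)  ≡⟨ rearrange (𝕕 v) (𝕨 s) (𝕨 s′) ⟩
          𝕕 v ℤ.+ 𝕨 s′ ℤ.+ 𝕨 s    ≤⟨ ℤ.+-monoˡ-≤ (𝕨 s) (w-≤ {s′} {v} {m} σ₁) ⟩
          𝕕 m ℤ.+ 𝕨 s             ≤⟨ w-≤ {s} {m} {t} σ₂ ⟩
          𝕕 t                     ≡⟨ eq ⟩
          𝕕 v ℤ.+ 𝕨 r             ∎)
        where open ℤ.≤-Reasoning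

      sum-0ʳ : ∀ s → Sum s 0ˢ s
      sum-0ʳ s = sum-comm {0ˢ} {s} {s} (0ˢ-sum s)

      acts-∘⇒mult : ∀ {s s′ r u m t} → Acts s′ u m → Acts s m t → Acts r u t → Mult s s′ r
      acts-∘⇒mult {s} {s′} {r} {u} {m} {t} (σ₁ , d₁) (σ₂ , d₂) (σ , dt) =
        (λ i → ℕ.+-cancelʳ-≡ (digit u i) _ _ (trans (sym (σ i)) (trans (σ₂ i)
          (trans (cong (digit s i ℕ.+_) (σ₁ i)) (sym (ℕ.+-assoc (digit s i) _ _)))))) ,
        GroupProperties.∙-cancelˡ (AbelianGroup.group ℤ.+-0-abelianGroup) (𝕕 u) _ _
          (trans (sym dt) (trans d₂ (trans (cong (ℤ._+ 𝕨 s) d₁) (sym (rearrange (𝕕 u) (𝕨 s) (𝕨 s′))))))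

      -- The two inequalities `w-≤` along u, m, t add up to an equality, so both are equalities.
      mult⇒acts-∘ : ∀ {s s′ r u t} → Mult s s′ r → Acts r u t → ∃[ m ] Acts s′ u m × Acts s m t
      mult⇒acts-∘ {s} {s′} {r} {u} {t} (σ , wr) (τ , dt) =
        let (m , σ₁ , σ₂) = sum-assoc {s} {s′} {r} {u} {t} σ τ
            lower = w-≤ {s′} {u} {m} σ₁
            upper = w-≤ {s} {m} {t} σ₂
            total : 𝕕 t ≡ 𝕕 u ℤ.+ 𝕨 s′ ℤ.+ 𝕨 s
            total = trans dt (trans (cong (λ i → 𝕕 u ℤ.+ i) wr) (rearrange (𝕕 u) (𝕨 s) (𝕨 s′)))
            dm : 𝕕 m ≡ 𝕕 u ℤ.+ 𝕨 s′
            dm = ℤ.≤-antisym (cancelʳ-≤ (𝕨 s) (ℤ.≤-trans upper (ℤ.≤-reflexive total))) lower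
        in m , (σ₁ , dm) , (σ₂ , trans total (cong (ℤ._+ 𝕨 s) (sym dm)))

      mult-increasing : ∀ {s s′ r} → Mult s s′ r → s′ ≢ 0ˢ → toℕ s ℕ.< toℕ r
      mult-increasing {s} {s′} {r} (σ , _) = sum-increasing {s′} {s} {r} (sum-comm {s} {s′} {r} σ)

      𝒟⇒ : ∀ {u s v} → 𝒟 h b u → Acts s v u → s ≡ 0ˢ
      𝒟⇒ {u} {s} {v} u∈ (σ , eq) with s Fin.≟ 0ˢ
      ... | yes s≡0 = s≡0
      ... | no  s≢0 = contradiction (u∈ s (≢0ˢ⇒0≺ s≢0) (sum⇒≼ {s} {v} {u} σ))
        (ℤ.<-irrefl (trans (cong (λ x → 𝕕 x ℤ.+ 𝕨 s) (sum⇒-ˢ {s} {v} {u} σ)) (sym eq)))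

      -- Where the strict inequality of 𝒟 fails, `w-≤` turns the failure into equality.
      ¬𝒟⇒ : ∀ {u} → ¬ 𝒟 h b u → ∃₂ λ s v → s ≢ 0ˢ × Acts s v u × toℕ v ℕ.< toℕ u
      ¬𝒟⇒ {u} u∉ with Fin.¬∀⟶∃¬ _ _ (λ s → (0ˢ ≺? s) →-dec ((s ≼? u) →-dec (_ ℤ.<? _))) u∉
      ... | s , ¬P with 0ˢ ≺? s | s ≼? u | 𝕕 (u -ˢ s) ℤ.+ 𝕨 s ℤ.<? 𝕕 u
      ... | no ¬0≺s | _       | _      = contradiction (λ 0≺s → contradiction 0≺s ¬0≺s) ¬P
      ... | yes _   | no s⋠u  | _      = contradiction (λ _ s≼u → contradiction s≼u s⋠u) ¬P
      ... | yes _   | yes _   | yes lt = contradiction (λ _ _ → lt) ¬P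
      ... | yes (_ , 0≢s) | yes s≼u | no ≮ = s , u -ˢ s , s≢0 ,
        (-ˢ-sum s≼u , ℤ.≤-antisym (ℤ.≮⇒≥ ≮) (w-≤ {s} {u -ˢ s} {u} (-ˢ-sum s≼u))) ,
        sum-increasing {s} {u -ˢ s} {u} (-ˢ-sum s≼u) s≢0
        where s≢0 = λ s≡0 → 0≢s (sym s≡0)

      ℰ⇒ : ∀ {u s s′} → ℰ h b u → Mult s s′ u → s ≡ 0ˢ ⊎ s′ ≡ 0ˢ
      ℰ⇒ {u} {s} {s′} u∈ (σ , eq) with s Fin.≟ 0ˢ | s′ Fin.≟ 0ˢ
      ... | yes s≡0 | _        = inj₁ s≡0
      ... | no _    | yes s′≡0 = inj₂ s′≡0
      ... | no s≢0  | no s′≢0  = contradiction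
        (u∈ s (≢0ˢ⇒0≺ s≢0) (sum⇒≼ {s} {s′} {u} σ ,
          λ { refl → ℕ.<-irrefl refl (sum-increasing {s′} {s} {s} (sum-comm {s} {s′} {s} σ) s′≢0) }))
        (ℤ.<-irrefl (trans (cong (λ x → 𝕨 x ℤ.+ 𝕨 s) (sum⇒-ˢ {s} {s′} {u} σ)) (trans (ℤ.+-comm (𝕨 s′) (𝕨 s)) (sym eq))))

      -- As for 𝒟, with `w-superadditive` in the place of `w-≤`; s ≠ u ensures that the
      -- complementary factor is not 0 either.
      ¬ℰ⇒ : ∀ {u} → ¬ ℰ h b u → ∃₂ λ s s′ → s ≢ 0ˢ × s′ ≢ 0ˢ × Mult s s′ u
      ¬ℰ⇒ {u} u∉ with Fin.¬∀⟶∃¬ _ _ (λ s → (0ˢ ≺? s) →-dec ((s ≺? u) →-dec (_ ℤ.<? _))) u∉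
      ... | s , ¬P with 0ˢ ≺? s | s ≺? u | 𝕨 (u -ˢ s) ℤ.+ 𝕨 s ℤ.<? 𝕨 u
      ... | no ¬0≺s | _       | _      = contradiction (λ 0≺s → contradiction 0≺s ¬0≺s) ¬P
      ... | yes _   | no s⊀u  | _      = contradiction (λ _ s≺u → contradiction s≺u s⊀u) ¬P
      ... | yes _   | yes _   | yes lt = contradiction (λ _ _ → lt) ¬P
      ... | yes (_ , 0≢s) | yes (s≼u , s≢u) | no ≮ = s , u -ˢ s , (λ s≡0 → 0≢s (sym s≡0)) , u-s≢0 ,
        (σ , ℤ.≤-antisym (ℤ.≤-trans (ℤ.≮⇒≥ ≮) (ℤ.≤-reflexive (ℤ.+-comm _ (𝕨 s)))) (w-superadditive {s} {u -ˢ s} {u} σ))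
        where
        σ = -ˢ-sum s≼u
        u-s≢0 : u -ˢ s ≢ 0ˢ
        u-s≢0 eq = s≢u (sum-functional {s} {0ˢ} {s} {u} (sum-0ʳ s) (subst (λ x → Sum s x u) eq σ))

      -- Vacuous, since s ≼ 0 forces s = 0. In the cotangent space this index stands for the
      -- uniformizer of K.
      0∈ℰ : ℰ h b 0ˢ
      0∈ℰ s (_ , 0≢s) (s≼0 , _) = contradiction (digits-injective (λ i → trans (digit-0ˢ i)
        (sym (ℕ.n≤0⇒n≡0 (subst (digit s i ℕ.≤_) (digit-0ˢ i) (s≼0 i)))))) 0≢s

    shiftTable : ShiftTable (p ^ n)
    shiftTable = record
      { 0ˢ = 0ˢ
      ; Acts = Acts
      ; Mult = Mult
      ; acts? = λ s u t → sum? s u t ×-dec (_ ℤ.≟ _)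
      ; mult? = λ s s′ r → sum? s s′ r ×-dec (_ ℤ.≟ _)
      ; acts-total = w-attained
      ; acts-injective = λ {s} {s′} {u} {t} (σ , _) (σ′ , _) → sum-cancelʳ {s} {s′} {u} {t} σ σ′
      ; acts-functional = λ {s} {u} {t} {t′} (σ , _) (σ′ , _) → sum-functional {s} {u} {t} {t′} σ σ′
      ; acts-∘⇒mult = acts-∘⇒mult
      ; mult⇒acts-∘ = mult⇒acts-∘
      ; mult-identityʳ = λ s → sum-0ʳ s , sym (trans (cong (λ i → 𝕨 s ℤ.+ i) w-0ˢ) (ℤ.+-identityʳ (𝕨 s)))
      ; mult-functional = λ {s} {s′} {r} {r′} (σ , _) (σ′ , _) → sum-functional {s} {s′} {r} {r′} σ σ′
      ; mult-increasing = mult-increasing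
      ; 𝒟 = 𝒟 h b
      ; 𝒟? = 𝒟? h b
      ; 𝒟⇒ = 𝒟⇒
      ; ¬𝒟⇒ = ¬𝒟⇒
      ; ℰ = ℰ h b
      ; ℰ? = ℰ? h b
      ; ℰ⇒ = ℰ⇒
      ; ¬ℰ⇒ = ¬ℰ⇒
      ; 0∈ℰ = 0∈ℰ
      }

-- The numbers 𝔟(s) modulo pⁿ and the function 𝔞

module Residues (p : ℕ) (p-prime : Prime p) (n : ℕ) (β : Fin n → ℤ)
         (coprime : ∀ i → Coprime (β i) (+ p)) where
  open Shifts p p-prime n β
  open Digits p p-prime n β
  open Summation ℤ.+-*-ring
  private
    instance
      p-nonZero : ℕ.NonZero p
      p-nonZero = prime⇒nonZero p-prime

    weigh : ∀ m → (Fin m → ℤ) → (Fin m → ℕ) → ℤ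
    weigh m β f = ∑ (λ i → + (f i ℕ.* p ^ (m ∸ ℕ.suc (toℕ i))) ℤ.* β i)

    small-multiple : ∀ {i} → ℤ.∣ i ∣ ℕ.< p → + p ℤᵤ.∣ i → i ≡ + 0
    small-multiple {+ ℕ.zero}   _  _ = refl
    small-multiple {+ ℕ.suc i}  lt d = contradiction (ℕ.∣⇒≤ d) (ℕ.<⇒≱ lt)
    small-multiple {ℤ.-[1+ i ]} lt d = contradiction (ℕ.∣⇒≤ d) (ℕ.<⇒≱ lt)

    ∣f-g∣<p : ∀ {f g} → f ℕ.< p → g ℕ.< p → ℤ.∣ + f ℤ.- + g ∣ ℕ.< p
    ∣f-g∣<p {f} {g} f<p g<p with ℕ.≤-total f g
    ... | inj₁ f≤g = ℕ.≤-<-trans (ℕ.≤-reflexive (trans (cong ℤ.∣_∣ (ℤ.m-n≡m⊖n f g)) (ℤ.∣⊖∣-≤ f≤g))) (ℕ.≤-<-trans (ℕ.m∸n≤m g f) g<p)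
    ... | inj₂ g≤f = ℕ.≤-<-trans (ℕ.≤-reflexive (trans (cong ℤ.∣_∣ (trans (ℤ.m-n≡m⊖n f g) (ℤ.⊖-≥ g≤f))) refl)) (ℕ.≤-<-trans (ℕ.m∸n≤m f g) f<p)

    -- Modulo p^m the leading term vanishes, so the remaining digits agree by induction. What is
    -- left is that p^(m+1) divides β₀(f₀ - g₀)p^m; as β₀ is prime to p, p divides f₀ - g₀, whose
    -- absolute value is below p.
    weigh-injective : ∀ m (β : Fin m → ℤ) → (∀ i → Coprime (β i) (+ p)) →
      ∀ f g → (∀ i → f i ℕ.< p) → (∀ i → g i ℕ.< p) → + (p ^ m) ℤ.∣ weigh m β f ℤ.- weigh m β g → ∀ i → f i ≡ g i
    weigh-injective (ℕ.suc m) β cop f g f<p g<p d = λ { zero → head-eq ; (suc i) → tail-eq i }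
      where
      q = + (p ^ m)
      β′ = λ i → β (suc i)
      f′ = λ i → f (suc i)
      g′ = λ i → g (suc i)
      Z = β zero ℤ.* (+ f zero ℤ.- + g zero)
      Y = weigh m β′ f′ ℤ.- weigh m β′ g′
      weigh-∷ : ∀ h → weigh (ℕ.suc m) β h ≡ (+ h zero ℤ.* q) ℤ.* β zero ℤ.+ weigh m β′ (λ i → h (suc i))
      weigh-∷ h = trans (∑-∷ _) (cong (λ x → x ℤ.* β zero ℤ.+ weigh m β′ (λ i → h (suc i))) (ℤ.pos-* (h zero) (p ^ m)))
      split : weigh (ℕ.suc m) β f ℤ.- weigh (ℕ.suc m) β g ≡ Z ℤ.* q ℤ.+ Y
      split = trans (cong₂ ℤ._-_ (weigh-∷ f) (weigh-∷ g)) (rearrange (+ f zero) (+ g zero) q (β zero) (weigh m β′ f′) (weigh m β′ g′))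
        where
        rearrange : ∀ f g q b F G → ((f ℤ.* q) ℤ.* b ℤ.+ F) ℤ.- ((g ℤ.* q) ℤ.* b ℤ.+ G) ≡ b ℤ.* (f ℤ.- g) ℤ.* q ℤ.+ (F ℤ.- G)
        rearrange = solve-∀
      d′ : + p ℤ.* q ℤ.∣ Z ℤ.* q ℤ.+ Y
      d′ = ≡.subst₂ ℤ._∣_ (ℤ.pos-* p (p ^ m)) split d
      tail-eq : ∀ i → f (suc i) ≡ g (suc i)
      tail-eq = weigh-injective m β′ (λ i → cop (suc i)) f′ g′ (λ i → f<p (suc i)) (λ i → g<p (suc i))
        (ℤ.∣m+n∣m⇒∣n {m = Z ℤ.* q} (ℤ.∣-trans (ℤ.divides (+ p) refl) d′) (ℤ.divides Z refl))
      Y≡0 : Y ≡ + 0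
      Y≡0 = trans (cong (λ x → x ℤ.- weigh m β′ g′) (∑-cong (λ i → cong (λ x → + (x ℕ.* _) ℤ.* β′ i) (tail-eq i)))) (ℤ.+-inverseʳ (weigh m β′ g′))
      p∣Z : + p ℤ.∣ Z
      p∣Z = ℤ.*-cancelʳ-∣ q {{ℕ.m^n≢0 p m}} (subst (λ x → + p ℤ.* q ℤ.∣ x) (trans (cong (λ x → Z ℤ.* q ℤ.+ x) Y≡0) (ℤ.+-identityʳ _)) d′)
      head-eq : f zero ≡ g zero
      head-eq = ℤ.+-injective (AbelianGroupProperties.x∙y⁻¹≈ε⇒x≈y ℤ.+-0-abelianGroup (+ f zero) (+ g zero)
        (small-multiple (∣f-g∣<p (f<p zero) (g<p zero))
          (Coprime.coprime-divisor (+ p) (β zero) (+ f zero ℤ.- + g zero) (Coprime.sym {β zero} {+ p} (cop zero)) (ℤ.∣⇒∣ᵤ p∣Z))))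

  𝔟≡∑ : ∀ s → 𝔟 s ≡ ∑ (λ i → + (digit s i ℕ.* p ^ exponent i) ℤ.* β i)
  𝔟≡∑ s = sym (∑≈sum _)

  𝔟-sum : ∀ {s t u} → Sum s t u → 𝔟 u ≡ 𝔟 s ℤ.+ 𝔟 t
  𝔟-sum {s} {t} {u} σ = trans (𝔟≡∑ u) (trans (∑-cong (λ i → trans (cong (λ x → + (x ℕ.* p ^ exponent i) ℤ.* β i) (σ i)) (distrib (digit s i) (digit t i) (p ^ exponent i) (β i))))
    (trans (∑-+ _ _) (cong₂ ℤ._+_ (sym (𝔟≡∑ s)) (sym (𝔟≡∑ t)))))
    where
    distrib : ∀ a b c d → + ((a ℕ.+ b) ℕ.* c) ℤ.* d ≡ + (a ℕ.* c) ℤ.* d ℤ.+ + (b ℕ.* c) ℤ.* d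
    distrib a b c d = trans (cong (λ x → + x ℤ.* d) (ℕ.*-distribʳ-+ c a b)) (ℤ.*-distribʳ-+ d (+ (a ℕ.* c)) (+ (b ℕ.* c)))

  𝔟-0ˢ : 𝔟 0ˢ ≡ + 0
  𝔟-0ˢ = AbelianGroupProperties.identityʳ-unique ℤ.+-0-abelianGroup (𝔟 0ˢ) (𝔟 0ˢ) (sym (𝔟-sum {0ˢ} {0ˢ} {0ˢ} (0ˢ-sum 0ˢ)))

  𝔟-injective : ∀ {s t} → + (p ^ n) ℤ.∣ 𝔟 s ℤ.- 𝔟 t → s ≡ t
  𝔟-injective {s} {t} d = digits-injective (weigh-injective n β coprime (digit s) (digit t) (digit<p s) (digit<p t)
    (≡.subst₂ (λ x y → + (p ^ n) ℤ.∣ x ℤ.- y) (𝔟≡∑ s) (𝔟≡∑ t) d))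

  private
    p-1<p : p ∸ 1 ℕ.< p
    p-1<p = ℕ.∸-monoʳ-< {p} {1} {0} (ℕ.s≤s ℕ.z≤n) (ℕ.n≢0⇒n>0 (ℕ.≢-nonZero⁻¹ p))

    M-digits = fromDigits (λ _ → p ∸ 1) (λ _ → p-1<p)
    M = proj₁ M-digits

    ≼M : ∀ s → s ≼ M
    ≼M s i = subst (digit s i ℕ.≤_) (sym (proj₂ M-digits i)) (ℕ.∸-monoˡ-≤ 1 (digit<p s i))

    -- No geometric sum is evaluated: m ≼ M gives m ≤ M as numbers, and M ≤ pⁿ - 1 since M < pⁿ.
    ≡M : ∀ {m} → toℕ m ≡ p ^ n ∸ 1 → m ≡ M
    ≡M {m} m-max = Fin.toℕ-injective (ℕ.≤-antisym
      (subst (toℕ m ℕ.≤_) (sym (sum-toℕ {m} {M -ˢ m} {M} (-ˢ-sum (≼M m)))) (ℕ.m≤m+n (toℕ m) _))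
      (subst (toℕ M ℕ.≤_) (sym m-max) (ℕ.∸-monoˡ-≤ 1 (Fin.toℕ<n M))))

  maximal-≽ : ∀ {m} → toℕ m ≡ p ^ n ∸ 1 → ∀ s → s ≼ m
  maximal-≽ {m} m-max s = subst (s ≼_) (sym (≡M m-max)) (≼M s)

  digit-maximal : ∀ {m} → toℕ m ≡ p ^ n ∸ 1 → ∀ i → digit m i ≡ p ∸ 1
  digit-maximal m-max i = trans (cong (λ m → digit m i) (≡M m-max)) (proj₂ M-digits i)

  𝔞-spec : ∀ t → + (p ^ n) ℤ.∣ (𝔟 (𝔞 t) ℤ.+ t) ⊎ (𝔞 t ≡ 0ˢ × ¬ (∃[ s ] + (p ^ n) ℤ.∣ (𝔟 s ℤ.+ t)))
  𝔞-spec t with Fin.any? (λ s → + (p ^ n) ℤ.∣? (𝔟 s ℤ.+ t))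
  ... | yes (s , d) = inj₁ d
  ... | no ¬∃       = inj₂ (refl , ¬∃)

  -- A failed search would return 0ˢ, so pⁿ - 1 = 0, and divisibility by pⁿ = 1 holds anyway.
  𝔞-divides : ∀ {b} → toℕ (𝔞 b) ≡ p ^ n ∸ 1 → + (p ^ n) ℤ.∣ (𝔟 (𝔞 b) ℤ.+ b)
  𝔞-divides {b} max with 𝔞-spec b
  ... | inj₁ d           = d
  ... | inj₂ (𝔞b≡0 , _) = subst (λ q → + q ℤ.∣ (𝔟 (𝔞 b) ℤ.+ b)) (sym p^n≡1) (ℤ.divides (𝔟 (𝔞 b) ℤ.+ b) (sym (ℤ.*-identityʳ (𝔟 (𝔞 b) ℤ.+ b))))
    where
    p^n≡1 : p ^ n ≡ 1
    p^n≡1 = trans (sym (ℕ.m+[n∸m]≡n (ℕ.m^n>0 p n)))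
      (cong ℕ.suc (trans (sym max) (trans (cong toℕ 𝔞b≡0) (Fin.toℕ-fromℕ< (ℕ.m^n>0 p n)))))

  -- 𝔞(b) -ˢ u solves the congruence that defines 𝔞(b + 𝔟(u)). Hence the search at b + 𝔟(u)
  -- succeeds, and by `𝔟-injective` it finds this solution.
  𝔞-complement : ∀ {b} → toℕ (𝔞 b) ≡ p ^ n ∸ 1 → ∀ u → Sum (𝔞 (b ℤ.+ 𝔟 u)) u (𝔞 b)
  𝔞-complement {b} max u = subst (λ a → Sum a u m) (sym a≡c) σ
    where
    m = 𝔞 b
    c = m -ˢ u
    a = 𝔞 (b ℤ.+ 𝔟 u)
    σ : Sum c u m
    σ = sum-comm {u} {c} {m} (-ˢ-sum (maximal-≽ max u))
    c-divides : + (p ^ n) ℤ.∣ (𝔟 c ℤ.+ (b ℤ.+ 𝔟 u))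
    c-divides = subst (+ (p ^ n) ℤ.∣_) (trans (cong (ℤ._+ b) (𝔟-sum {c} {u} {m} σ)) (rearrange (𝔟 c) (𝔟 u) b)) (𝔞-divides max)
      where
      rearrange : ∀ i j k → i ℤ.+ j ℤ.+ k ≡ i ℤ.+ (k ℤ.+ j)
      rearrange = solve-∀
    a-divides : + (p ^ n) ℤ.∣ (𝔟 a ℤ.+ (b ℤ.+ 𝔟 u))
    a-divides with 𝔞-spec (b ℤ.+ 𝔟 u)
    ... | inj₁ d         = d
    ... | inj₂ (_ , ¬∃) = contradiction (c , c-divides) ¬∃
    a≡c : a ≡ c
    a≡c = 𝔟-injective (subst (+ (p ^ n) ℤ.∣_) (cancel (𝔟 a) (𝔟 c) (b ℤ.+ 𝔟 u)) (ℤ.∣m∣n⇒∣m-n a-divides c-divides))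
      where
      cancel : ∀ i j k → (i ℤ.+ k) ℤ.- (j ℤ.+ k) ≡ i ℤ.- j
      cancel = solve-∀

-- Words with prescribed multiplicities

module Words (n : ℕ) where

  indicator : Fin n → Fin n → ℕ
  indicator i j with j Fin.≟ i
  ... | yes _ = 1
  ... | no  _ = 0

  indicator-≡ : ∀ i → indicator i i ≡ 1
  indicator-≡ i with i Fin.≟ i
  ... | yes _  = refl
  ... | no i≢i = contradiction refl i≢i

  indicator-≢ : ∀ {i j} → j ≢ i → indicator i j ≡ 0
  indicator-≢ {i} {j} j≢i with j Fin.≟ i
  ... | yes j≡i = contradiction j≡i j≢i
  ... | no _    = refl

  count : List (Fin n) → Fin n → ℕ
  count []      j = 0
  count (i ∷ W) j = indicator i j ℕ.+ count W j

  count-++ : ∀ W W′ j → count (W ++ W′) j ≡ count W j ℕ.+ count W′ j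
  count-++ []      W′ j = refl
  count-++ (i ∷ W) W′ j = trans (cong (indicator i j ℕ.+_) (count-++ W W′ j)) (sym (ℕ.+-assoc (indicator i j) _ _))

  count-replicate-≡ : ∀ k i → count (replicate k i) i ≡ k
  count-replicate-≡ ℕ.zero    i = refl
  count-replicate-≡ (ℕ.suc k) i = cong₂ ℕ._+_ (indicator-≡ i) (count-replicate-≡ k i)

  count-replicate-≢ : ∀ k {i j} → j ≢ i → count (replicate k i) j ≡ 0
  count-replicate-≢ ℕ.zero    j≢i = refl
  count-replicate-≢ (ℕ.suc k) j≢i = cong₂ ℕ._+_ (indicator-≢ j≢i) (count-replicate-≢ k j≢i)

  private
    -- The map φ embeds the letters not yet treated, so that the recursion on m leaves the alphabet
    -- `Fin n` unchanged.
    word′ : ∀ {m} → (Fin m → Fin n) → (Fin m → ℕ) → List (Fin n)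
    word′ {ℕ.zero}  φ f = []
    word′ {ℕ.suc m} φ f = replicate (f zero) (φ zero) ++ word′ (λ i → φ (suc i)) (λ i → f (suc i))

    count-word′-∉ : ∀ {m} (φ : Fin m → Fin n) f {k} → (∀ i → k ≢ φ i) → count (word′ φ f) k ≡ 0
    count-word′-∉ {ℕ.zero}  φ f     k∉ = refl
    count-word′-∉ {ℕ.suc m} φ f {k} k∉ = trans (count-++ (replicate (f zero) (φ zero)) _ k)
      (cong₂ ℕ._+_ (count-replicate-≢ (f zero) (k∉ zero)) (count-word′-∉ (λ i → φ (suc i)) (λ i → f (suc i)) (λ i → k∉ (suc i))))

    count-word′ : ∀ {m} (φ : Fin m → Fin n) f → Injective _≡_ _≡_ φ → ∀ j → count (word′ φ f) (φ j) ≡ f j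
    count-word′ {ℕ.suc m} φ f φ-inj zero = trans (count-++ (replicate (f zero) (φ zero)) _ (φ zero))
      (trans (cong₂ ℕ._+_ (count-replicate-≡ (f zero) (φ zero))
        (count-word′-∉ (λ i → φ (suc i)) (λ i → f (suc i)) (λ i eq → Fin.0≢1+n (φ-inj eq)))) (ℕ.+-identityʳ (f zero)))
    count-word′ {ℕ.suc m} φ f φ-inj (suc j) = trans (count-++ (replicate (f zero) (φ zero)) _ (φ (suc j)))
      (cong₂ ℕ._+_ (count-replicate-≢ (f zero) (λ eq → Fin.0≢1+n (φ-inj (sym eq))))
        (count-word′ (λ i → φ (suc i)) (λ i → f (suc i)) (λ eq → Fin.suc-injective (φ-inj eq)) j))

  word : (Fin n → ℕ) → List (Fin n)
  word = word′ (λ i → i)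

  count-word : ∀ f j → count (word f) j ≡ f j
  count-word f = count-word′ (λ i → i) f (λ eq → eq)

  count≡0⇒[] : ∀ W → (∀ j → count W j ≡ 0) → W ≡ []
  count≡0⇒[] []      _  = refl
  count≡0⇒[] (i ∷ W) eq with () ← trans (sym (cong (ℕ._+ count W i) (indicator-≡ i))) (eq i)

-- From a scaffold to adapted bases

module ScaffoldBases {k ℓk l ℓl a ℓa : Level} {p : ℕ} (p-prime : Prime p) {n : ℕ}
         {K : Field k ℓk} {vK : DiscreteValuation K}
         {L : Extension K l ℓl} {vL : DiscreteValuation (Extension.extensionField L)}
         (L/K : TotallyRamified vK L vL (p ^ n)) {A : Algebra K a ℓa} (A↷L : Action A L)
         {𝔗 : ℤ ⁺} {β : Fin n → ℤ} (coprime : ∀ i → Coprime (β i) (+ p))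
         (scaffold : Scaffold vK vL A↷L p p-prime n β 𝔗) {h b : ℤ} (h≤b : h ℤ.≤ b)
         (𝔞b-maximal : toℕ (Shifts.𝔞 p p-prime n β b) ≡ p ^ n ∸ 1)
         (tolerance : [ + (p ^ n) ℤ.+ b ℤ.- h ] ≤⁺ 𝔗) where
  private
    instance
      p-nonZero : ℕ.NonZero p
      p-nonZero = prime⇒nonZero p-prime
      p^n-nonZero : ℕ.NonZero (p ^ n)
      p^n-nonZero = ℕ.m^n≢0 p n
    module K = Field K
    module L = Extension L
    module A = Algebra A
    module VL = Valued vL
    module ∑L = Summation L.ring
    module vK = DiscreteValuation vK
    module vL = DiscreteValuation vL
    module ι = IsRingHomomorphism L.ι-homo
    module LC = Combination L.vectorSpace
    module Act = Action A↷L
  open Valued vK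
  open Action A↷L using (_·_; ·-linearʳ)
  open Shifts p p-prime n β hiding (d; w)
  open Digits p p-prime n β
  open Residues p p-prime n β coprime
  open Table h b
  open Scaffold scaffold
  open Words n
  private
    N = + (p ^ n)
    d = Shifts.d p p-prime n β h b
    w = Shifts.w p p-prime n β h b

    ≤-via : ∀ {i j i′ j′} k → i ℤ.≤ j → i ℤ.+ k ≡ i′ → j ℤ.+ k ≡ j′ → i′ ℤ.≤ j′
    ≤-via k p refl refl = ℤ.+-monoˡ-≤ k p

    <-via : ∀ {i j i′ j′} k → i ℤ.< j → i ℤ.+ k ≡ i′ → j ℤ.+ k ≡ j′ → i′ ℤ.< j′
    <-via k p refl refl = ℤ.+-monoˡ-< k p

    -- In the place of π^i any element of value i will do, except that `Φ0≈1` requires the value 1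
    -- at i = 0.
    ϖ : ℤ → K.Carrier
    ϖ (+ ℕ.zero)      = K.1#
    ϖ i@(+ ℕ.suc _)   = proj₁ (vK.v-surjective i)
    ϖ i@(ℤ.-[1+ _ ])  = proj₁ (vK.v-surjective i)

    v-ϖ : ∀ i → vK.v (ϖ i) ≡ [ i ]
    v-ϖ (+ ℕ.zero)      = v-1#
    v-ϖ i@(+ ℕ.suc _)   = proj₂ (vK.v-surjective i)
    v-ϖ i@(ℤ.-[1+ _ ])  = proj₂ (vK.v-surjective i)

    v-ι : ∀ {c i} → vK.v c ≡ [ i ] → vL.v (L.ι c) ≡ [ N ℤ.* i ]
    v-ι {c} eq = trans (TotallyRamified.ramificationIndex L/K c) (cong (λ a → (p ^ n) ·⁺ a) eq)

    Λ : 𝕊 → L.Carrier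
    Λ u = λᴸ (b ℤ.+ 𝔟 u)

    y : 𝕊 → L.Carrier
    y u = L.ι (ϖ (ℤ.- d u)) L.* Λ u

    vy : 𝕊 → ℤ
    vy u = N ℤ.* (ℤ.- d u) ℤ.+ (b ℤ.+ 𝔟 u)

    v-y : ∀ u → vL.v (y u) ≡ [ vy u ]
    v-y u = VL.v-*-fin (v-ι (v-ϖ (ℤ.- d u))) (v-λᴸ (b ℤ.+ 𝔟 u))

    vy-lower : ∀ u → h ℤ.≤ vy u
    vy-lower u = ≤-via (h ℤ.- d u ℤ.* N) (ℤ.[n/ℕd]*d≤n (𝔟 u ℤ.+ b ℤ.- h) (p ^ n)) (eq₁ (d u) h N) (eq₂ (d u) (𝔟 u) b h N)
      where
      eq₁ : ∀ d h N → d ℤ.* N ℤ.+ (h ℤ.- d ℤ.* N) ≡ h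
      eq₁ = solve-∀
      eq₂ : ∀ d x b h N → (x ℤ.+ b ℤ.- h) ℤ.+ (h ℤ.- d ℤ.* N) ≡ N ℤ.* (ℤ.- d) ℤ.+ (b ℤ.+ x)
      eq₂ = solve-∀

    vy-upper : ∀ u → vy u ℤ.< h ℤ.+ N
    vy-upper u = <-via (h ℤ.- d u ℤ.* N) (ℤ.n<s[n/ℕd]*d (𝔟 u ℤ.+ b ℤ.- h) (p ^ n)) (eq₂ (d u) (𝔟 u) b h N) (eq₁ (d u) h N)
      where
      eq₁ : ∀ d h N → (+ 1 ℤ.+ d) ℤ.* N ℤ.+ (h ℤ.- d ℤ.* N) ≡ h ℤ.+ N
      eq₁ = solve-∀
      eq₂ : ∀ d x b h N → (x ℤ.+ b ℤ.- h) ℤ.+ (h ℤ.- d ℤ.* N) ≡ N ℤ.* (ℤ.- d) ℤ.+ (b ℤ.+ x)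
      eq₂ = solve-∀

    lc≈∑ : ∀ {m} (c : Fin m → K.Carrier) x → LC.lc c x L.≈ ∑L.∑ (λ i → L.ι (c i) L.* x i)
    lc≈∑ {ℕ.zero}  c x = L.trans (LC.lc-[] c x) (L.sym (∑L.∑-[] _))
    lc≈∑ {ℕ.suc m} c x = L.trans (LC.lc-∷ c x) (L.trans (L.+-congˡ (lc≈∑ _ _)) (L.sym (∑L.∑-∷ _)))

    ι-zero : ∀ {c} x → c K.≈ K.0# → L.ι c L.* x L.≈ L.0#
    ι-zero x c≈0 = L.trans (L.*-congʳ (L.trans (ι.⟦⟧-cong c≈0) ι.0#-homo)) (L.zeroˡ x)

    v-≈0 : ∀ {x} → x L.≈ L.0# → vL.v x ≡ ⊤⁺
    v-≈0 {x} = Equivalence.from (vL.v-∞ x)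

    -- Values of elements of K are multiples of pⁿ in L, so two nonzero terms of equal value would
    -- make 𝔟(u) and 𝔟(u′) congruent modulo pⁿ.
    terms-separated : ∀ (c : 𝕊 → K.Carrier) → VL.Separated (λ u → L.ι (c u) L.* y u)
    terms-separated c u u′ u≢u′ eq with c u ≈0? | c u′ ≈0?
    ... | yes c≈0 | _        = v-≈0 (ι-zero (y u) c≈0)
    ... | no _    | yes c′≈0 = trans eq (v-≈0 (ι-zero (y u′) c′≈0))
    ... | no c≉0  | no c′≉0  =
      let (i , vc)  = ≉0⇒v-fin c≉0
          (j , vc′) = ≉0⇒v-fin c′≉0
      in contradiction (𝔟-injective (ℤ.divides (j ℤ.- d u′ ℤ.- i ℤ.+ d u) (solution i j (d u) (d u′) (𝔟 u) (𝔟 u′) b N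
           ([]-injective (trans (sym (VL.v-*-fin (v-ι vc) (v-y u))) (trans eq (VL.v-*-fin (v-ι vc′) (v-y u′)))))))) u≢u′
      where
      []-injective : ∀ {i j : ℤ} → _≡_ {A = ℤ ⁺} [ i ] [ j ] → i ≡ j
      []-injective refl = refl
      solution : ∀ i j d d′ x x′ b N → N ℤ.* i ℤ.+ (N ℤ.* (ℤ.- d) ℤ.+ (b ℤ.+ x)) ≡ N ℤ.* j ℤ.+ (N ℤ.* (ℤ.- d′) ℤ.+ (b ℤ.+ x′)) →
        x ℤ.- x′ ≡ (j ℤ.- d′ ℤ.- i ℤ.+ d) ℤ.* N
      solution i j d d′ x x′ b N eq = trans (eq₁ i d x x′ b N) (trans (cong (λ z → z ℤ.- (N ℤ.* i ℤ.- N ℤ.* d ℤ.+ b ℤ.+ x′)) eq) (eq₂ i j d d′ x′ b N))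
        where
        eq₁ : ∀ i d x x′ b N → x ℤ.- x′ ≡ (N ℤ.* i ℤ.+ (N ℤ.* (ℤ.- d) ℤ.+ (b ℤ.+ x))) ℤ.- (N ℤ.* i ℤ.- N ℤ.* d ℤ.+ b ℤ.+ x′)
        eq₁ = solve-∀
        eq₂ : ∀ i j d d′ x′ b N → (N ℤ.* j ℤ.+ (N ℤ.* (ℤ.- d′) ℤ.+ (b ℤ.+ x′))) ℤ.- (N ℤ.* i ℤ.- N ℤ.* d ℤ.+ b ℤ.+ x′) ≡ (j ℤ.- d′ ℤ.- i ℤ.+ d) ℤ.* N
        eq₂ = solve-∀

    terms∈ : ∀ {m} (c : 𝕊 → K.Carrier) → VL.V m (LC.lc c y) → ∀ u → VL.V m (L.ι (c u) L.* y u)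
    terms∈ c p = VL.V-∑⁻ (terms-separated c) (VL.V-resp (lc≈∑ c y) p)

    -- Without cancellation each term lies in the ideal that contains the sum. A coefficient of
    -- value i < m would give a term of value Ni + vy u < Ni + h + N ≤ h + Nm.
    y-reduced : ∀ {m} c → VL.V (h ℤ.+ N ℤ.* m) (LC.lc c y) → ∀ u → V m (c u)
    y-reduced {m} c p u with c u ≈0?
    ... | yes c≈0 = V-resp (K.sym c≈0) V-0#
    ... | no c≉0  = let (i , vc) = ≉0⇒v-fin c≉0 in V-≤ (bound i (VL.v≡⇒V-≤ (VL.v-*-fin (v-ι vc) (v-y u)) (terms∈ c p u))) (v⇒V vc)
      where
      bound : ∀ i → h ℤ.+ N ℤ.* m ℤ.≤ N ℤ.* i ℤ.+ vy u → m ℤ.≤ i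
      bound i le = ℤ.≮⇒≥ λ i<m → ℤ.<-irrefl refl (ℤ.<-≤-trans
        (ℤ.≤-<-trans le (ℤ.+-monoʳ-< (N ℤ.* i) (vy-upper u)))
        (≤-via h (ℤ.*-monoˡ-≤-nonNeg N (ℤ.i<j⇒suc[i]≤j i<m)) (eq N i h) (ℤ.+-comm (N ℤ.* m) h)))
        where
        eq : ∀ N i h → N ℤ.* (+ 1 ℤ.+ i) ℤ.+ h ≡ N ℤ.* i ℤ.+ (h ℤ.+ N)
        eq = solve-∀

    y-basis : LC.Basis y
    y-basis = record
      { generates = independent⇒generates L.vectorSpace (proj₁ (proj₂ (TotallyRamified.degree L/K))) independent
      ; independent = independent }
      where
      open DivisionRing K.ring _≈0? K.1≉0
        (λ _ x≉0 → proj₁ (K.inverse x≉0) , K.trans (K.*-comm _ _) (proj₂ (K.inverse x≉0)))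
      independent : LinearlyIndependent L.vectorSpace y
      independent c eq u = ⋂V⇒≈0 λ m → y-reduced {m} c (VL.V-resp (L.sym (L.trans (LC.lc≈linearCombination c y) eq)) VL.V-0#) u

    open LC.Basis y-basis

    step : Fin n → ℤ
    step i = + (p ^ exponent i) ℤ.* β i

    -- A finite lower bound for 𝔗, in which all error terms are measured; 𝔗 itself may be ∞.
    T₀ : ℤ
    T₀ = N ℤ.+ b ℤ.- h

    0≤T₀ : + 0 ℤ.≤ T₀
    0≤T₀ = ℤ.≤-trans (ℤ.i≤j⇒0≤j-i h≤b)
      (≤-via (b ℤ.- h) (ℤ.+≤+ {0} {p ^ n} ℕ.z≤n) (ℤ.+-identityˡ (b ℤ.- h)) (sym (ℤ.+-assoc N b (ℤ.- h))))

    𝔓^𝔗⇒V : ∀ {r} → vL.𝔓^ 𝔗 r → VL.V T₀ r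
    𝔓^𝔗⇒V = ≤⁺.≤⁺-trans ℤ.≤-trans tolerance

    -- By `𝔞-complement` the digit of 𝔞(b + 𝔟(u)) at i is p - 1 minus that of u. The case
    -- distinction of the scaffold is therefore whether 1 can be added to this digit of u without a
    -- carry.
    Ψ·Λ : ∀ i u → let target = λᴸ (b ℤ.+ 𝔟 u ℤ.+ step i); error = VL.V (b ℤ.+ 𝔟 u ℤ.+ step i ℤ.+ T₀) in
      (digit u i ℕ.< p ∸ 1 → ∃[ c ] Unit c × error (Ψ i · Λ u L.- L.ι c L.* target)) ×
      (digit u i ≡ p ∸ 1 → error (Ψ i · Λ u))
    Ψ·Λ i u = let ((c , c∈) , ((c⁻¹ , c⁻¹∈) , cc⁻¹≈1 , _) , below , top) = Ψ·λᴸ i (b ℤ.+ 𝔟 u) in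
      (λ lt → c , Unit-*⁻ c∈ c⁻¹∈ (trans (vK.v-cong cc⁻¹≈1) v-1#) ,
        from-congruence (below (ℕ.n≢0⇒n>0 λ eq → ℕ.<⇒≢ lt (trans (cong (ℕ._+ digit u i) (sym eq)) complement)))) ,
      (λ eq → VL.V-resp (L.trans (L.+-congˡ (RingProperties.-0#≈0# L.ring)) (L.+-identityʳ _))
        (from-congruence (top (ℕ.+-cancelʳ-≡ (digit u i) _ 0 (trans complement (sym eq))))))
      where
      complement : digit (𝔞 (b ℤ.+ 𝔟 u)) i ℕ.+ digit u i ≡ p ∸ 1
      complement = trans (sym (𝔞-complement 𝔞b-maximal u i)) (digit-maximal 𝔞b-maximal i)
      from-congruence : ∀ {x y} → CongruentMod vK vL A↷L p p-prime n β (λᴸ (b ℤ.+ 𝔟 u ℤ.+ step i)) 𝔗 x y →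
        VL.V (b ℤ.+ 𝔟 u ℤ.+ step i ℤ.+ T₀) (x L.- y)
      from-congruence (r , r∈ , eq) = VL.V-resp (L.sym eq) (VL.V-* (VL.v⇒V (v-λᴸ _)) (𝔓^𝔗⇒V r∈))

    ι-V0 : ∀ {c} → Unit c → VL.V (+ 0) (L.ι c)
    ι-V0 u = VL.v⇒V (trans (v-ι u) (cong [_] (ℤ.*-zeroʳ N)))

    o≤o+T₀ : ∀ o → o ℤ.≤ o ℤ.+ T₀
    o≤o+T₀ o = subst (ℤ._≤ o ℤ.+ T₀) (ℤ.+-identityʳ o) (ℤ.+-monoʳ-≤ o 0≤T₀)

    Ψ·Λ∈ : ∀ i u → VL.V (b ℤ.+ 𝔟 u ℤ.+ step i) (Ψ i · Λ u)
    Ψ·Λ∈ i u with digit u i ℕ.<? p ∸ 1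
    ... | yes lt = let (c , c-unit , err) = proj₁ (Ψ·Λ i u) lt in
      VL.V-≡ (VL.V-≤ (o≤o+T₀ _) err) (VL.V-0* (ι-V0 c-unit) (VL.v⇒V (v-λᴸ _)))
    ... | no ≮ = VL.V-≤ (o≤o+T₀ _) (proj₂ (Ψ·Λ i u) (ℕ.≤-antisym (ℕ.∸-monoˡ-≤ 1 (digit<p u i)) (ℕ.≮⇒≥ ≮)))

    ·-lc : ∀ α {m} (c : Fin m → K.Carrier) x → α · LC.lc c x L.≈ LC.lc c (λ i → α · x i)
    ·-lc α = LinearMap.lc-map L.vectorSpace L.vectorSpace (α ·_) Act.*ₗ-congˡ (Act.*ₗ-distribˡ α) (λ c x → ·-linearʳ c α x)

    ·-- : ∀ α x z → α · (x L.- z) L.≈ α · x L.- α · z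
    ·-- α x z = L.trans (Act.*ₗ-distribˡ α x (L.- z)) (L.+-congˡ (AbelianGroupProperties.inverseʳ-unique L.+-abelianGroup _ _
      (L.trans (L.sym (Act.*ₗ-distribˡ α z (L.- z))) (L.trans (Act.*ₗ-congˡ (L.-‿inverseʳ z)) (Act.*ₗ-zeroʳ α)))))

    -- In the expansion of x in the y_u every term has value at least j, and `Ψ·Λ∈` raises each of
    -- these values by `step i`. This carries error terms through the remaining factors of a
    -- product.
    Ψ-shift : ∀ i {j x} → VL.V j x → VL.V (j ℤ.+ step i) (Ψ i · x)
    Ψ-shift i {j} {x} x∈ = VL.V-resp (L.sym (L.trans (Act.*ₗ-congˡ (expand x)) (L.trans (·-lc (Ψ i) (coord x) y) (lc≈∑ _ _))))
      (VL.V-∑ λ u → subst (λ o → VL.V o (L.ι (coord x u) L.* (Ψ i · y u))) (eq₂ j (vy u) (step i))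
        (VL.V-* (VL.V-cancelˡ (v-y u) (subst (λ o → VL.V o (y u L.* L.ι (coord x u))) (sym (eq₁ (vy u) j))
                  (VL.V-resp (L.*-comm _ _) (terms∈ (coord x) (VL.V-resp (expand x) x∈) u))))
                (Ψ·y∈ u)))
      where
      eq₁ : ∀ i j → i ℤ.+ (j ℤ.- i) ≡ j
      eq₁ = solve-∀
      eq₂ : ∀ j i e → (j ℤ.- i) ℤ.+ (i ℤ.+ e) ≡ j ℤ.+ e
      eq₂ = solve-∀
      Ψ·y∈ : ∀ u → VL.V (vy u ℤ.+ step i) (Ψ i · y u)
      Ψ·y∈ u = subst (λ o → VL.V o (Ψ i · y u)) (sym (ℤ.+-assoc (N ℤ.* (ℤ.- d u)) (b ℤ.+ 𝔟 u) (step i)))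
        (VL.V-resp (L.sym (·-linearʳ (ϖ (ℤ.- d u)) (Ψ i) (Λ u))) (VL.V-* (VL.v⇒V (v-ι (v-ϖ (ℤ.- d u)))) (Ψ·Λ∈ i u)))

    Ψʷ : List (Fin n) → A.Carrier
    Ψʷ []      = A.1#
    Ψʷ (i ∷ W) = Ψ i A.* Ψʷ W

    degree : List (Fin n) → ℤ
    degree []      = + 0
    degree (i ∷ W) = degree W ℤ.+ step i

    Reach : List (Fin n) → 𝕊 → 𝕊 → Set
    Reach W u t = ∀ j → digit t j ≡ count W j ℕ.+ digit u j

    module ∑ℤ = Summation ℤ.+-*-ring

    weight : (Fin n → ℕ) → ℤ
    weight f = ∑ℤ.∑ (λ i → + (f i ℕ.* p ^ exponent i) ℤ.* β i)

    weight-+ : ∀ f g → weight (λ i → f i ℕ.+ g i) ≡ weight f ℤ.+ weight g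
    weight-+ f g = trans (∑ℤ.∑-cong (λ i → trans (cong (λ x → + x ℤ.* β i) (ℕ.*-distribʳ-+ (p ^ exponent i) (f i) (g i)))
      (ℤ.*-distribʳ-+ (β i) (+ (f i ℕ.* p ^ exponent i)) (+ (g i ℕ.* p ^ exponent i))))) (∑ℤ.∑-+ _ _)

    degree≡weight : ∀ W → degree W ≡ weight (count W)
    degree≡weight []      = sym (∑ℤ.∑-zero (λ i → refl))
    degree≡weight (i ∷ W) = trans (ℤ.+-comm (degree W) (step i)) (trans (cong₂ ℤ._+_ (sym single-step) (degree≡weight W))
      (sym (weight-+ (indicator i) (count W))))
      where
      single-step : weight (indicator i) ≡ step i
      single-step = trans (∑ℤ.∑-single _ i (λ j j≢i → cong (λ x → + (x ℕ.* p ^ exponent j) ℤ.* β j) (indicator-≢ j≢i)))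
        (trans (cong (λ x → + (x ℕ.* p ^ exponent i) ℤ.* β i) (indicator-≡ i)) (cong (λ x → + x ℤ.* β i) (ℕ.*-identityˡ (p ^ exponent i))))

    𝔟-reach : ∀ W {u t} → Reach W u t → 𝔟 t ≡ 𝔟 u ℤ.+ degree W
    𝔟-reach W {u} {t} ρ = trans (𝔟≡∑ t) (trans (∑ℤ.∑-cong (λ i → cong (λ x → + (x ℕ.* p ^ exponent i) ℤ.* β i) (ρ i)))
      (trans (weight-+ (count W) (digit u)) (trans (ℤ.+-comm (weight (count W)) (weight (digit u)))
        (cong₂ ℤ._+_ (sym (𝔟≡∑ u)) (sym (degree≡weight W))))))

    reach? : ∀ W u t → Dec (Reach W u t)
    reach? W u t = Fin.all? (λ j → digit t j ℕ.≟ count W j ℕ.+ digit u j)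

    Error : List (Fin n) → 𝕊 → L.Carrier → Set
    Error W u = VL.V (b ℤ.+ 𝔟 u ℤ.+ degree W ℤ.+ T₀)

    Moves : List (Fin n) → 𝕊 → Set _
    Moves W u = (∀ t → Reach W u t → ∃[ c ] Unit c × Error W u (Ψʷ W · Λ u L.- L.ι c L.* Λ t)) ×
                ((∀ t → ¬ Reach W u t) → Error W u (Ψʷ W · Λ u))

    -- Induction on the word, whose first letter acts last. Once a digit has overflowed only an
    -- error remains, and `Ψ-shift` raises it along with the degree; otherwise the new letter is
    -- applied to the element Λ t′ reached so far. The precision relative to the expected value
    -- stays T₀ throughout.
    Ψʷ·Λ : ∀ W u → Moves W u
    Ψʷ·Λ [] u = (λ t ρ → K.1# , v-1# , VL.≈⇒V (L.trans (Act.*ₗ-identityˡ (Λ u)) (L.sym (L.trans (L.*-congʳ ι.1#-homo)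
        (L.trans (L.*-identityˡ (Λ t)) (L.reflexive (cong Λ (digits-injective ρ)))))))) ,
      (λ none → contradiction (λ j → refl) (none u))
    Ψʷ·Λ (i ∷ W) u with Fin.any? (reach? W u)
    ... | no none = (λ t ρ → contradiction (intermediate t ρ) none) , λ _ →
      subst (λ o → VL.V o (Ψʷ (i ∷ W) · Λ u)) (reorder b (𝔟 u) (degree W) (step i) T₀)
        (VL.V-resp (L.sym (Act.*ₗ-assoc (Ψ i) (Ψʷ W) (Λ u))) (Ψ-shift i (proj₂ (Ψʷ·Λ W u) (λ t ρ → none (t , ρ)))))
      where
      reorder : ∀ b x D e T → b ℤ.+ x ℤ.+ D ℤ.+ T ℤ.+ e ≡ b ℤ.+ x ℤ.+ (D ℤ.+ e) ℤ.+ T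
      reorder = solve-∀
      intermediate : ∀ t → Reach (i ∷ W) u t → ∃[ t′ ] Reach W u t′
      intermediate t ρ = fromDigits (λ j → count W j ℕ.+ digit u j) (λ j → ℕ.≤-<-trans
        (subst (count W j ℕ.+ digit u j ℕ.≤_) (sym (trans (ρ j) (ℕ.+-assoc (indicator i j) (count W j) (digit u j)))) (ℕ.m≤n+m _ (indicator i j)))
        (digit<p t j))
    ... | yes (t′ , ρ′) = reached , unreached
      where
      reorder : ∀ b x D e T → b ℤ.+ x ℤ.+ D ℤ.+ T ℤ.+ e ≡ b ℤ.+ x ℤ.+ (D ℤ.+ e) ℤ.+ T
      reorder = solve-∀
      reorder′ : ∀ b x D e → b ℤ.+ (x ℤ.+ D) ℤ.+ e ≡ b ℤ.+ x ℤ.+ (D ℤ.+ e)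
      reorder′ = solve-∀
      IH = proj₁ (Ψʷ·Λ W u) t′ ρ′
      c′ = proj₁ IH
      c′-unit = proj₁ (proj₂ IH)
      position : b ℤ.+ 𝔟 t′ ℤ.+ step i ≡ b ℤ.+ 𝔟 u ℤ.+ degree (i ∷ W)
      position = trans (cong (λ x → b ℤ.+ x ℤ.+ step i) (𝔟-reach W ρ′)) (reorder′ b (𝔟 u) (degree W) (step i))
      digit-cons : ∀ j → count (i ∷ W) j ℕ.+ digit u j ≡ indicator i j ℕ.+ digit t′ j
      digit-cons j = trans (ℕ.+-assoc (indicator i j) (count W j) (digit u j)) (cong (indicator i j ℕ.+_) (sym (ρ′ j)))
      first : Error (i ∷ W) u (Ψʷ (i ∷ W) · Λ u L.- L.ι c′ L.* (Ψ i · Λ t′))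
      first = subst (λ o → VL.V o (Ψʷ (i ∷ W) · Λ u L.- L.ι c′ L.* (Ψ i · Λ t′))) (reorder b (𝔟 u) (degree W) (step i) T₀)
        (VL.V-resp (L.trans (·-- (Ψ i) _ _) (L.+-cong (L.sym (Act.*ₗ-assoc (Ψ i) (Ψʷ W) (Λ u))) (L.-‿cong (·-linearʳ c′ (Ψ i) (Λ t′)))))
          (Ψ-shift i (proj₂ (proj₂ IH))))
      reached : ∀ t → Reach (i ∷ W) u t → ∃[ c ] Unit c × Error (i ∷ W) u (Ψʷ (i ∷ W) · Λ u L.- L.ι c L.* Λ t)
      reached t ρ = let (c , c-unit , err) = proj₁ (Ψ·Λ i t′) lt in
        c′ K.* c , v-*-fin c′-unit c-unit , VL.V-trans first (second c err)
        where
        -- The digit of t at i is one more than that of t′, and is still below p.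
        lt : digit t′ i ℕ.< p ∸ 1
        lt = ℕ.m+n≤o⇒m≤o∸n (ℕ.suc (digit t′ i)) (subst (ℕ._≤ p) (ℕ.+-comm 1 _)
          (subst (ℕ._< p) (trans (ρ i) (trans (digit-cons i) (cong (ℕ._+ digit t′ i) (indicator-≡ i)))) (digit<p t i)))
        target≡ : λᴸ (b ℤ.+ 𝔟 t′ ℤ.+ step i) ≡ Λ t
        target≡ = cong λᴸ (trans position (trans (ℤ.+-assoc b (𝔟 u) _) (cong (λ x → b ℤ.+ x) (sym (𝔟-reach (i ∷ W) ρ)))))
        second : ∀ c → VL.V (b ℤ.+ 𝔟 t′ ℤ.+ step i ℤ.+ T₀) (Ψ i · Λ t′ L.- L.ι c L.* λᴸ (b ℤ.+ 𝔟 t′ ℤ.+ step i)) →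
          Error (i ∷ W) u (L.ι c′ L.* (Ψ i · Λ t′) L.- L.ι (c′ K.* c) L.* Λ t)
        second c err = VL.V-resp (L.trans (L.distribˡ _ _ _) (L.+-congˡ (L.trans (L.sym (RingProperties.-‿distribʳ-* L.ring _ _))
            (L.-‿cong (L.trans (L.sym (L.*-assoc _ _ _)) (L.*-cong (L.sym (ι.*-homo c′ c)) (L.reflexive target≡)))))))
          (VL.V-0* (ι-V0 c′-unit) (subst (λ o → VL.V (o ℤ.+ T₀) _) position err))
      unreached : (∀ t → ¬ Reach (i ∷ W) u t) → Error (i ∷ W) u (Ψʷ (i ∷ W) · Λ u)
      unreached none = VL.V-≡ first (VL.V-0* (ι-V0 c′-unit) (subst (λ o → VL.V (o ℤ.+ T₀) (Ψ i · Λ t′)) position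
        (proj₂ (Ψ·Λ i t′) (ℕ.≤-antisym (ℕ.∸-monoˡ-≤ 1 (digit<p t′ i)) (ℕ.≮⇒≥ full)))))
        where
        -- Otherwise adding 1 to the digit of t′ at i would give an element reached by the longer
        -- word.
        full : ¬ digit t′ i ℕ.< p ∸ 1
        full lt = let (t , ρ) = fromDigits (λ j → count (i ∷ W) j ℕ.+ digit u j) (λ j → subst (ℕ._< p) (sym (digit-cons j)) (bound j)) in none t ρ
          where
          bound : ∀ j → indicator i j ℕ.+ digit t′ j ℕ.< p
          bound j with j Fin.≟ i
          ... | no _     = digit<p t′ j
          ... | yes refl = ℕ.≤-trans (ℕ.s≤s lt) (ℕ.≤-reflexive (ℕ.m+[n∸m]≡n (ℕ.n≢0⇒n>0 (ℕ.≢-nonZero⁻¹ p))))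

    W : 𝕊 → List (Fin n)
    W s = word (digit s)

    sum⇒reach : ∀ {s u t} → Sum s u t → Reach (W s) u t
    sum⇒reach {s} {u} σ j = trans (σ j) (cong (ℕ._+ digit u j) (sym (count-word (digit s) j)))

    reach⇒sum : ∀ {s u t} → Reach (W s) u t → Sum s u t
    reach⇒sum {s} {u} ρ j = trans (ρ j) (cong (ℕ._+ digit u j) (count-word (digit s) j))

    degree-W : ∀ s → degree (W s) ≡ 𝔟 s
    degree-W s = trans (sym (ℤ.+-identityˡ (degree (W s)))) (trans (cong (ℤ._+ degree (W s)) (sym 𝔟-0ˢ))
      (sym (𝔟-reach (W s) {0ˢ} {s} (sum⇒reach {s} {0ˢ} {s} (sum-comm {0ˢ} {s} {s} (0ˢ-sum s))))))

    Φ : 𝕊 → A.Carrier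
    Φ s = A.η (ϖ (ℤ.- w s)) A.* Ψʷ (W s)

    -- Comparing w(s) with its term at u = s gives w(s) ≤ d(s) - d(0), and d(0) ≥ 0 because h ≤ b.
    N*w≤ : ∀ s → N ℤ.* w s ℤ.≤ 𝔟 s ℤ.+ b ℤ.- h
    N*w≤ s = ℤ.≤-trans (ℤ.*-monoˡ-≤-nonNeg N w≤d)
      (ℤ.≤-trans (ℤ.≤-reflexive (ℤ.*-comm N (d s))) (ℤ.[n/ℕd]*d≤n (𝔟 s ℤ.+ b ℤ.- h) (p ^ n)))
      where
      0≤d0 : + 0 ℤ.≤ d 0ˢ
      0≤d0 = ℤ.0≤n⇒0≤n/ℕd (𝔟 0ˢ ℤ.+ b ℤ.- h) (p ^ n) (subst (+ 0 ℤ.≤_)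
        (cong (ℤ._- h) (sym (trans (cong (ℤ._+ b) 𝔟-0ˢ) (ℤ.+-identityˡ b)))) (ℤ.i≤j⇒0≤j-i h≤b))
      w≤d : w s ℤ.≤ d s
      w≤d = ℤ.≤-trans (subst (ℤ._≤ d 0ˢ ℤ.+ w s) (ℤ.+-identityˡ (w s)) (ℤ.+-monoˡ-≤ (w s) 0≤d0))
        (w-≤ {s} {0ˢ} {s} (sum-comm {0ˢ} {s} {s} (0ˢ-sum s)))

    scale : 𝕊 → 𝕊 → K.Carrier
    scale s u = ϖ (ℤ.- w s) K.* ϖ (ℤ.- d u)

    v-scale : ∀ s u → vK.v (scale s u) ≡ [ ℤ.- w s ℤ.- d u ]
    v-scale s u = v-*-fin (v-ϖ (ℤ.- w s)) (v-ϖ (ℤ.- d u))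

    -- After scaling, the guaranteed value of the error is `vy u` plus 𝔟(s) + b - h - pⁿw(s) plus
    -- pⁿ. The first summand is at least h and the second is nonnegative; the term b - h of T₀ is
    -- what the second one needs.
    scaled-error : ∀ s u {x} → Error (W s) u x → VL.V (h ℤ.+ N ℤ.* + 1) (L.ι (scale s u) L.* x)
    scaled-error s u {x} err = VL.V-≤ le (VL.V-* (VL.v⇒V (v-ι (v-scale s u))) err)
      where
      le : h ℤ.+ N ℤ.* + 1 ℤ.≤ N ℤ.* (ℤ.- w s ℤ.- d u) ℤ.+ (b ℤ.+ 𝔟 u ℤ.+ degree (W s) ℤ.+ T₀)
      le = ≤-via N (ℤ.+-mono-≤ (vy-lower u) (ℤ.i≤j⇒0≤j-i (N*w≤ s)))
        (eq₁ h N) (trans (eq₂ N (w s) (d u) b (𝔟 u) (𝔟 s) h) (cong (λ x → N ℤ.* (ℤ.- w s ℤ.- d u) ℤ.+ (b ℤ.+ 𝔟 u ℤ.+ x ℤ.+ T₀)) (sym (degree-W s))))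
        where
        eq₁ : ∀ h N → h ℤ.+ + 0 ℤ.+ N ≡ h ℤ.+ N ℤ.* + 1
        eq₁ = solve-∀
        eq₂ : ∀ N w d b x z h → N ℤ.* (ℤ.- d) ℤ.+ (b ℤ.+ x) ℤ.+ (z ℤ.+ b ℤ.- h ℤ.- N ℤ.* w) ℤ.+ N ≡ N ℤ.* (ℤ.- w ℤ.- d) ℤ.+ (b ℤ.+ x ℤ.+ z ℤ.+ (N ℤ.+ b ℤ.- h))
        eq₂ = solve-∀

    Φ·y : ∀ s u → Φ s · y u L.≈ L.ι (scale s u) L.* (Ψʷ (W s) · Λ u)
    Φ·y s u = L.trans (Action.·-linearˡ A↷L (ϖ (ℤ.- w s)) (Ψʷ (W s)) (y u))
      (L.trans (L.*-congˡ (·-linearʳ (ϖ (ℤ.- d u)) (Ψʷ (W s)) (Λ u)))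
        (L.trans (L.sym (L.*-assoc _ _ _)) (L.*-congʳ (L.sym (ι.*-homo _ _)))))

    inverse-ϖ : ∀ u → ∃[ c ] (ϖ (ℤ.- d u) K.* c K.≈ K.1#) × vK.v c ≡ [ ℤ.- (ℤ.- d u) ]
    inverse-ϖ u = v-inverse (v-ϖ (ℤ.- d u))

    Φ·y-reached : ∀ {s u t} → Sum s u t →
      ∃[ c ] vK.v c ≡ [ d t ℤ.- (d u ℤ.+ w s) ] × VL.V (h ℤ.+ N ℤ.* + 1) (Φ s · y u L.- L.ι c L.* y t)
    Φ·y-reached {s} {u} {t} σ =
      let (c , c-unit , err) = proj₁ (Ψʷ·Λ (W s) u) t (sum⇒reach {s} {u} {t} σ)
          (e , ϖe≈1 , v-e)   = inverse-ϖ t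
      in (scale s u K.* c) K.* e ,
         trans (v-*-fin (v-*-fin (v-scale s u) c-unit) v-e) (cong [_] (eq (w s) (d u) (d t))) ,
         VL.V-resp (L.trans (L.distribˡ _ _ _) (L.+-cong (L.sym (Φ·y s u)) (L.trans (L.sym (RingProperties.-‿distribʳ-* L.ring _ _)) (L.-‿cong (main c e ϖe≈1)))))
           (scaled-error s u err)
      where
      eq : ∀ w d e → (ℤ.- w ℤ.- d) ℤ.+ + 0 ℤ.+ ℤ.- (ℤ.- e) ≡ e ℤ.- (d ℤ.+ w)
      eq = solve-∀
      main : ∀ c e → ϖ (ℤ.- d t) K.* e K.≈ K.1# →
        L.ι (scale s u) L.* (L.ι c L.* Λ t) L.≈ L.ι ((scale s u K.* c) K.* e) L.* y t
      main c e ϖe≈1 = begin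
        L.ι (scale s u) L.* (L.ι c L.* Λ t)                          ≈⟨ L.*-assoc _ _ _ ⟨
        (L.ι (scale s u) L.* L.ι c) L.* Λ t                          ≈⟨ L.*-congʳ (ι.*-homo _ _) ⟨
        L.ι (scale s u K.* c) L.* Λ t                                ≈⟨ L.*-congʳ (ι.⟦⟧-cong (K.trans (K.*-assoc _ _ _) (K.trans (K.*-congˡ (K.trans (K.*-comm _ _) ϖe≈1)) (K.*-identityʳ _)))) ⟨
        L.ι ((scale s u K.* c) K.* e K.* ϖ (ℤ.- d t)) L.* Λ t        ≈⟨ L.*-congʳ (ι.*-homo _ _) ⟩
        (L.ι ((scale s u K.* c) K.* e) L.* L.ι (ϖ (ℤ.- d t))) L.* Λ t ≈⟨ L.*-assoc _ _ _ ⟩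
        L.ι ((scale s u K.* c) K.* e) L.* y t                        ∎
        where open ≈-Reasoning L.setoid

    Φ·y-unreached : ∀ {s u} → (∀ t → ¬ Sum s u t) → VL.V (h ℤ.+ N ℤ.* + 1) (Φ s · y u)
    Φ·y-unreached {s} {u} none = VL.V-resp (L.sym (Φ·y s u))
      (scaled-error s u (proj₂ (Ψʷ·Λ (W s) u) (λ t ρ → none t (reach⇒sum {s} {u} {t} ρ))))

    coord∈ : ∀ {x} → VL.V (h ℤ.+ N ℤ.* + 1) x → ∀ u → V (+ 1) (coord x u)
    coord∈ {x} x∈ = y-reduced {+ 1} (coord x) (VL.V-resp (expand x) x∈)

    coord-Φ·y : ∀ {s u t} → (σ : Sum s u t) → ∀ r → V (+ 1) (coord (Φ s · y u) r K.- proj₁ (Φ·y-reached {s} {u} {t} σ) K.* coord (y t) r)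
    coord-Φ·y {s} {u} {t} σ r = V-resp (K.trans (coord-+ _ _ r) (K.+-congˡ (K.trans (coord-neg _ r) (K.-‿cong (coord-*ₗ c (y t) r)))))
      (coord∈ (proj₂ (proj₂ (Φ·y-reached {s} {u} {t} σ))) r)
      where c = proj₁ (Φ·y-reached {s} {u} {t} σ)

    acts⇒unit : ∀ {s u t} → Acts s u t → Unit (coord (Φ s · y u) t)
    acts⇒unit {s} {u} {t} (σ , eq) = Unit-≡ (coord-Φ·y {s} {u} {t} σ t) (trans (vK.v-cong (K.trans (K.*-congˡ (coord-self t)) (K.*-identityʳ _)))
      (trans (proj₁ (proj₂ (Φ·y-reached {s} {u} {t} σ))) (cong [_] (trans (cong (ℤ._- (d u ℤ.+ w s)) eq) (ℤ.+-inverseʳ (d u ℤ.+ w s))))))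

    -- If s + u has a carry, only an error term is left. Otherwise Φₛy_u is a multiple of y_t for t
    -- = s + u, up to an error; at r = t the failure of `Acts` makes `w-≤` strict, so the multiplier
    -- has value at least 1.
    ¬acts⇒𝔓 : ∀ {s u r} → ¬ Acts s u r → V (+ 1) (coord (Φ s · y u) r)
    ¬acts⇒𝔓 {s} {u} {r} ¬a = from (Fin.any? (sum? s u))
      where
      from : Dec (∃[ t ] Sum s u t) → V (+ 1) (coord (Φ s · y u) r)
      from (no none) = coord∈ (Φ·y-unreached {s} {u} (λ t σ → none (t , σ))) r
      from (yes (t , σ)) = V-≡ (coord-Φ·y {s} {u} {t} σ r) (small (r Fin.≟ t))
        where
        small : Dec (r ≡ t) → V (+ 1) (proj₁ (Φ·y-reached {s} {u} {t} σ) K.* coord (y t) r)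
        small (no r≢t)   = V-resp (K.sym (K.trans (K.*-congˡ (coord-other r≢t)) (K.zeroʳ _))) V-0#
        small (yes refl) = V-resp (K.sym (K.trans (K.*-congˡ (coord-self t)) (K.*-identityʳ _)))
          (V-≤ (≤-via (ℤ.- (d u ℤ.+ w s)) (ℤ.i<j⇒suc[i]≤j (ℤ.≤∧≢⇒< (w-≤ {s} {u} {t} σ) (λ eq → ¬a (σ , sym eq)))) (eq₁ (d u ℤ.+ w s)) refl)
            (v⇒V (proj₁ (proj₂ (Φ·y-reached {s} {u} {t} σ)))))
          where
          eq₁ : ∀ i → + 1 ℤ.+ i ℤ.+ ℤ.- i ≡ + 1
          eq₁ = solve-∀

    Φ0≈1 : Φ 0ˢ A.≈ A.1#
    Φ0≈1 = A.trans (A.*-cong (A.trans (A.reflexive (cong (λ i → A.η (ϖ (ℤ.- i))) w-0ˢ)) (IsRingHomomorphism.1#-homo A.η-homo))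
        (A.reflexive (cong Ψʷ (count≡0⇒[] (W 0ˢ) (λ j → trans (count-word (digit 0ˢ) j) (digit-0ˢ j))))))
      (A.*-identityˡ A.1#)

    Ψʷ·1≈0 : ∀ W → W ≢ [] → Ψʷ W · L.1# L.≈ L.0#
    Ψʷ·1≈0 []          ne = contradiction refl ne
    Ψʷ·1≈0 (i ∷ [])    _  = L.trans (Act.*ₗ-congʳ (A.*-identityʳ (Ψ i))) (Ψ·1 i)
    Ψʷ·1≈0 (i ∷ j ∷ W) _  = L.trans (Act.*ₗ-assoc (Ψ i) (Ψʷ (j ∷ W)) L.1#)
      (L.trans (Act.*ₗ-congˡ (Ψʷ·1≈0 (j ∷ W) (λ ()))) (Act.*ₗ-zeroʳ (Ψ i)))

    Φ·1≈0 : ∀ {s} → s ≢ 0ˢ → Φ s · L.1# L.≈ L.0#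
    Φ·1≈0 {s} s≢0 = L.trans (Action.·-linearˡ A↷L (ϖ (ℤ.- w s)) (Ψʷ (W s)) L.1#)
      (L.trans (L.*-congˡ (Ψʷ·1≈0 (W s) W≢[])) (L.zeroʳ _))
      where
      W≢[] : W s ≢ []
      W≢[] eq = s≢0 (digits-injective (λ j → trans (sym (count-word (digit s) j))
        (trans (cong (λ W → count W j) eq) (sym (digit-0ˢ j)))))

  adaptedBases : AdaptedBases L/K A↷L h shiftTable
  adaptedBases = record
    { y = y
    ; y∈ = λ u → VL.V-≤ (vy-lower u) (VL.v⇒V (v-y u))
    ; y-reduced = y-reduced
    ; y-basis = y-basis
    ; Φ = Φ
    ; Φ0≈1 = Φ0≈1
    ; Φ·1≈0 = Φ·1≈0
    ; acts⇒unit = acts⇒unit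
    ; ¬acts⇒𝔓 = ¬acts⇒𝔓
    }

theorem3p7 :
  ∀ {k ℓk l ℓl a ℓa : Level} (ℓᴵ : Level)
    (p : ℕ) (p-prime : Prime p) (n : ℕ)
    (K : Field k ℓk) (vK : DiscreteValuation K) →
    DiscreteValuation.Complete vK →
    HasCharacteristic (DiscreteValuation.residueRing vK) p →
    (L : Extension K l ℓl) (vL : DiscreteValuation (Extension.extensionField L))
    (L/K : TotallyRamified vK L vL (p ^ n))
    (A : Algebra K a ℓa) → HasDimension (Algebra.vectorSpace A) (p ^ n) →
    (A↷L : Action A L)
    (𝔗 : ℤ ⁺) → [ + 1 ] ≤⁺ 𝔗 →
    (β : Fin n → ℤ) → (∀ i → Coprime (β i) (+ p)) →
    Scaffold vK vL A↷L p p-prime n β 𝔗 →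
    (h b : ℤ) →
    let open Shifts p p-prime n β
        open AssociatedOrder L/K A↷L h
    in
    h ℤ.≤ b → b ℤ.< h ℤ.+ + (p ^ n) → toℕ (𝔞 b) ≡ p ^ n ∸ 1 →
    [ + (p ^ n) ℤ.+ b ℤ.- h ] ≤⁺ 𝔗 →
    MinimalNumberOfGenerators 𝔓ᴸʰ (∣𝒟∣ h b) ×
    (Σ[ 𝔐 ∈ Pred (Ring.Carrier 𝔄) ℓᴵ ]
     Σ[ 𝔄-local ∈ IsLocalRing 𝔄 𝔐 ]
     Σ[ κ≅𝔄/𝔐 ∈ HasResidueFieldκ (IsLocalRing.isIdeal 𝔄-local) ]
       HasDimension (cotangentSpace (IsLocalRing.isIdeal 𝔄-local) κ≅𝔄/𝔐) (∣ℰ∣ h b))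
theorem3p7 ℓᴵ p p-prime n K vK _ _ L vL L/K A A-dim A↷L 𝔗 _ β coprime scaffold h b h≤b _ 𝔞b-maximal tolerance =
  Generators.minimalNumberOfGenerators L/K A-dim A↷L h table bases ,
  Cotangent.structure ℓᴵ L/K A-dim A↷L h table bases
  where
  table : ShiftTable (p ^ n)
  table = Digits.Table.shiftTable p p-prime n β h b
  bases : AdaptedBases L/K A↷L h table
  bases = ScaffoldBases.adaptedBases p-prime L/K A↷L coprime scaffold h≤b 𝔞b-maximal tolerance
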